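{- Let $r>s\ge 1$ be integers, let $H$ be an $(r-s)$-progressive-edge-critical graph with $\chi(H)=r+1$, and let $F$ be a core of $H$. Then there exists $n_0=n_0(H,r,s)$ such that the following holds for all $n\ge n_0$. Let $G$ be an $H$-free graph on $n$ vertices. Suppose that $G$ contains a set $M\subseteq V(G)$ of size $m$ such that $G[M]$ is $F$-free and \[ m\ge \left\lceil \frac{sn}{r}\right\rceil . \] Then \[ e(G)\le m(n-m)+t_s(m)+t_{r-s}(n-m). \] Moreover, equality holds if and only if $G$ is a complete $r$-partite graph whose parts can be divided into two groups: $s$ parts with total size $m$, as equal as possible, and $r-s$ parts with total size $n-m$, as equal as possible.
   Context: All graphs are finite, simple and undirected; $e(G)$ is the number of edges of $G$, $\chi$ is the chromatic number, and $G[M]$ is the subgraph induced by $M\subseteq V(G)$. A graph is $F$-free if it contains no (not necessarily induced) subgraph isomorphic to $F$. A graph is edge-critical if it contains an edge whose deletion reduces its chromatic number. For an integer $t\ge 0$, a graph $H$ is $t$-progressive-edge-critical if $H$ is edge-critical and there exist vertices $v_1,\ldots,v_t$ of $H$ such that, for each $1\le i\le t$, the graph $H-\{v_1,\ldots,v_i\}$ (vertex deletion) is edge-critical and has chromatic number $\chi(H)-i$. For such a sequence of vertices, the graph $H-\{v_1,\ldots,v_t\}$ is called a core of $H$; in the claim, cores are taken with $t=r-s$. A graph is complete $r$-partite if its vertex set can be partitioned into $r$ independent sets (parts) such that every two vertices from distinct parts are adjacent; parts of size zero are allowed. "As equal as possible" means that the sizes of any two parts within the group differ by at most one. The Turán graph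 $T_r(n)$ is the complete $r$-partite graph on $n$ vertices in which any two part sizes differ by at most one, and $t_r(n)=e(T_r(n))$, with $t_r(0)=0$. -}

module Defs where

open import Data.Bool using (true; false)
open import Data.Fin using (Fin; zero; suc; toℕ; finToFun; funToFin)
import Data.Fin as Fin
open import Data.Fin.Properties using (all?; any?; finToFun-funToFin)
import Data.Fin.Properties as Fin
open import Data.Fin.Subset using (Subset; ∣_∣; ∁; ⋃; ⁅_⁆; _∈_)
open import Data.Fin.Subset.Properties using (_∈?_)
open import Data.List using (List; length; filter; cartesianProduct)
import Data.List as List
open import Data.Nat using (ℕ; zero; suc; _+_; _≤_; _<_; _≟_; NonZero; z≤n; s≤s)
open import Data.Nat.DivMod using (_%_)
open import Data.Product using (Σ; ∃-syntax; _×_; _,_; proj₁; proj₂)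
open import Data.Sum using (_⊎_; inj₁; inj₂)
open import Data.Vec using (Vec; _∷_; count; allFin; toList)
open import Function using (_∘_; id; _⇔_)
open import Function.Definitions using (Injective)
open import Level using (0ℓ)
open import Relation.Binary using (Rel; Symmetric; Irreflexive; Decidable)
open import Relation.Binary.PropositionalEquality using (_≡_; _≢_; _≗_; refl; sym; trans; cong)
open import Relation.Nullary using (¬_; Dec; yes; no; contradiction)
open import Relation.Nullary.Decidable using (map′; ¬?; _×-dec_; _⊎-dec_; _→-dec_)
import Relation.Unary as Unary

record Graph (n : ℕ) : Set₁ where
  field
    Adj    : Rel (Fin n) 0ℓ
    adj?   : Decidable Adj
    symm   : Symmetric Adj
    irrefl : Irreflexive _≡_ Adj

open Graph public

edges : ∀ {n} → Graph n → List (Fin n × Fin n)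
edges {n} G =
  filter (λ (u , v) → u Fin.<? v ×-dec adj? G u v)
         (cartesianProduct (List.allFin n) (List.allFin n))

e : ∀ {n} → Graph n → ℕ
e G = length (edges G)

-- The increasing enumeration of the elements of a subset.
nth : ∀ {n} (S : Subset n) → Fin ∣ S ∣ → Fin n
nth (true  ∷ S) zero    = zero
nth (true  ∷ S) (suc i) = suc (nth S i)
nth (false ∷ S) i       = suc (nth S i)

nth-injective : ∀ {n} (S : Subset n) → Injective _≡_ _≡_ (nth S)
nth-injective (true  ∷ S) {zero}  {zero}  eq = refl
nth-injective (true  ∷ S) {suc i} {suc j} eq = cong suc (nth-injective S (Fin.suc-injective eq))
nth-injective (false ∷ S)                 eq = nth-injective S (Fin.suc-injective eq)

-- The induced subgraph, its vertices renumbered in increasing order.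
_[_] : ∀ {n} → Graph n → (S : Subset n) → Graph ∣ S ∣
G [ S ] = record
  { Adj    = λ i j → Adj G (nth S i) (nth S j)
  ; adj?   = λ i j → adj? G (nth S i) (nth S j)
  ; symm   = symm G
  ; irrefl = irrefl G ∘ cong (nth S)
  }

_-vertices_ : ∀ {n} → Graph n → (S : Subset n) → Graph ∣ ∁ S ∣
G -vertices S = G [ ∁ S ]

SamePair : ∀ {n} (u v x y : Fin n) → Set
SamePair u v x y = (x ≡ u × y ≡ v) ⊎ (x ≡ v × y ≡ u)

samePair? : ∀ {n} (u v x y : Fin n) → Dec (SamePair u v x y)
samePair? u v x y =
  (x Fin.≟ u ×-dec y Fin.≟ v) ⊎-dec (x Fin.≟ v ×-dec y Fin.≟ u)

samePair-swap : ∀ {n} {u v x y : Fin n} → SamePair u v x y → SamePair u v y x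
samePair-swap (inj₁ (p , q)) = inj₂ (q , p)
samePair-swap (inj₂ (p , q)) = inj₁ (q , p)

deleteEdge : ∀ {n} → Graph n → (u v : Fin n) → Graph n
deleteEdge G u v = record
  { Adj    = λ x y → Adj G x y × ¬ SamePair u v x y
  ; adj?   = λ x y → adj? G x y ×-dec ¬? (samePair? u v x y)
  ; symm   = λ (a , ne) → symm G a , ne ∘ samePair-swap
  ; irrefl = λ eq (a , _) → irrefl G eq a
  }

Contains : ∀ {n k} → Graph n → Graph k → Set
Contains {n} {k} G F =
  Σ (Fin k → Fin n) λ f →
    Injective _≡_ _≡_ f × (∀ {u v} → Adj F u v → Adj G (f u) (f v))

_IsFreeOf_ : ∀ {n k} → Graph n → Graph k → Set
G IsFreeOf F = ¬ Contains G F

Proper : ∀ {n k} → Graph n → (Fin n → Fin k) → Set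
Proper G c = ∀ u v → Adj G u v → c u ≢ c v

Colourable : ∀ {n} → Graph n → ℕ → Set
Colourable {n} G k = Σ (Fin n → Fin k) (Proper G)

proper? : ∀ {n k} (G : Graph n) → Unary.Decidable (Proper {k = k} G)
proper? G c = all? λ u → all? λ v → adj? G u v →-dec ¬? (c u Fin.≟ c v)

proper-resp-≗ : ∀ {n k} (G : Graph n) {c d : Fin n → Fin k} → c ≗ d → Proper G c → Proper G d
proper-resp-≗ G c≗d pc u v a eq = pc u v a (trans (c≗d u) (trans eq (sym (c≗d v))))

colourable? : ∀ {n} (G : Graph n) → Unary.Decidable (Colourable G)
colourable? {n} G k = map′
  (λ (i , p) → finToFun i , p)
  (λ (c , p) → funToFin c , proper-resp-≗ G (sym ∘ finToFun-funToFin c) p)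
  (any? λ i → proper? G (finToFun {k} {n} i))

Least : (ℕ → Set) → Set
Least P = ∃[ k ] P k × (∀ j → P j → k ≤ j)

least : {P : ℕ → Set} → Unary.Decidable P → ∀ b → P b → Least P
least P? zero    p = 0 , p , λ _ _ → z≤n
least {P} P? (suc b) p with P? 0
... | yes p₀ = 0 , p₀ , λ _ _ → z≤n
... | no ¬p₀ with least (P? ∘ suc) b p
...   | k , pk , k-min = suc k , pk , min
  where
  min : ∀ j → P j → suc k ≤ j
  min zero    p₀ = contradiction p₀ ¬p₀
  min (suc j) pj = s≤s (k-min j pj)

leastColourable : ∀ {n} (G : Graph n) → Least (Colourable G)
leastColourable {n} G = least (colourable? G) n (id , λ u v a eq → irrefl G eq a)

χ : ∀ {n} → Graph n → ℕ
χ G = proj₁ (leastColourable G)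

EdgeCritical : ∀ {n} → Graph n → Set
EdgeCritical G = ∃[ u ] ∃[ v ] Adj G u v × χ (deleteEdge G u v) < χ G

-- The set {v₁, …, vᵢ}.
firstVertices : ∀ {h t} → ℕ → Vec (Fin h) t → Subset h
firstVertices i vs = ⋃ (List.map ⁅_⁆ (List.take i (toList vs)))

-- Repetitions need not be excluded: χ strictly drops at every step.
CriticalSequence : ∀ {h t} → Graph h → Vec (Fin h) t → Set
CriticalSequence {t = t} H vs = ∀ i → 1 ≤ i → i ≤ t →
  let Hᵢ = H -vertices firstVertices i vs in
  EdgeCritical Hᵢ × χ Hᵢ + i ≡ χ H

ProgressiveEdgeCritical : ∀ {h} → ℕ → Graph h → Set
ProgressiveEdgeCritical {h} t H =
  EdgeCritical H × Σ (Vec (Fin h) t) (CriticalSequence H)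

data Core {h} (t : ℕ) (H : Graph h) : ∀ {k} → Graph k → Set where
  core : (vs : Vec (Fin h) t) → CriticalSequence H vs →
         Core t H (H -vertices firstVertices t vs)

-- The parts are the residue classes modulo r, whose sizes differ by at most one.
turánGraph : (r : ℕ) .{{_ : NonZero r}} (n : ℕ) → Graph n
turánGraph r n = record
  { Adj    = λ u v → toℕ u % r ≢ toℕ v % r
  ; adj?   = λ u v → ¬? (toℕ u % r ≟ toℕ v % r)
  ; symm   = λ ne eq → ne (sym eq)
  ; irrefl = λ eq ne → ne (cong (λ u → toℕ u % r) eq)
  }

turánNumber : (r : ℕ) .{{_ : NonZero r}} → ℕ → ℕ
turánNumber r n = e (turánGraph r n)

-- A partition into r possibly empty parts is a map π sending each vertex to
-- the index of its part.
CompletePartiteWith : ∀ {n r} → Graph n → (Fin n → Fin r) → Set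
CompletePartiteWith G π = ∀ u v → Adj G u v ⇔ π u ≢ π v

partSize : ∀ {n r} → (Fin n → Fin r) → Fin r → ℕ
partSize {n} π i = count (λ v → π v Fin.≟ i) (allFin n)

-- A group of parts is given by the set I of their indices.
totalSize : ∀ {n r} → (Fin n → Fin r) → Subset r → ℕ
totalSize {n} π I = count (λ v → π v ∈? I) (allFin n)

AsEqualAsPossible : ∀ {n r} → (Fin n → Fin r) → Subset r → Set
AsEqualAsPossible π I = ∀ i j → i ∈ I → j ∈ I → partSize π i ≤ suc (partSize π j)

BalancedGroup : ∀ {n r} → (Fin n → Fin r) → Subset r → (k size : ℕ) → Set
BalancedGroup π I k size = ∣ I ∣ ≡ k × totalSize π I ≡ size × AsEqualAsPossible π I

{-# OPTIONS --safe #-}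
module Submission where

-- Write r = ρ + 1, s = σ + 1, r − s = τ + 1, and N for the complement of M, of size ν.
-- The hypotheses on G, H and F are used only through three forbidden configurations:
-- H lies in K_r(T) with an edge added to a part, F in K_s(T) with such an edge, and H in
-- the join of K_{r−s+1} with K_s(T), for T = |H| + 2.
--
-- A vertex of M of minimum degree in G[M] has at most as many neighbours in M as a vertex
-- of minimum degree in T_s(m), so its deletion does not decrease e(G) − bound.  Deletion is
-- repeated until m is the total size of the s largest parts of T_r(n), where the bound is
-- t_r(n): then Simonovits' theorem for the first configuration identifies the graph, and M
-- is the union of s of its parts.  Going back, every deleted vertex is adjacent to all of N;
-- with M and N completely joined, Simonovits' theorem in M (second configuration) and
-- Turán's theorem in N (third configuration) give the bound and its equality case.  For
-- smaller m the bound is t_r(n) itself.  If N is too small for the descent, G[M] is almost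
-- extremal and contains a large K_s(L), which is joined to N up to boundedly many vertices.
--
-- Simonovits' theorem is proved by deleting vertices of too small degree, which increases
-- the excess over the Turán number, until the minimum degree is that of the Turán graph;
-- such a graph contains a large K_r(L) by the Erdős–Stone argument, and sorting the vertices
-- by the part of K_r(L) they miss gives a proper r-colouring.

open import Defs
import Algebra.Properties.Semiring.Sum
open import Data.Bool using (Bool; true; false; not; _∧_; _∨_; if_then_else_)
import Data.Bool.Properties as Bool
open import Data.Empty using (⊥; ⊥-elim)
open import Data.Fin using (Fin; zero; suc; toℕ)
import Data.Fin as Fin
open import Data.Fin.Properties using (all?; any?; pigeonhole)
import Data.Fin.Properties as Fin
open import Data.Fin.Permutation.Components using (transpose; transpose-inverse)
open import Data.Fin.Subset using (Subset; ∣_∣; ∁; ⁅_⁆; _∈_)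
open import Data.Fin.Subset.Properties using (_∈?_; ∉⊥; x∈⁅y⁆⇒x≡y; x∈p∪q⁻; x∉p⇒x∈∁p; ∣p∣≤n; ∣∁p∣≡n∸∣p∣)
open import Data.List using (length; filter; cartesianProduct; tabulate; map; _++_)
open import Data.List.Properties using (filter-++; length-++; map-tabulate)
open import Data.Nat
open import Data.Nat.Divisibility using (divides)
open import Data.Nat.DivMod
open import Data.Nat.Properties
open import Data.Nat.Tactic.RingSolver using (solve-∀)
open import Data.Product using (Σ; ∃-syntax; _×_; _,_; proj₁; proj₂)
open import Data.Sum using (_⊎_; inj₁; inj₂; [_,_]′)
open import Data.Vec using (Vec; []; _∷_; lookup; count; allFin)
import Data.Vec as Vec
open import Data.Vec.Properties using ([]=⇒lookup; lookup⇒[]=; lookup-map; lookup∘tabulate)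
open import Function using (_⇔_; _∘_; id; mk⇔; Equivalence)
open import Relation.Binary.Definitions using (Tri; tri<; tri≈; tri>)
open import Relation.Binary.PropositionalEquality hiding ([_])
open import Relation.Nullary using (¬_; Dec; yes; no; contradiction; does)
open import Relation.Nullary.Decidable using (dec-true; dec-false; ¬?; _×-dec_)
private module Sum = Algebra.Properties.Semiring.Sum +-*-semiring

-- When M exceeds the s largest parts of T_r(n), the bound lies below t_r(n), so the extremal
-- theorem for H alone cannot give it; the deletions bring the graph to the point where the two
-- numbers agree. What they carry along is the inequality e(G) ≥ bound. The upper bound comes only
-- on the way back, where both inequalities together pinch the degree of each restored vertex.
-- Turán's theorem in N needs a K_s(T) in M that is joined to all of N, so such a copy travels
-- through the recursion together with the completeness of the join. N stays fixed, and about
-- s|N|/(r-s) vertices of M are left at the end; for a bounded N that remainder would be too small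
-- for an asymptotic theorem, which is why this case is argued separately. Two conventions keep the
-- arithmetic free of subtraction: edges are counted as ordered pairs, and degrees are expressed
-- through the number of non-neighbours, the vertex itself included, which in a complete
-- multipartite graph is the size of its part.

private variable
  n k : ℕ

-- A Farkas certificate: A ≤ B is a combination of hypotheses, and the equation a
-- semiring identity; no subtraction occurs.
certify : ∀ {A B X Y} k → A ≤ B → X + B + k ≡ Y + A → X ≤ Y
certify {A} {B} {X} {Y} k A≤B eq = +-cancelʳ-≤ A X Y (begin
  X + A      ≤⟨ +-monoʳ-≤ X A≤B ⟩
  X + B      ≤⟨ m≤m+n (X + B) k ⟩
  X + B + k  ≡⟨ eq ⟩
  Y + A      ∎)
  where open ≤-Reasoning

-- Kept opaque so that a sum determines its summand during unification.
opaque
  sum : (Fin n → ℕ) → ℕ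
  sum = Sum.sum

opaque
  unfolding sum

  sum-empty : (f : Fin 0 → ℕ) → sum f ≡ 0
  sum-empty f = refl

  sum-suc : (f : Fin (suc n) → ℕ) → sum f ≡ f zero + sum (f ∘ suc)
  sum-suc f = refl

  sum-cong : {f g : Fin n → ℕ} → (∀ i → f i ≡ g i) → sum f ≡ sum g
  sum-cong = Sum.sum-cong-≗

  sum-+ : (f g : Fin n → ℕ) → sum (λ i → f i + g i) ≡ sum f + sum g
  sum-+ = Sum.∑-distrib-+

  sum-comm : (f : Fin k → Fin n → ℕ) → sum (λ i → sum (f i)) ≡ sum (λ j → sum (λ i → f i j))
  sum-comm = Sum.∑-comm

  *-sum : ∀ c (f : Fin n → ℕ) → c * sum f ≡ sum (λ i → c * f i)
  *-sum = Sum.*-distribˡ-sum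

  sum-* : ∀ c (f : Fin n → ℕ) → sum f * c ≡ sum (λ i → f i * c)
  sum-* = Sum.*-distribʳ-sum

  sum-zero : ∀ n → sum {n} (λ _ → 0) ≡ 0
  sum-zero = Sum.sum-replicate-zero

  sum-mono : {f g : Fin n → ℕ} → (∀ i → f i ≤ g i) → sum f ≤ sum g
  sum-mono {n = zero}  f≤g = z≤n
  sum-mono {n = suc n} f≤g = +-mono-≤ (f≤g zero) (sum-mono (f≤g ∘ suc))

  sum-const : ∀ n c → sum {n} (λ _ → c) ≡ n * c
  sum-const zero    c = refl
  sum-const (suc n) c = cong (c +_) (sum-const n c)

  sum-mono-< : {f g : Fin n → ℕ} → (∀ i → f i ≤ g i) → ∀ i → f i < g i → sum f < sum g
  sum-mono-< f≤g zero    f<g = +-mono-<-≤ f<g (sum-mono (f≤g ∘ suc))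
  sum-mono-< f≤g (suc i) f<g = +-mono-≤-< (f≤g zero) (sum-mono-< (f≤g ∘ suc) i f<g)

  sum-mono-≡ : {f g : Fin n → ℕ} → (∀ i → f i ≤ g i) → sum g ≤ sum f → ∀ i → f i ≡ g i
  sum-mono-≡ {f = f} {g} f≤g g≤f i with m≤n⇒m<n∨m≡n (f≤g i)
  ... | inj₁ f<g = contradiction g≤f (<⇒≱ (sum-mono-< f≤g i f<g))
  ... | inj₂ f≡g = f≡g

  sum-<⇒∃ : {f g : Fin n → ℕ} → sum f < sum g → ∃[ i ] f i < g i
  sum-<⇒∃ {f = f} {g} Σf<Σg with any? (λ i → f i <? g i)
  ... | yes p = p
  ... | no ¬p = contradiction Σf<Σg (≤⇒≯ (sum-mono (λ i → ≮⇒≥ (λ f<g → ¬p (i , f<g)))))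

  term≤sum : (f : Fin n → ℕ) → ∀ i → f i ≤ sum f
  term≤sum f zero    = m≤m+n _ _
  term≤sum f (suc i) = ≤-trans (term≤sum (f ∘ suc) i) (m≤n+m _ _)

  two-terms≤sum : (f : Fin n → ℕ) → ∀ {i j} → i ≢ j → f i + f j ≤ sum f
  two-terms≤sum f {zero}  {zero}  i≢j = contradiction refl i≢j
  two-terms≤sum f {zero}  {suc j} i≢j = +-monoʳ-≤ _ (term≤sum (f ∘ suc) j)
  two-terms≤sum f {suc i} {zero}  i≢j =
    ≤-trans (≤-reflexive (+-comm (f (suc i)) (f zero))) (+-monoʳ-≤ _ (term≤sum (f ∘ suc) i))
  two-terms≤sum f {suc i} {suc j} i≢j =
    ≤-trans (two-terms≤sum (f ∘ suc) (i≢j ∘ cong suc)) (m≤n+m _ _)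

  -- Applied to class sizes bounded by `c`: when their sum is close to `suc n * c`, no single class
  -- can be much smaller than `c`.
  sum≤term+rest : ∀ (f : Fin (suc n) → ℕ) {c} → ∀ i → (∀ j → f j ≤ c) → sum f ≤ f i + n * c
  sum≤term+rest {n = n} f {c} zero f≤c =
    +-monoʳ-≤ _ (≤-trans (sum-mono (f≤c ∘ suc)) (≤-reflexive (sum-const n c)))
  sum≤term+rest {n = suc n} f {c} (suc i) f≤c = begin
    f zero + sum (f ∘ suc)  ≤⟨ +-mono-≤ (f≤c zero) (sum≤term+rest (f ∘ suc) i (f≤c ∘ suc)) ⟩
    c + (f (suc i) + n * c)  ≡⟨ lemma c (f (suc i)) (n * c) ⟩
    f (suc i) + (c + n * c)  ∎
    where
    open ≤-Reasoning
    lemma : ∀ x y z → x + (y + z) ≡ y + (x + z)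
    lemma = solve-∀

-- Subsets and double counting

⟦_⟧ : Bool → ℕ
⟦ true  ⟧ = 1
⟦ false ⟧ = 0

⟦⟧-mono : ∀ {b c} → (b ≡ true → c ≡ true) → ⟦ b ⟧ ≤ ⟦ c ⟧
⟦⟧-mono {false} h = z≤n
⟦⟧-mono {true}  h rewrite h refl = ≤-refl

⟦⟧-complement : ∀ b c → ⟦ b ⟧ ≡ ⟦ b ∧ c ⟧ + ⟦ b ∧ not c ⟧
⟦⟧-complement false c     = refl
⟦⟧-complement true  false = refl
⟦⟧-complement true  true  = refl

⟦⟧≤⇒true : ∀ {b k} → 0 < k → k ≤ ⟦ b ⟧ → b ≡ true
⟦⟧≤⇒true {true}  _ _ = refl
⟦⟧≤⇒true {false} (s≤s _) ()

∧-intro : ∀ {b c} → b ≡ true → c ≡ true → b ∧ c ≡ true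
∧-intro refl refl = refl

∧-elimˡ : ∀ {b c} → b ∧ c ≡ true → b ≡ true
∧-elimˡ {true} _ = refl

∧-elimʳ : ∀ {b c} → b ∧ c ≡ true → c ≡ true
∧-elimʳ {true} c = c

not-true : ∀ {b} → not b ≡ true → b ≡ false
not-true {false} _ = refl

true≢false : ∀ {b} → b ≡ true → b ≡ false → ⊥
true≢false refl ()

true∨false : ∀ b → b ≡ true ⊎ b ≡ false
true∨false true  = inj₁ refl
true∨false false = inj₂ refl

not-intro : ∀ {b} → ¬ (b ≡ true) → not b ≡ true
not-intro {true}  h = contradiction refl h
not-intro {false} h = refl

module _ {P : Set} where
  does⇒ : (P? : Dec P) → does P? ≡ true → P
  does⇒ (yes p) _ = p

  ¬does⇒ : (P? : Dec P) → does P? ≡ false → ¬ P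
  ¬does⇒ (no ¬p) _ = ¬p

Sub : ℕ → Set
Sub n = Fin n → Bool

# : Sub n → ℕ
# A = sum (λ x → ⟦ A x ⟧)

infix 4 _⊑_
_⊑_ : Sub n → Sub n → Set
A ⊑ B = ∀ x → A x ≡ true → B x ≡ true

infixr 6 _∩_ _∖_
_∩_ _∖_ : Sub n → Sub n → Sub n
(A ∩ B) x = A x ∧ B x
(A ∖ B) x = A x ∧ not (B x)

full : Sub n
full _ = true

∩⊑ˡ : (A B : Sub n) → A ∩ B ⊑ A
∩⊑ˡ A B x = ∧-elimˡ

⊑-trans : {A B C : Sub n} → A ⊑ B → B ⊑ C → A ⊑ C
⊑-trans f g x = g x ∘ f x

#-mono : {A B : Sub n} → A ⊑ B → # A ≤ # B
#-mono A⊑B = sum-mono (λ x → ⟦⟧-mono (A⊑B x))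

#-complement : (A B : Sub n) → # A ≡ # (A ∩ B) + # (A ∖ B)
#-complement A B = trans (sum-cong (λ x → ⟦⟧-complement (A x) (B x))) (sum-+ _ _)

#-≥⇒⊒ : {A B : Sub n} → A ⊑ B → # B ≤ # A → B ⊑ A
#-≥⇒⊒ {A = A} {B} A⊑B B≤A x Bx =
  ⟦⟧≤⇒true z<s (≤-reflexive (sym (trans (sum-mono-≡ (λ x → ⟦⟧-mono (A⊑B x)) B≤A x) (cong ⟦_⟧ Bx))))

#-inhabited : (A : Sub n) → 0 < # A → ∃[ x ] A x ≡ true
#-inhabited {n = n} A 0<A
  with x , lt ← sum-<⇒∃ {f = λ _ → 0} {λ x → ⟦ A x ⟧} (≤-trans (s≤s (≤-reflexive (sum-zero n))) 0<A)
  = x , ⟦⟧≤⇒true z<s lt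

∈⇒0<# : (A : Sub n) → ∀ {x} → A x ≡ true → 0 < # A
∈⇒0<# A {x} Ax = ≤-trans (≤-reflexive (cong ⟦_⟧ (sym Ax))) (term≤sum (λ x → ⟦ A x ⟧) x)

#≡0⇒∉ : (A : Sub n) → # A ≡ 0 → ∀ x → A x ≡ false
#≡0⇒∉ A A≡0 x with true∨false (A x)
... | inj₁ Ax = contradiction (∈⇒0<# A Ax) (≤⇒≯ (≤-reflexive A≡0))
... | inj₂ Ax = Ax

∉⇒#≡0 : (A : Sub n) → (∀ x → A x ≡ false) → # A ≡ 0
∉⇒#≡0 {n = n} A h = trans (sum-cong (λ x → cong ⟦_⟧ (h x))) (sum-zero n)

⁅_⁆ᵇ : Fin n → Sub n
⁅ v ⁆ᵇ x = does (v Fin.≟ x)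

∈⁅⁆ : (v : Fin n) → ⁅ v ⁆ᵇ v ≡ true
∈⁅⁆ v = dec-true (v Fin.≟ v) refl

∈⁅⁆⇒≡ : ∀ {v x : Fin n} → ⁅ v ⁆ᵇ x ≡ true → v ≡ x
∈⁅⁆⇒≡ {v = v} {x} = does⇒ (v Fin.≟ x)

opaque
  unfolding sum

  sum-⁅⁆ : (v : Fin n) (f : Fin n → ℕ) → sum (λ x → ⟦ ⁅ v ⁆ᵇ x ⟧ * f x) ≡ f v
  sum-⁅⁆ {suc n} zero    f = trans (cong₂ _+_ (+-identityʳ (f zero)) (sum-zero n)) (+-identityʳ (f zero))
  sum-⁅⁆ {suc n} (suc v) f = trans (sum-cong (λ x → cong (λ b → ⟦ b ⟧ * f (suc x)) (lemma x))) (sum-⁅⁆ v (f ∘ suc))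
    where
    lemma : ∀ x → ⁅ suc v ⁆ᵇ (suc x) ≡ ⁅ v ⁆ᵇ x
    lemma x with v Fin.≟ x
    ... | yes _ = refl
    ... | no  _ = refl

#-⁅⁆ : (v : Fin n) → # ⁅ v ⁆ᵇ ≡ 1
#-⁅⁆ v = trans (sum-cong (λ x → sym (*-identityʳ ⟦ ⁅ v ⁆ᵇ x ⟧))) (sum-⁅⁆ v (λ _ → 1))

infixl 7 _─_
_─_ : Sub n → Fin n → Sub n
A ─ v = A ∖ ⁅ v ⁆ᵇ

─⊑ : (A : Sub n) (v : Fin n) → A ─ v ⊑ A
─⊑ A v x = ∧-elimˡ

─-∈ : (A : Sub n) → ∀ {v x} → A x ≡ true → v ≢ x → (A ─ v) x ≡ true
─-∈ A {v} {x} Ax v≢x = ∧-intro Ax (cong not (dec-false (v Fin.≟ x) v≢x))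

∉─ : (A : Sub n) → ∀ {v x} → (A ─ v) x ≡ true → v ≢ x
∉─ A {v} {x} h refl = true≢false (∈⁅⁆ v) (not-true (∧-elimʳ h))

⟦⟧-─ : (A : Sub n) → ∀ {v} → A v ≡ true → ∀ x → ⟦ A x ⟧ ≡ ⟦ ⁅ v ⁆ᵇ x ⟧ + ⟦ (A ─ v) x ⟧
⟦⟧-─ A {v} Av x with v Fin.≟ x
... | yes refl rewrite Av = refl
... | no _     = cong ⟦_⟧ (sym (Bool.∧-identityʳ (A x)))

─-absent : (A : Sub n) → ∀ {v} → A v ≡ false → ∀ x → (A ─ v) x ≡ A x
─-absent A {v} v∉A x with v Fin.≟ x
... | yes refl = trans (Bool.∧-zeroʳ (A v)) (sym v∉A)
... | no _     = Bool.∧-identityʳ (A x)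

#-─ : (A : Sub n) → ∀ {v} → A v ≡ true → # A ≡ suc (# (A ─ v))
#-─ A {v} Av = trans (sum-cong (⟦⟧-─ A Av)) (trans (sum-+ _ _) (cong (_+ # (A ─ v)) (#-⁅⁆ v)))

#-─-≥ : (A : Sub n) → ∀ v → # A ≤ suc (# (A ─ v))
#-─-≥ A v with true∨false (A v)
... | inj₁ Av = ≤-reflexive (#-─ A Av)
... | inj₂ Av = ≤-trans (#-mono {A = A} {A ─ v} (λ x Ax → ─-∈ A {v} Ax (λ { refl → true≢false Ax Av }))) (n≤1+n _)

shrink : ∀ k (A : Sub n) → k ≤ # A → ∃[ B ] B ⊑ A × # B ≡ k
shrink {n} zero A _ = (λ _ → false) , (λ x ()) , sum-zero n
shrink (suc k) A k<A with x , Ax ← #-inhabited A (≤-trans z<s k<A) = aux (<-cmp (suc k) (# A))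
  where
  aux : Tri (suc k < # A) (suc k ≡ # A) (# A < suc k) → _
  aux (tri≈ _ eq _) = A , (λ _ Ax → Ax) , sym eq
  aux (tri> _ _ gt) = contradiction k<A (<⇒≱ gt)
  aux (tri< _ _ _)
    with B , B⊑ , #B ← shrink k (A ─ x) (s≤s⁻¹ (≤-trans k<A (≤-reflexive (#-─ A Ax))))
    = add
    where
    add : ∃[ C ] C ⊑ A × # C ≡ suc k
    add = C , C⊑A , trans (#-─ C Cx) (cong suc (trans C─x #B))
      where
      C : Sub _
      C y = B y ∨ ⁅ x ⁆ᵇ y
      Cx : C x ≡ true
      Cx rewrite ∈⁅⁆ x = Bool.∨-zeroʳ (B x)
      C⊑A : C ⊑ A
      C⊑A y Cy with true∨false (B y)
      ... | inj₁ By = ∧-elimˡ (B⊑ y By)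
      ... | inj₂ By rewrite By | sym (∈⁅⁆⇒≡ {v = x} {y} Cy) = Ax
      C─x : # (C ─ x) ≡ # B
      C─x = sum-cong (λ y → cong ⟦_⟧ (lemma y))
        where
        lemma : ∀ y → (C ─ x) y ≡ B y
        lemma y with true∨false (B y) | x Fin.≟ y
        ... | inj₁ By | yes refl = ⊥-elim (∉─ A (B⊑ y By) refl)
        ... | inj₁ By | no _ rewrite By = refl
        ... | inj₂ By | yes refl rewrite By = refl
        ... | inj₂ By | no _ rewrite By = refl

enumerate : ∀ k (A : Sub n) → k ≤ # A →
  Σ (Fin k → Fin n) λ f → (∀ i → A (f i) ≡ true) × (∀ {i j} → f i ≡ f j → i ≡ j)
enumerate zero    A _   = (λ ()) , (λ ()) , λ { {()} }
enumerate (suc k) A k<A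
  with x , Ax ← #-inhabited A (≤-trans z<s k<A)
  with f , f∈ , f-inj ← enumerate k (A ─ x) (s≤s⁻¹ (≤-trans k<A (≤-reflexive (#-─ A Ax))))
  = g , g∈ , g-inj
  where
  g : Fin (suc k) → _
  g zero    = x
  g (suc i) = f i
  g∈ : ∀ i → A (g i) ≡ true
  g∈ zero    = Ax
  g∈ (suc i) = ∧-elimˡ (f∈ i)
  g-inj : ∀ {i j} → g i ≡ g j → i ≡ j
  g-inj {zero}  {zero}  _  = refl
  g-inj {zero}  {suc j} eq = contradiction eq (∉─ A (f∈ j))
  g-inj {suc i} {zero}  eq = contradiction (sym eq) (∉─ A (f∈ i))
  g-inj {suc i} {suc j} eq = cong suc (f-inj eq)

sum-over : Sub n → (Fin n → ℕ) → ℕ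
sum-over A f = sum (λ x → ⟦ A x ⟧ * f x)

sum-over-≤ : (A : Sub n) {f : Fin n → ℕ} → ∀ {c} → (∀ x → A x ≡ true → f x ≤ c) → sum-over A f ≤ # A * c
sum-over-≤ A {f} {c} f≤c =
  ≤-trans (sum-mono lemma) (≤-reflexive (sym (sum-* c (λ x → ⟦ A x ⟧))))
  where
  lemma : ∀ x → ⟦ A x ⟧ * f x ≤ ⟦ A x ⟧ * c
  lemma x with A x in Ax
  ... | true  = *-monoʳ-≤ 1 (f≤c x Ax)
  ... | false = z≤n

sum-over-≥ : (A : Sub n) {f : Fin n → ℕ} → ∀ {c} → (∀ x → A x ≡ true → c ≤ f x) → # A * c ≤ sum-over A f
sum-over-≥ A {f} {c} c≤f =
  ≤-trans (≤-reflexive (sum-* c (λ x → ⟦ A x ⟧))) (sum-mono lemma)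
  where
  lemma : ∀ x → ⟦ A x ⟧ * c ≤ ⟦ A x ⟧ * f x
  lemma x with A x in Ax
  ... | true  = *-monoʳ-≤ 1 (c≤f x Ax)
  ... | false = z≤n

sum-over-+ˡ : {A B C : Sub n} (f : Fin n → ℕ) → (∀ x → ⟦ A x ⟧ ≡ ⟦ B x ⟧ + ⟦ C x ⟧) →
  sum-over A f ≡ sum-over B f + sum-over C f
sum-over-+ˡ {A = A} {B} {C} f h = trans
  (sum-cong (λ x → trans (cong (_* f x) (h x)) (*-distribʳ-+ (f x) ⟦ B x ⟧ ⟦ C x ⟧)))
  (sum-+ _ _)

sum-over-cong : (A : Sub n) {f g : Fin n → ℕ} → (∀ x → A x ≡ true → f x ≡ g x) → sum-over A f ≡ sum-over A g
sum-over-cong A {f} {g} h = sum-cong lemma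
  where
  lemma : ∀ x → ⟦ A x ⟧ * f x ≡ ⟦ A x ⟧ * g x
  lemma x with A x in Ax
  ... | true  = cong (1 *_) (h x Ax)
  ... | false = refl

-- The relation is a parameter, so that one double count serves both adjacency and non-adjacency.
cross : (Fin n → Fin n → Bool) → Sub n → Sub n → ℕ
cross b A B = sum-over A (λ x → # (B ∩ b x))

cross-comm : (b : Fin n → Fin n → Bool) → (∀ x y → b x y ≡ b y x) → ∀ A B → cross b A B ≡ cross b B A
cross-comm b b-sym A B = begin
  sum (λ x → ⟦ A x ⟧ * # (B ∩ b x))  ≡⟨ sum-cong (λ x → *-sum ⟦ A x ⟧ (λ y → ⟦ (B ∩ b x) y ⟧)) ⟩
  sum (λ x → sum (λ y → ⟦ A x ⟧ * ⟦ B y ∧ b x y ⟧))      ≡⟨ sum-comm (λ x y → ⟦ A x ⟧ * ⟦ B y ∧ b x y ⟧) ⟩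
  sum (λ y → sum (λ x → ⟦ A x ⟧ * ⟦ B y ∧ b x y ⟧))      ≡⟨ sum-cong (λ y → sum-cong (λ x → lemma (A x) (B y) (b-sym x y))) ⟩
  sum (λ y → sum (λ x → ⟦ B y ⟧ * ⟦ A x ∧ b y x ⟧))      ≡⟨ sum-cong (λ y → sym (*-sum ⟦ B y ⟧ (λ x → ⟦ (A ∩ b y) x ⟧))) ⟩
  sum (λ y → ⟦ B y ⟧ * # (A ∩ b y))  ∎
  where
  open ≡-Reasoning
  lemma : ∀ c d {e f} → e ≡ f → ⟦ c ⟧ * ⟦ d ∧ e ⟧ ≡ ⟦ d ⟧ * ⟦ c ∧ f ⟧
  lemma false false _ = refl
  lemma false true  _ = refl
  lemma true  false _ = refl
  lemma true  true  refl = refl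

-- With `P i` saying that a vertex has few neighbours in the part `i`, the first case produces too
-- many non-neighbours, and in the second `i` is the part that receives the additional edge of a
-- `PlusEdge`.
at-most-one : (P : Fin (suc k) → Set) → (∀ i → Dec (P i)) →
  (∃[ i ] ∃[ j ] i ≢ j × P i × P j) ⊎ (∃[ i ] ∀ j → j ≢ i → ¬ P j)
at-most-one P P? with any? (λ i → any? (λ j → ¬? (i Fin.≟ j) ×-dec P? i ×-dec P? j))
... | yes p = inj₁ p
... | no ¬p with any? P?
...   | yes (i , Pi) = inj₂ (i , λ j j≢i Pj → ¬p (i , j , j≢i ∘ sym , Pi , Pj))
...   | no  ¬q       = inj₂ (zero , λ j _ Pj → ¬q (j , Pj))

cls : (Fin n → Fin k) → Fin k → Sub n
cls π i x = does (π x Fin.≟ i)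

∈cls : (π : Fin n → Fin k) → ∀ x → cls π (π x) x ≡ true
∈cls π x = dec-true (π x Fin.≟ π x) refl

sum-over-cls : (S : Sub n) (π : Fin n → Fin k) (J : Sub k) →
  sum-over J (λ i → # (S ∩ cls π i)) ≡ # (S ∩ (J ∘ π))
sum-over-cls S π J = begin
  sum (λ i → ⟦ J i ⟧ * sum (λ x → ⟦ S x ∧ cls π i x ⟧))  ≡⟨ sum-cong (λ i → *-sum ⟦ J i ⟧ _) ⟩
  sum (λ i → sum (λ x → ⟦ J i ⟧ * ⟦ S x ∧ cls π i x ⟧))  ≡⟨ sum-comm _ ⟩
  sum (λ x → sum (λ i → ⟦ J i ⟧ * ⟦ S x ∧ cls π i x ⟧))  ≡⟨ sum-cong (λ x → sum-cong (λ i → lemma (J i) (S x) (cls π i x))) ⟩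
  sum (λ x → sum (λ i → ⟦ ⁅ π x ⁆ᵇ i ⟧ * ⟦ S x ∧ J i ⟧))  ≡⟨ sum-cong (λ x → sum-⁅⁆ (π x) (λ i → ⟦ S x ∧ J i ⟧)) ⟩
  sum (λ x → ⟦ S x ∧ J (π x) ⟧)  ∎
  where
  open ≡-Reasoning
  lemma : ∀ a b c → ⟦ a ⟧ * ⟦ b ∧ c ⟧ ≡ ⟦ c ⟧ * ⟦ b ∧ a ⟧
  lemma false false false = refl
  lemma false false true  = refl
  lemma false true  false = refl
  lemma false true  true  = refl
  lemma true  false false = refl
  lemma true  false true  = refl
  lemma true  true  false = refl
  lemma true  true  true  = refl

sum-over-full : (f : Fin n → ℕ) → sum-over full f ≡ sum f
sum-over-full f = sum-cong (λ i → *-identityˡ (f i))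

#-full : ∀ n → # (full {n}) ≡ n
#-full n = trans (sum-const n 1) (*-identityʳ n)

sum-cls : (S : Sub n) (π : Fin n → Fin k) → sum (λ i → # (S ∩ cls π i)) ≡ # S
sum-cls S π = trans (sym (sum-over-full _)) (trans (sum-over-cls S π full)
  (sum-cong (λ x → cong ⟦_⟧ (Bool.∧-identityʳ (S x)))))

sum-over-mono-< : (J : Sub k) {f g : Fin k → ℕ} → (∀ i → J i ≡ true → f i ≤ g i) →
  ∀ {i} → J i ≡ true → f i < g i → sum-over J f < sum-over J g
sum-over-mono-< J {f} {g} f≤g {i} Ji f<g = sum-mono-< lemma i
  (subst (λ b → ⟦ b ⟧ * f i < ⟦ b ⟧ * g i) (sym Ji) (*-monoʳ-< 1 f<g))
  where
  lemma : ∀ i → ⟦ J i ⟧ * f i ≤ ⟦ J i ⟧ * g i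
  lemma i with J i in Ji
  ... | true  = *-monoʳ-≤ 1 (f≤g i Ji)
  ... | false = z≤n

sum-over-const : (J : Sub k) → ∀ c → sum-over J (λ _ → c) ≡ # J * c
sum-over-const J c = sym (sum-* c (λ i → ⟦ J i ⟧))

Balanced : Sub k → (Fin k → ℕ) → Set
Balanced J p = ∀ i j → J i ≡ true → J j ≡ true → p i ≤ suc (p j)

-- A value below `κ` would force all the others to be at most `κ`, by balance, and the sum would
-- fall short of `# J * κ`.
balanced-≥ : (J : Sub k) {p : Fin k → ℕ} → Balanced J p → ∀ κ → # J * κ ≤ sum-over J p →
  ∀ i → J i ≡ true → κ ≤ p i
balanced-≥ J {p} bal κ le i Ji with κ ≤? p i
... | yes κ≤p = κ≤p
... | no  κ≰p = contradiction
  (subst (_≤ sum-over J p) (sym (sum-over-const J κ)) le)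
  (<⇒≱ (sum-over-mono-< J (λ j Jj → ≤-trans (bal j i Jj Ji) (≰⇒> κ≰p)) Ji (≰⇒> κ≰p)))

balanced-≤ : (J : Sub k) {p : Fin k → ℕ} → Balanced J p → ∀ κ → sum-over J p ≤ # J * κ →
  ∀ i → J i ≡ true → p i ≤ κ
balanced-≤ J {p} bal κ le i Ji with p i ≤? κ
... | yes p≤κ = p≤κ
... | no  p≰κ = contradiction
  (subst (sum-over J p ≤_) (sym (sum-over-const J κ)) le)
  (<⇒≱ (sum-over-mono-< J (λ j Jj → s≤s⁻¹ (≤-trans (≰⇒> p≰κ) (bal i j Ji Jj))) Ji (≰⇒> p≰κ)))

-- Degrees and cliques

opaque
  ex : ℕ → ℕ → ℕ
  ex ρ = turánNumber (suc ρ)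

-- ⌈ q / (ρ + 1) ⌉ for positive q; the value at q = 0 is 1.
⌈_/1+_⌉ : ℕ → ℕ → ℕ
⌈ q /1+ ρ ⌉ = suc (pred q / suc ρ)

≤*⌈⌉ : ∀ ρ q → q ≤ suc ρ * ⌈ q /1+ ρ ⌉
≤*⌈⌉ ρ zero    = z≤n
≤*⌈⌉ ρ (suc p) = begin
  suc p  ≡⟨ cong suc (m≡m%n+[m/n]*n p (suc ρ)) ⟩
  suc (p % suc ρ) + p / suc ρ * suc ρ  ≤⟨ +-monoˡ-≤ _ (m%n<n p (suc ρ)) ⟩
  suc ρ + p / suc ρ * suc ρ  ≡⟨ *-comm (suc (p / suc ρ)) (suc ρ) ⟩
  suc ρ * suc (p / suc ρ)  ∎
  where open ≤-Reasoning

*⌈⌉≤ : ∀ ρ {q} → 0 < q → suc ρ * ⌈ q /1+ ρ ⌉ ≤ q + ρ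
*⌈⌉≤ ρ {suc p} _ = begin
  suc ρ * suc (p / suc ρ)  ≡⟨ *-comm (suc ρ) (suc (p / suc ρ)) ⟩
  suc ρ + p / suc ρ * suc ρ  ≤⟨ +-monoʳ-≤ (suc ρ) (m/n*n≤m p (suc ρ)) ⟩
  suc ρ + p  ≡⟨ cong suc (+-comm ρ p) ⟩
  suc p + ρ  ∎
  where open ≤-Reasoning

module _ (G : Graph n) where

  adj : Fin n → Fin n → Bool
  adj x y = does (adj? G x y)

  adj-sym : ∀ x y → adj x y ≡ adj y x
  adj-sym x y with adj? G x y | adj? G y x
  ... | yes _ | yes _ = refl
  ... | no  _ | no  _ = refl
  ... | yes p | no ¬q = contradiction (symm G p) ¬q
  ... | no ¬p | yes q = contradiction (symm G q) ¬p

  adj-irrefl : ∀ x → adj x x ≡ false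
  adj-irrefl x = dec-false (adj? G x x) (irrefl G refl)

  adj-flip : ∀ {x y} → adj x y ≡ true → adj y x ≡ true
  adj-flip {x} {y} = trans (adj-sym y x)

  adj⇒≢ : ∀ {x y} → adj x y ≡ true → x ≢ y
  adj⇒≢ {x} xy refl = true≢false xy (adj-irrefl x)

  nonadj : Fin n → Fin n → Bool
  nonadj x y = not (adj x y)

  nonadj-sym : ∀ x y → nonadj x y ≡ nonadj y x
  nonadj-sym x y = cong not (adj-sym x y)

  -- `non A x` counts `x` itself when `x` lies in `A`. In a Turán graph it is therefore the size of
  -- the part of `x`, which is what `⌈ q /1+ ρ ⌉` is compared with.
  nbr non : Sub n → Fin n → ℕ
  nbr A x = # (A ∩ adj x)
  non A x = # (A ∩ nonadj x)

  nbr+non : ∀ A x → nbr A x + non A x ≡ # A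
  nbr+non A x = sym (#-complement A (adj x))

  non-mono : ∀ {A B} → A ⊑ B → ∀ x → non A x ≤ non B x
  non-mono A⊑B x = #-mono (λ y h → ∧-intro (A⊑B y (∧-elimˡ h)) (∧-elimʳ h))

  non≡0⇒adj : ∀ A x → non A x ≡ 0 → ∀ y → A y ≡ true → adj x y ≡ true
  non≡0⇒adj A x h y Ay with true∨false (adj x y)
  ... | inj₁ xy = xy
  ... | inj₂ xy = contradiction h (>⇒≢ (∈⇒0<# (A ∩ nonadj x) (∧-intro Ay (cong not xy))))

  nbr≡0⇒¬adj : ∀ A x → nbr A x ≡ 0 → ∀ y → A y ≡ true → adj x y ≡ false
  nbr≡0⇒¬adj A x h y Ay with true∨false (adj x y)
  ... | inj₂ xy = xy
  ... | inj₁ xy = contradiction h (>⇒≢ (∈⇒0<# (A ∩ adj x) (∧-intro Ay xy)))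

  -- Twice the number of edges inside S
  D : Sub n → ℕ
  D S = cross adj S S

  -- The degree of `v` in `S` is `# S` minus `non S v`, and deleting `v` costs twice the degree; the
  -- negative terms are moved across.
  D-─ : ∀ S {v} → S v ≡ true → D S + 2 * non S v ≡ D (S ─ v) + 2 * # S
  D-─ S {v} Sv = begin
    D S + 2 * non S v  ≡⟨ cong (_+ 2 * non S v) split ⟩
    nbr S v + (nbr S′ v + D S′) + 2 * non S v  ≡⟨ cong (λ x → nbr S v + (x + D S′) + 2 * non S v) (sym nbr-S) ⟩
    nbr S v + (nbr S v + D S′) + 2 * non S v  ≡⟨ lemma (nbr S v) (D S′) (non S v) ⟩
    D S′ + 2 * (nbr S v + non S v)  ≡⟨ cong (λ x → D S′ + 2 * x) (nbr+non S v) ⟩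
    D S′ + 2 * # S  ∎
    where
    open ≡-Reasoning
    S′ = S ─ v
    lemma : ∀ a d b → a + (a + d) + 2 * b ≡ d + 2 * (a + b)
    lemma = solve-∀
    split : D S ≡ nbr S v + (nbr S′ v + D S′)
    split = trans (sum-over-+ˡ {A = S} {⁅ v ⁆ᵇ} {S′} _ (⟦⟧-─ S Sv)) (cong₂ _+_ (sum-⁅⁆ v _)
      (trans (cross-comm adj adj-sym S′ S)
        (trans (sum-over-+ˡ {A = S} {⁅ v ⁆ᵇ} {S′} _ (⟦⟧-─ S Sv)) (cong (_+ D S′) (sum-⁅⁆ v _)))))
    nbr-S : nbr S v ≡ nbr S′ v
    nbr-S = sum-cong λ x → cong ⟦_⟧ (eq x)
      where
      eq : ∀ x → S x ∧ adj v x ≡ S′ x ∧ adj v x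
      eq x with v Fin.≟ x
      ... | yes refl rewrite adj-irrefl v = trans (Bool.∧-zeroʳ (S v)) (sym (Bool.∧-zeroʳ _))
      ... | no _ = cong (_∧ adj v x) (sym (Bool.∧-identityʳ (S x)))

  D≤#² : ∀ S → D S ≤ # S * # S
  D≤#² S = sum-over-≤ S (λ x _ → #-mono (∩⊑ˡ S (adj x)))

  Clique : Sub n → ℕ → Set
  Clique S k = Σ (Fin k → Fin n) λ f →
    (∀ i → S (f i) ≡ true) × (∀ i j → i ≢ j → adj (f i) (f j) ≡ true)

  extend-clique : ∀ S {k} ((f , _) : Clique S k) {y} → S y ≡ true → (∀ i → adj (f i) y ≡ true) → Clique S (suc k)
  extend-clique S {k} (f , f∈ , f-adj) {y} Sy y-adj = g , g∈ , g-adj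
    where
    g : Fin (suc k) → Fin n
    g zero    = y
    g (suc i) = f i
    g∈ : ∀ i → S (g i) ≡ true
    g∈ zero    = Sy
    g∈ (suc i) = f∈ i
    g-adj : ∀ i j → i ≢ j → adj (g i) (g j) ≡ true
    g-adj zero    zero    i≢j = contradiction refl i≢j
    g-adj zero    (suc j) i≢j = adj-flip (y-adj j)
    g-adj (suc i) zero    i≢j = y-adj i
    g-adj (suc i) (suc j) i≢j = f-adj i j (i≢j ∘ cong suc)

  -- Union bound: the sets of non-neighbours of the `f i` cover `S`.
  #≤Σnon : ∀ {k} S (f : Fin k → Fin n) → (∀ y → S y ≡ true → ¬ (∀ i → adj (f i) y ≡ true)) →
    # S ≤ sum (λ i → non S (f i))
  #≤Σnon S f none = ≤-trans (sum-mono lemma) (≤-reflexive (sym (sum-comm _)))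
    where
    lemma : ∀ y → ⟦ S y ⟧ ≤ sum (λ i → ⟦ S y ∧ nonadj (f i) y ⟧)
    lemma y with S y in Sy
    ... | false = z≤n
    ... | true with Fin.¬∀⟶∃¬ _ (λ i → adj (f i) y ≡ true) (λ i → adj (f i) y Bool.≟ true) (none y Sy)
    ...   | i , ¬iy = ≤-trans (≤-reflexive (cong ⟦_⟧ (sym (not-intro ¬iy)))) (term≤sum (λ i → ⟦ nonadj (f i) y ⟧) i)

  greedy-clique : ∀ S b k → (∀ x → S x ≡ true → non S x ≤ b) → k * b < # S → Clique S (suc k)
  greedy-clique S b zero non≤ 0<S with y , Sy ← #-inhabited S 0<S =
    extend-clique S ((λ ()) , (λ ()) , λ ()) Sy (λ ())
  greedy-clique S b (suc k) non≤ lt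
    with C@(f , f∈ , _) ← greedy-clique S b k non≤ (≤-trans (s≤s (m≤n+m (k * b) b)) lt)
    with any? (λ y → S y Bool.≟ true ×-dec all? (λ i → adj (f i) y Bool.≟ true))
  ... | yes (y , Sy , h) = extend-clique S C Sy h
  ... | no ¬p = contradiction
    (≤-trans (#≤Σnon S f (λ y Sy h → ¬p (y , Sy , h)))
      (≤-trans (sum-mono (λ i → non≤ _ (f∈ i))) (≤-reflexive (sum-const (suc k) b))))
    (<⇒≱ lt)

  -- Otherwise every vertex has at most `pred (# S) / suc ρ` non-neighbours. Then `suc ρ` such sets
  -- never cover `S`, and the greedy choice reaches a clique of size `ρ + 2`.
  vertex-of-small-degree : ∀ ρ S → 0 < # S → ¬ Clique S (suc (suc ρ)) →
    ∃[ v ] S v ≡ true × ⌈ # S /1+ ρ ⌉ ≤ non S v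
  vertex-of-small-degree ρ S 0<S no-clique with any? (λ v → S v Bool.≟ true ×-dec ⌈ # S /1+ ρ ⌉ ≤? non S v)
  ... | yes p = p
  ... | no ¬p = contradiction (greedy-clique S (pred (# S) / suc ρ) (suc ρ)
                  (λ x Sx → s≤s⁻¹ (≰⇒> (λ le → ¬p (x , Sx , le)))) lt) no-clique
    where
    lt : suc ρ * (pred (# S) / suc ρ) < # S
    lt = ≤-trans (s≤s (≤-trans (≤-reflexive (*-comm (suc ρ) _)) (m/n*n≤m (pred (# S)) (suc ρ))))
      (≤-reflexive (suc-pred (# S) {{>-nonZero 0<S}}))

  CompleteBalanced : ℕ → Sub n → Set
  CompleteBalanced ρ S = Σ (Fin n → Fin (suc ρ)) λ π →
    (∀ x y → S x ≡ true → S y ≡ true → adj x y ≡ not (cls π (π y) x)) ×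
    Balanced full (λ i → # (S ∩ cls π i))

  TuránBound : ℕ → Sub n → Set
  TuránBound ρ S = D S ≤ 2 * ex ρ (# S) × (D S ≡ 2 * ex ρ (# S) → CompleteBalanced ρ S)

-- Counting edges, and the recursion for Turán numbers

opaque
  unfolding sum

  length-filter-tabulate : ∀ {A : Set} {P : A → Set} (P? : ∀ x → Dec (P x)) (g : Fin n → A) →
    length (filter P? (tabulate g)) ≡ sum (λ i → ⟦ does (P? (g i)) ⟧)
  length-filter-tabulate {n = zero}  P? g = refl
  length-filter-tabulate {n = suc n} P? g with does (P? (g zero))
  ... | true  = cong suc (length-filter-tabulate P? (g ∘ suc))
  ... | false = length-filter-tabulate P? (g ∘ suc)

length-filter-product : ∀ {m} {A B : Set} {P : A × B → Set} (P? : ∀ x → Dec (P x)) (f : Fin m → A) (g : Fin n → B) →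
  length (filter P? (cartesianProduct (tabulate f) (tabulate g))) ≡ sum (λ i → sum (λ j → ⟦ does (P? (f i , g j)) ⟧))
length-filter-product {m = zero}  P? f g = sym (sum-empty _)
length-filter-product {m = suc m} P? f g = begin
  length (filter P? (map (f zero ,_) (tabulate g) ++ rest))  ≡⟨ cong length (filter-++ P? (map (f zero ,_) (tabulate g)) rest) ⟩
  length (filter P? (map (f zero ,_) (tabulate g)) ++ filter P? rest)  ≡⟨ length-++ (filter P? (map (f zero ,_) (tabulate g))) ⟩
  length (filter P? (map (f zero ,_) (tabulate g))) + length (filter P? rest)  ≡⟨ cong₂ _+_ first (length-filter-product P? (f ∘ suc) g) ⟩
  sum (λ j → ⟦ does (P? (f zero , g j)) ⟧) + sum (λ i → sum (λ j → ⟦ does (P? (f (suc i) , g j)) ⟧))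
                                                                                     ≡⟨ sym (sum-suc _) ⟩
  sum (λ i → sum (λ j → ⟦ does (P? (f i , g j)) ⟧)) ∎
  where
  open ≡-Reasoning
  rest = cartesianProduct (tabulate (f ∘ suc)) (tabulate g)
  first : length (filter P? (map (f zero ,_) (tabulate g))) ≡ sum (λ j → ⟦ does (P? (f zero , g j)) ⟧)
  first = trans (cong (λ l → length (filter P? l)) (map-tabulate g (f zero ,_))) (length-filter-tabulate P? (λ j → f zero , g j))

e-as-sum : (G : Graph n) → e G ≡ sum (λ u → sum (λ v → ⟦ does (u Fin.<? v) ∧ adj G u v ⟧))
e-as-sum G = length-filter-product (λ (u , v) → u Fin.<? v ×-dec adj? G u v) id id

D-full : (G : Graph n) → D G full ≡ 2 * e G
D-full {n} G = begin
  D G full  ≡⟨ sum-over-full _ ⟩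
  sum (λ u → sum (λ v → ⟦ adj G u v ⟧))  ≡⟨ sum-cong (λ u → trans (sum-cong (split u)) (sum-+ _ _)) ⟩
  sum (λ u → sum (up u) + sum (λ v → up v u))  ≡⟨ sum-+ _ _ ⟩
  sum (λ u → sum (up u)) + sum (λ u → sum (λ v → up v u))  ≡⟨ cong (sum (λ u → sum (up u)) +_) (sym (sum-comm up)) ⟩
  sum (λ u → sum (up u)) + sum (λ u → sum (up u))   ≡⟨ cong (λ x → x + x) (sym (e-as-sum G)) ⟩
  e G + e G  ≡⟨ cong (e G +_) (sym (+-identityʳ (e G))) ⟩
  2 * e G  ∎
  where
  open ≡-Reasoning
  up : Fin n → Fin n → ℕ
  up u v = ⟦ does (u Fin.<? v) ∧ adj G u v ⟧
  split : ∀ u v → ⟦ adj G u v ⟧ ≡ up u v + up v u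
  split u v = aux (Fin.<-cmp u v)
    where
    aux : Tri (u Fin.< v) (u ≡ v) (v Fin.< u) → ⟦ adj G u v ⟧ ≡ up u v + up v u
    aux (tri< u<v _ u≯v) rewrite dec-true (u Fin.<? v) u<v | dec-false (v Fin.<? u) u≯v = sym (+-identityʳ _)
    aux (tri≈ u≮u refl _) rewrite adj-irrefl G u | dec-false (u Fin.<? u) u≮u = refl
    aux (tri> u≮v _ u>v) rewrite dec-false (u Fin.<? v) u≮v | dec-true (v Fin.<? u) u>v | adj-sym G u v = refl

divmod-suc : ∀ r .{{_ : NonZero r}} a →
  (suc a / r ≡ a / r × suc a % r ≡ suc (a % r)) ⊎ (suc a / r ≡ suc (a / r) × suc a % r ≡ 0 × suc (a % r) ≡ r)
divmod-suc r@(suc ρ) a = aux (m≤n⇒m<n∨m≡n (m%n<n a r))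
  where
  j = a % r
  q = a / r
  a≡ : suc a ≡ suc j + q * r
  a≡ = cong suc (m≡m%n+[m/n]*n a r)
  quotient : suc a / r ≡ suc j / r + q
  quotient = trans (cong (_/ r) a≡) (trans (+-distrib-/-∣ʳ (suc j) (divides q refl)) (cong (suc j / r +_) (m*n/n≡m q r)))
  remainder : suc a % r ≡ suc j % r
  remainder = trans (cong (_% r) a≡) ([m+kn]%n≡m%n (suc j) q r)
  aux : suc j < r ⊎ suc j ≡ r → (suc a / r ≡ q × suc a % r ≡ suc j) ⊎ (suc a / r ≡ suc q × suc a % r ≡ 0 × suc j ≡ r)
  aux (inj₁ j<r) = inj₁ (trans quotient (cong (_+ q) (m<n⇒m/n≡0 j<r)) , trans remainder (m<n⇒m%n≡m j<r))
  aux (inj₂ j≡r) = inj₂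
    ( trans quotient (cong (_+ q) (trans (cong (_/ r) j≡r) (n/n≡1 r)))
    , trans remainder (trans (cong (_% r) j≡r) (n%n≡0 r))
    , j≡r)

div-suc : ∀ r .{{_ : NonZero r}} a → ⟦ does (suc a % r ≟ 0) ⟧ + a / r ≡ suc a / r
div-suc r@(suc ρ) a = [ (λ (q≡ , j≡) → trans (indicator (λ eq → contradiction (trans (sym j≡) eq) λ ())) (sym q≡))
                      , (λ (q≡ , j≡0 , _) → trans (cong (λ b → ⟦ b ⟧ + a / r) (dec-true (suc a % r ≟ 0) j≡0)) (sym q≡))
                      ]′ (divmod-suc r a)
  where
  indicator : suc a % r ≢ 0 → ⟦ does (suc a % r ≟ 0) ⟧ + a / r ≡ a / r
  indicator ne = cong (λ b → ⟦ b ⟧ + a / r) (dec-false (suc a % r ≟ 0) ne)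

-- Telescoping of `div-suc`; the offset `a` makes the induction on `p` possible.
count-multiples : ∀ r .{{_ : NonZero r}} p a →
  sum {p} (λ v → ⟦ does (suc (a + toℕ v) % r ≟ 0) ⟧) + a / r ≡ (a + p) / r
count-multiples r zero a = trans (cong (_+ a / r) (sum-empty _)) (cong (_/ r) (sym (+-identityʳ a)))
count-multiples r (suc p) a = begin
  sum (λ v → ⟦ does (suc (a + toℕ v) % r ≟ 0) ⟧) + a / r  ≡⟨ cong (_+ a / r) (sum-suc _) ⟩
  ⟦ does (suc (a + 0) % r ≟ 0) ⟧ + sum {p} (λ v → ⟦ does (suc (a + suc (toℕ v)) % r ≟ 0) ⟧) + a / r
    ≡⟨ cong₂ (λ x y → x + y + a / r) (cong (λ x → ⟦ does (suc x % r ≟ 0) ⟧) (+-identityʳ a))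
         (sum-cong (λ v → cong (λ x → ⟦ does (suc x % r ≟ 0) ⟧) (+-suc a (toℕ v)))) ⟩
  ⟦ does (suc a % r ≟ 0) ⟧ + rest + a / r  ≡⟨ lemma _ rest (a / r) ⟩
  rest + (⟦ does (suc a % r ≟ 0) ⟧ + a / r)  ≡⟨ cong (rest +_) (div-suc r a) ⟩
  rest + suc a / r  ≡⟨ count-multiples r p (suc a) ⟩
  (suc a + p) / r  ≡⟨ cong (_/ r) (sym (+-suc a p)) ⟩
  (a + suc p) / r  ∎
  where
  open ≡-Reasoning
  rest = sum {p} (λ v → ⟦ does (suc (suc a + toℕ v) % r ≟ 0) ⟧)
  lemma : ∀ x y z → x + y + z ≡ y + (x + z)
  lemma = solve-∀

-- Adding `ρ` to a successor completes a full period, which undoes the shift modulo `suc ρ`.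
%-suc-injective : ∀ ρ {a b} → suc a % suc ρ ≡ suc b % suc ρ → a % suc ρ ≡ b % suc ρ
%-suc-injective ρ {a} {b} eq = trans (sym (shift a)) (trans (cong (λ x → (x + ρ % suc ρ) % suc ρ) eq) (shift b))
  where
  shift : ∀ a → (suc a % suc ρ + ρ % suc ρ) % suc ρ ≡ a % suc ρ
  shift a = trans (sym (%-distribˡ-+ (suc a) ρ (suc ρ)))
    (trans (cong (_% suc ρ) (sym (+-suc a ρ))) ([m+n]%n≡m%n a (suc ρ)))

%-suc-cong : ∀ ρ {a b} → a % suc ρ ≡ b % suc ρ → suc a % suc ρ ≡ suc b % suc ρ
%-suc-cong ρ {a} {b} eq = trans (%-distribˡ-+ 1 a (suc ρ))
  (trans (cong (λ x → (1 % suc ρ + x) % suc ρ) eq) (sym (%-distribˡ-+ 1 b (suc ρ))))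

does-⇔ : ∀ {P Q : Set} (P? : Dec P) (Q? : Dec Q) → (P → Q) → (Q → P) → does P? ≡ does Q?
does-⇔ (yes _) (yes _) _ _ = refl
does-⇔ (no _)  (no _)  _ _ = refl
does-⇔ (yes p) (no ¬q) f _ = contradiction (f p) ¬q
does-⇔ (no ¬p) (yes q) _ g = contradiction (g q) ¬p

-- The new vertex is put in front. Shifting the others by one rotates the residue classes and leaves
-- the smaller Turán graph, while vertex 0 is non-adjacent exactly to the multiples of `suc ρ`,
-- itself included.
turánNumber-suc : ∀ ρ p →
  turánNumber (suc ρ) (suc p) + ⌈ suc p /1+ ρ ⌉ ≡ turánNumber (suc ρ) p + suc p
turánNumber-suc ρ p = begin
  e T⁺ + suc (p / r)  ≡⟨ cong (_+ suc (p / r)) (e-as-sum T⁺) ⟩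
  sum (λ u → sum (up⁺ u)) + suc (p / r)  ≡⟨ cong (_+ suc (p / r)) (sum-suc _) ⟩
  sum (up⁺ zero) + sum (λ u → sum (up⁺ (suc u))) + suc (p / r)
    ≡⟨ cong₂ (λ x y → x + y + suc (p / r)) (sum-suc (up⁺ zero)) (sum-cong (λ u → trans (sum-suc (up⁺ (suc u))) (sum-cong (shift u)))) ⟩
  others + sum (λ u → sum (up u)) + suc (p / r)  ≡⟨ lemma others (sum (λ u → sum (up u))) (p / r) ⟩
  sum (λ u → sum (up u)) + suc (p / r + others)  ≡⟨ cong₂ (λ x y → x + suc y) (sym (e-as-sum T)) total ⟩
  e T + suc p  ∎
  where
  open ≡-Reasoning
  r = suc ρ
  T = turánGraph r p
  T⁺ = turánGraph r (suc p)
  up : Fin p → Fin p → ℕ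
  up u v = ⟦ does (u Fin.<? v) ∧ adj T u v ⟧
  up⁺ : Fin (suc p) → Fin (suc p) → ℕ
  up⁺ u v = ⟦ does (u Fin.<? v) ∧ adj T⁺ u v ⟧
  shift : ∀ u v → up⁺ (suc u) (suc v) ≡ up u v
  shift u v = cong ⟦_⟧ (cong₂ _∧_
    (does-⇔ (suc u Fin.<? suc v) (u Fin.<? v) s≤s⁻¹ s≤s)
    (does-⇔ (adj? T⁺ (suc u) (suc v)) (adj? T u v) (_∘ %-suc-cong ρ) (_∘ %-suc-injective ρ)))
  multiple other : Fin p → ℕ
  multiple v = ⟦ does (suc (toℕ v) % r ≟ 0) ⟧
  other v = ⟦ adj T⁺ zero (suc v) ⟧
  others = sum other
  lemma : ∀ a b c → a + b + suc c ≡ b + suc (c + a)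
  lemma = solve-∀
  total : p / r + others ≡ p
  total = begin
    p / r + others  ≡⟨ cong (_+ others) (sym (trans (cong (sum multiple +_) (sym (0/n≡0 r))) (count-multiples r p 0))) ⟩
    sum multiple + 0 + others  ≡⟨ cong (_+ others) (+-identityʳ _) ⟩
    sum multiple + others  ≡⟨ sym (sum-+ multiple other) ⟩
    sum (λ v → multiple v + other v)      ≡⟨ sum-cong one ⟩
    sum {p} (λ v → 1)  ≡⟨ #-full p ⟩
    p                                     ∎
    where
    one : ∀ v → multiple v + other v ≡ 1
    one v = aux (suc (toℕ v) % r ≟ 0)
      where
      aux : Dec (suc (toℕ v) % r ≡ 0) → multiple v + other v ≡ 1
      aux (yes eq) = cong₂ (λ b c → ⟦ b ⟧ + ⟦ c ⟧) (dec-true (suc (toℕ v) % r ≟ 0) eq)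
        (dec-false (adj? T⁺ zero (suc v)) (λ ne → ne (sym eq)))
      aux (no ne) = cong₂ (λ b c → ⟦ b ⟧ + ⟦ c ⟧) (dec-false (suc (toℕ v) % r ≟ 0) ne)
        (dec-true (adj? T⁺ zero (suc v)) (λ eq → ne (sym eq)))

opaque
  unfolding ex

  ex≡turánNumber : ∀ ρ q → ex ρ q ≡ turánNumber (suc ρ) q
  ex≡turánNumber ρ q = refl

  ex-zero : ∀ ρ → ex ρ 0 ≡ 0
  ex-zero ρ = refl

  ex-suc : ∀ ρ p → ex ρ (suc p) + ⌈ suc p /1+ ρ ⌉ ≡ ex ρ p + suc p
  ex-suc = turánNumber-suc

-- Turán's theorem

-- Deleting a vertex with ν non-neighbours compared with the step from T_r(q − 1) to T_r(q).
module Deletion {D ν d q t c t′ : ℕ} (deleted : D + 2 * ν ≡ d + 2 * q) (step : t + c ≡ t′ + q) where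

  private
    base : D + 2 * ν + 2 * (t′ + q) ≤ d + 2 * q + 2 * (t + c)
    base = +-mono-≤ (≤-reflexive deleted) (≤-reflexive (cong (2 *_) (sym step)))

  D≤2t : c ≤ ν → d ≤ 2 * t′ → D ≤ 2 * t
  D≤2t c≤ν d≤ = certify 0 (+-mono-≤ base (+-mono-≤ (*-monoʳ-≤ 2 c≤ν) d≤)) (lemma D ν d q t c t′)
    where
    lemma : ∀ D ν d q t c t′ → D + (d + 2 * q + 2 * (t + c) + (2 * ν + 2 * t′)) + 0 ≡
      2 * t + (D + 2 * ν + 2 * (t′ + q) + (2 * c + d))
    lemma = solve-∀

  2t′≤d : c ≤ ν → 2 * t ≤ D → 2 * t′ ≤ d
  2t′≤d c≤ν ≤D = certify 0 (+-mono-≤ base (+-mono-≤ (*-monoʳ-≤ 2 c≤ν) ≤D)) (lemma D ν d q t c t′)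
    where
    lemma : ∀ D ν d q t c t′ → 2 * t′ + (d + 2 * q + 2 * (t + c) + (2 * ν + D)) + 0 ≡
      d + (D + 2 * ν + 2 * (t′ + q) + (2 * c + 2 * t))
    lemma = solve-∀

  -- An upper bound after the deletion and a lower bound before it leave no room for further
  -- non-neighbours. All equality cases rest on this pinching.
  ν≤c : d ≤ 2 * t′ → 2 * t ≤ D → ν ≤ c
  ν≤c d≤ ≤D = *-cancelˡ-≤ 2 (certify 0 (+-mono-≤ base (+-mono-≤ d≤ ≤D)) (lemma D ν d q t c t′))
    where
    lemma : ∀ D ν d q t c t′ → 2 * ν + (d + 2 * q + 2 * (t + c) + (2 * t′ + D)) + 0 ≡
      2 * c + (D + 2 * ν + 2 * (t′ + q) + (d + 2 * t))
    lemma = solve-∀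

module _ (G : Graph n) where

  -- If `v` had a neighbour in each class, these and `v` would form a clique of size `ρ + 2`. So `v`
  -- misses a class, and the number of its non-neighbours leaves room for nothing but this class and
  -- `v`; the class is therefore a smallest one, and `v` may join it without loss of balance.
  attach-vertex : ∀ {ρ} S {v} → S v ≡ true → CompleteBalanced G ρ (S ─ v) →
    non G S v ≡ ⌈ # S /1+ ρ ⌉ → ¬ Clique G S (suc (suc ρ)) → CompleteBalanced G ρ S
  attach-vertex {ρ} S {v} Sv (π , complete , bal) non-v no-clique
    with any? (λ i → nbr G (S ─ v ∩ cls π i) v ≟ 0)
  ... | no ¬p = contradiction (extend-clique G S (f , f∈ , f-adj) Sv (λ i → adj-flip G (f~v i))) no-clique
    where
    meets : ∀ i → ∃[ x ] ((S ─ v ∩ cls π i) ∩ adj G v) x ≡ true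
    meets i = #-inhabited _ (n≢0⇒n>0 (λ eq → ¬p (i , eq)))
    f : Fin (suc ρ) → Fin n
    f i = proj₁ (meets i)
    f∈S′ : ∀ i → (S ─ v) (f i) ≡ true
    f∈S′ i = ∧-elimˡ (∧-elimˡ (proj₂ (meets i)))
    f∈ : ∀ i → S (f i) ≡ true
    f∈ i = ─⊑ S v (f i) (f∈S′ i)
    f~v : ∀ i → adj G v (f i) ≡ true
    f~v i = ∧-elimʳ {(S ─ v ∩ cls π i) (f i)} (proj₂ (meets i))
    π-f : ∀ i → π (f i) ≡ i
    π-f i = does⇒ (π (f i) Fin.≟ i) (∧-elimʳ {(S ─ v) (f i)} (∧-elimˡ (proj₂ (meets i))))
    f-adj : ∀ i j → i ≢ j → adj G (f i) (f j) ≡ true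
    f-adj i j i≢j = trans (complete (f i) (f j) (f∈S′ i) (f∈S′ j))
      (cong not (dec-false (π (f i) Fin.≟ π (f j)) (λ eq → i≢j (trans (sym (π-f i)) (trans eq (π-f j))))))
  ... | yes (i , no-nbr) = π′ , complete′ , bal′
    where
    S′ = S ─ v
    p : Fin (suc ρ) → ℕ
    p j = # (S′ ∩ cls π j)
    -- The average class size in `S ─ v`, rounded down; every class has at least this size, by
    -- balance.
    κ = pred (# S) / suc ρ
    total : sum-over full p ≡ pred (# S)
    total = trans (sum-over-full p) (trans (sum-cls S′ π) (sym (cong pred (#-─ S Sv))))
    κ≤p : ∀ j → κ ≤ p j
    κ≤p j = balanced-≥ full bal κ (≤-trans (≤-reflexive (cong (_* κ) (#-full (suc ρ))))
      (≤-trans (≤-reflexive (*-comm (suc ρ) κ)) (≤-trans (m/n*n≤m (pred (# S)) (suc ρ)) (≤-reflexive (sym total))))) j refl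
    nonS′ : non G S′ v ≡ κ
    nonS′ = suc-injective (trans (sym (trans (#-─ (S ∩ nonadj G v) (∧-intro Sv (cong not (adj-irrefl G v))))
        (cong suc (sum-cong (λ x → cong ⟦_⟧ (swap (S x) (nonadj G v x) (not (⁅ v ⁆ᵇ x)))))))) non-v)
      where
      swap : ∀ a b c → (a ∧ b) ∧ c ≡ (a ∧ c) ∧ b
      swap a b c = trans (Bool.∧-assoc a b c) (trans (cong (a ∧_) (Bool.∧-comm b c)) (sym (Bool.∧-assoc a c b)))
    class⊑non : S′ ∩ cls π i ⊑ S′ ∩ nonadj G v
    class⊑non x h = ∧-intro (∧-elimˡ h) (cong not (nbr≡0⇒¬adj G (S′ ∩ cls π i) v no-nbr x h))
    non⊑class : S′ ∩ nonadj G v ⊑ S′ ∩ cls π i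
    non⊑class = #-≥⇒⊒ class⊑non (≤-trans (≤-reflexive nonS′) (κ≤p i))
    p-i : p i ≡ κ
    p-i = ≤-antisym (≤-trans (#-mono class⊑non) (≤-reflexive nonS′)) (κ≤p i)

    π′ : Fin n → Fin (suc ρ)
    π′ x = if ⁅ v ⁆ᵇ x then i else π x
    π′-v : π′ v ≡ i
    π′-v rewrite ∈⁅⁆ v = refl
    π′-≢ : ∀ {x} → v ≢ x → π′ x ≡ π x
    π′-≢ {x} v≢x rewrite dec-false (v Fin.≟ x) v≢x = refl
    adj-v : ∀ {x} → S x ≡ true → v ≢ x → adj G v x ≡ not (cls π i x)
    adj-v {x} Sx v≢x with true∨false (cls π i x)
    ... | inj₁ c = trans (nbr≡0⇒¬adj G (S′ ∩ cls π i) v no-nbr x (∧-intro (─-∈ S Sx v≢x) c)) (cong not (sym c))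
    ... | inj₂ c with true∨false (adj G v x)
    ...   | inj₁ vx = trans vx (cong not (sym c))
    ...   | inj₂ vx = ⊥-elim (true≢false (∧-elimʳ {S′ x} (non⊑class x (∧-intro (─-∈ S Sx v≢x) (cong not vx)))) c)
    cls-sym : ∀ j x y → π′ x ≡ j → cls π′ (π′ y) x ≡ cls π′ j y
    cls-sym j x y refl with π′ x Fin.≟ π′ y | π′ y Fin.≟ π′ x
    ... | yes _ | yes _ = refl
    ... | no _  | no _  = refl
    ... | yes p | no ¬q = contradiction (sym p) ¬q
    ... | no ¬p | yes q = contradiction (sym q) ¬p
    complete′ : ∀ x y → S x ≡ true → S y ≡ true → adj G x y ≡ not (cls π′ (π′ y) x)
    complete′ x y Sx Sy = aux (v Fin.≟ x) (v Fin.≟ y)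
      where
      aux : Dec (v ≡ x) → Dec (v ≡ y) → adj G x y ≡ not (cls π′ (π′ y) x)
      aux (yes refl) (yes refl) = trans (adj-irrefl G v) (cong not (sym (∈cls π′ v)))
      aux (yes refl) (no v≢y) = trans (adj-v Sy v≢y) (cong not
          (sym (trans (cls-sym i v y π′-v) (cong (λ j → does (j Fin.≟ i)) (π′-≢ v≢y)))))
      aux (no v≢x) (yes refl) = trans (adj-sym G x v) (trans (adj-v Sx v≢x) (cong not
          (sym (trans (cong (λ j → cls π′ j x) π′-v) (cong (λ j → does (j Fin.≟ i)) (π′-≢ v≢x))))))
      aux (no v≢x) (no v≢y) = trans (complete x y (─-∈ S Sx v≢x) (─-∈ S Sy v≢y))
          (cong not (cong₂ (λ j l → does (j Fin.≟ l)) (sym (π′-≢ v≢x)) (sym (π′-≢ v≢y))))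

    p′ : Fin (suc ρ) → ℕ
    p′ j = # (S ∩ cls π′ j)
    remove : ∀ j → # ((S ∩ cls π′ j) ─ v) ≡ p j
    remove j = sum-cong (λ x → cong ⟦_⟧ (eq x))
      where
      eq : ∀ x → ((S ∩ cls π′ j) ─ v) x ≡ (S′ ∩ cls π j) x
      eq x with v Fin.≟ x
      ... | yes refl = trans (Bool.∧-zeroʳ _) (cong (_∧ cls π j v) (sym (Bool.∧-zeroʳ (S v))))
      ... | no v≢x = trans (Bool.∧-identityʳ _) (cong (_∧ cls π j x) (sym (Bool.∧-identityʳ (S x))))
    p′-i : p′ i ≡ suc κ
    p′-i = trans (#-─ (S ∩ cls π′ i) (∧-intro Sv (subst (λ j → does (j Fin.≟ i) ≡ true) (sym π′-v) (dec-true (i Fin.≟ i) refl))))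
      (cong suc (trans (remove i) p-i))
    p′-≢ : ∀ {j} → i ≢ j → p′ j ≡ p j
    p′-≢ {j} i≢j = trans (sum-cong (λ x → cong ⟦_⟧ (sym (─-absent (S ∩ cls π′ j) v∉ x)))) (remove j)
      where
      v∉ : (S ∩ cls π′ j) v ≡ false
      v∉ = trans (cong (S v ∧_) (dec-false (π′ v Fin.≟ j) (λ eq → i≢j (trans (sym π′-v) eq)))) (Bool.∧-zeroʳ (S v))
    bal′ : Balanced full p′
    bal′ j l _ _ with i Fin.≟ j | i Fin.≟ l
    ... | yes refl | yes refl = n≤1+n _
    ... | yes refl | no i≢l = subst₂ (λ a b → a ≤ suc b) (sym p′-i) (sym (p′-≢ i≢l)) (s≤s (κ≤p l))
    ... | no i≢j | yes refl = subst₂ (λ a b → a ≤ suc b) (sym (p′-≢ i≢j)) (sym p′-i)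
          (≤-trans (bal j i refl refl) (≤-trans (s≤s (≤-reflexive p-i)) (n≤1+n _)))
    ... | no i≢j | no i≢l = subst₂ (λ a b → a ≤ suc b) (sym (p′-≢ i≢j)) (sym (p′-≢ i≢l)) (bal j l refl refl)

  -- A vertex of small degree is deleted. Equality for `S` makes both the bound for `S ─ v` and the
  -- count of non-neighbours of `v` tight, which is the situation of `attach-vertex`.
  turán : ∀ ρ q S → # S ≡ q → ¬ Clique G S (suc (suc ρ)) →
    D G S ≤ 2 * ex ρ q × (D G S ≡ 2 * ex ρ q → CompleteBalanced G ρ S)
  turán ρ zero S #S no-clique =
    ≤-trans (D≤#² G S) (≤-trans (≤-reflexive (cong (λ q → q * q) #S)) z≤n) ,
    λ _ → (λ _ → zero) ,
      (λ x y Sx Sy → ⊥-elim (true≢false Sx (#≡0⇒∉ S #S x))) ,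
      (λ i j _ _ → ≤-trans (#-mono (∩⊑ˡ S _)) (≤-trans (≤-reflexive #S) z≤n))
  turán ρ (suc p) S #S no-clique
    with v , Sv , small ← vertex-of-small-degree G ρ S (≤-trans z<s (≤-reflexive (sym #S))) no-clique
    with IH≤ , IH≡ ← turán ρ p (S ─ v) (suc-injective (trans (sym (#-─ S Sv)) #S))
                       (λ (f , f∈ , f-adj) → no-clique (f , (λ i → ─⊑ S v (f i) (f∈ i)) , f-adj))
    = D≤2t small IH≤ , λ D≡ → attach-vertex S Sv
        (IH≡ (≤-antisym IH≤ (2t′≤d small (≤-reflexive (sym D≡)))))
        (≤-antisym (ν≤c IH≤ (≤-reflexive (sym D≡))) small) no-clique
    where
    open Deletion {D G S} {non G S v} {D G (S ─ v)} {suc p} {ex ρ (suc p)} {⌈ # S /1+ ρ ⌉} {ex ρ p}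
      (trans (D-─ G S Sv) (cong (λ q → D G (S ─ v) + 2 * q) #S))
      (trans (cong (λ q → ex ρ (suc p) + ⌈ q /1+ ρ ⌉) #S) (ex-suc ρ p))

-- The Erdős–Stone argument

Homogeneous : ∀ {m} → (Fin m → Fin n → Bool) → Sub m → Sub n → Set
Homogeneous b U W = ∀ u → U u ≡ true → ∀ w w′ → W w ≡ true → W w′ ≡ true → b u w ≡ b u w′

-- Each vertex of `U` splits `W` into neighbours and non-neighbours; keeping a sufficiently large
-- side costs a factor of 2 per vertex.
homogeneous-subset : ∀ {m} (b : Fin m → Fin n → Bool) (U : Sub m) (W : Sub n) L → 2 ^ # U * L ≤ # W →
  ∃[ W′ ] W′ ⊑ W × L ≤ # W′ × Homogeneous b U W′
homogeneous-subset {m = zero} b U W L large =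
  W , (λ _ Ww → Ww) , ≤-trans (≤-reflexive (sym (trans (cong (λ c → 2 ^ c * L) (sum-empty _)) (*-identityˡ L)))) large , λ ()
homogeneous-subset {m = suc m} b U W L large = aux (true∨false (U zero))
  where
  U′ = U ∘ suc
  extend : ∀ {c} (W″ : Sub _) → W″ ⊑ W → (U zero ≡ true → ∀ w → W″ w ≡ true → b zero w ≡ c) → 2 ^ # U′ * L ≤ # W″ →
    ∃[ W′ ] W′ ⊑ W × L ≤ # W′ × Homogeneous b U W′
  extend W″ W″⊑W const large″ with W′ , W′⊑ , L≤ , h ← homogeneous-subset (b ∘ suc) U′ W″ L large″
    = W′ , (λ w → W″⊑W w ∘ W′⊑ w) , L≤ , h′
    where
    h′ : Homogeneous b U W′
    h′ zero    Uu w w′ Ww Ww′ = trans (const Uu w (W′⊑ w Ww)) (sym (const Uu w′ (W′⊑ w′ Ww′)))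
    h′ (suc u) Uu = h u Uu
  aux : U zero ≡ true ⊎ U zero ≡ false → ∃[ W′ ] W′ ⊑ W × L ≤ # W′ × Homogeneous b U W′
  aux (inj₂ U0) = extend {true} W (λ _ Ww → Ww) (λ U0′ → ⊥-elim (true≢false U0′ U0))
    (≤-trans (≤-reflexive (cong (λ c → 2 ^ c * L) (sym (trans (sum-suc _) (cong (λ c → ⟦ c ⟧ + # U′) U0))))) large)
  aux (inj₁ U0) with 2 ^ # U′ * L ≤? # (W ∩ b zero)
  ... | yes le = extend {true} (W ∩ b zero) (∩⊑ˡ W (b zero)) (λ _ w h → ∧-elimʳ h) le
  ... | no ¬le = extend {false} (W ∖ b zero) (∩⊑ˡ W (not ∘ b zero)) (λ _ w h → not-true (∧-elimʳ {W w} h)) (+-cancelˡ-≤ _ _ _ (begin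
      2 ^ # U′ * L + 2 ^ # U′ * L  ≡⟨ lemma (2 ^ # U′) L ⟩
      2 * 2 ^ # U′ * L  ≡⟨ cong (λ c → 2 ^ c * L) (sym (trans (sum-suc _) (cong (λ c → ⟦ c ⟧ + # U′) U0))) ⟩
      2 ^ # U * L  ≤⟨ large ⟩
      # W  ≡⟨ #-complement W (b zero) ⟩
      # (W ∩ b zero) + # (W ∖ b zero)      ≤⟨ +-monoˡ-≤ _ (<⇒≤ (≰⇒> ¬le)) ⟩
      2 ^ # U′ * L + # (W ∖ b zero)  ∎))
    where
    open ≤-Reasoning
    lemma : ∀ a l → a * l + a * l ≡ 2 * a * l
    lemma = solve-∀

homogeneous-subset-family : ∀ {m} (b : Fin m → Fin n → Bool) K j (U : Fin j → Sub m) → (∀ i → # (U i) ≡ K) →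
  ∀ W L → (2 ^ K) ^ j * L ≤ # W →
  ∃[ W′ ] W′ ⊑ W × L ≤ # W′ × (∀ i → Homogeneous b (U i) W′)
homogeneous-subset-family b K zero U #U W L large =
  W , (λ _ Ww → Ww) , ≤-trans (≤-reflexive (sym (*-identityˡ L))) large , λ ()
homogeneous-subset-family b K (suc j) U #U W L large
  with W₁ , W₁⊑ , large₁ , h₁ ← homogeneous-subset b (U zero) W ((2 ^ K) ^ j * L)
         (≤-trans (≤-reflexive (trans (cong (λ c → 2 ^ c * ((2 ^ K) ^ j * L)) (#U zero)) (sym (*-assoc (2 ^ K) _ L)))) large)
  with W₂ , W₂⊑ , L≤ , h₂ ← homogeneous-subset-family b K j (U ∘ suc) (#U ∘ suc) W₁ L large₁
  = W₂ , (λ w → W₁⊑ w ∘ W₂⊑ w) , L≤ , h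
  where
  h : ∀ i → Homogeneous b (U i) W₂
  h zero    u Uu w w′ Ww Ww′ = h₁ u Uu w w′ (W₂⊑ w Ww) (W₂⊑ w′ Ww′)
  h (suc i) = h₂ i

module _ (G : Graph n) where

  Joined : ∀ {j} → (Fin j → Sub n) → Set
  Joined A = ∀ {i k} → i ≢ k → ∀ {x y} → A i x ≡ true → A k y ≡ true → adj G x y ≡ true

  -- A copy of K_j(L); the parts may be larger than L.
  record Multipartite (S : Sub n) (j L : ℕ) : Set where
    field
      part   : Fin j → Sub n
      inside : ∀ i → part i ⊑ S
      large  : ∀ i → L ≤ # (part i)
      joined : Joined part

  -- A copy of K_{ρ+1}(T) with an edge xy added to the part i; x and y need not
  -- lie in that part.
  record PlusEdge (S : Sub n) (ρ T : ℕ) : Set where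
    field
      multipartite : Multipartite S (suc ρ) T
    open Multipartite multipartite public
    field
      i        : Fin (suc ρ)
      x y      : Fin n
      x∈S      : S x ≡ true
      y∈S      : S y ≡ true
      x~y      : adj G x y ≡ true
      x-joined : ∀ {j} → j ≢ i → ∀ {z} → part j z ≡ true → adj G x z ≡ true
      y-joined : ∀ {j} → j ≢ i → ∀ {z} → part j z ≡ true → adj G y z ≡ true

  -- Minimum degree at least that of the Turán graph with `suc ρ` parts on `# S` vertices.
  SmallNon : ℕ → Sub n → Set
  SmallNon ρ S = ∀ x → S x ≡ true → non G S x ≤ ⌈ # S /1+ ρ ⌉

  trim : ∀ {S j L} → Multipartite S j L → Σ (Multipartite S j L) λ K → ∀ i → # (Multipartite.part K i) ≡ L
  trim {S} {j} {L} K = record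
      { part   = A
      ; inside = λ i → ⊑-trans {A = A i} {part i} {S} (A⊑ i) (inside i)
      ; large  = λ i → ≤-reflexive (sym (#A i))
      ; joined = λ i≢k Ax Ay → joined i≢k (A⊑ _ _ Ax) (A⊑ _ _ Ay)
      } , #A
    where
    open Multipartite K
    A : Fin j → Sub n
    A i = proj₁ (shrink L (part i) (large i))
    A⊑ : ∀ i → A i ⊑ part i
    A⊑ i = proj₁ (proj₂ (shrink L (part i) (large i)))
    #A : ∀ i → # (A i) ≡ L
    #A i = proj₂ (proj₂ (shrink L (part i) (large i)))

  non-count : ∀ {j} S (A : Fin j → Sub n) K c → (∀ i → A i ⊑ S) → (∀ i → # (A i) ≡ K) →
    (∀ x → S x ≡ true → non G S x ≤ c) → sum-over S (λ w → sum (λ i → non G (A i) w)) ≤ j * (K * c)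
  non-count {j} S A K c A⊑S #A non≤ = begin
    sum (λ w → ⟦ S w ⟧ * sum (λ i → non G (A i) w))    ≡⟨ sum-cong (λ w → *-sum ⟦ S w ⟧ _) ⟩
    sum (λ w → sum (λ i → ⟦ S w ⟧ * non G (A i) w))    ≡⟨ sum-comm _ ⟩
    sum (λ i → cross (nonadj G) S (A i))  ≡⟨ sum-cong (λ i → cross-comm (nonadj G) (nonadj-sym G) S (A i)) ⟩
    sum (λ i → cross (nonadj G) (A i) S)  ≤⟨ sum-mono (λ i → sum-over-≤ (A i) (λ x Ax → non≤ x (A⊑S i x Ax))) ⟩
    sum (λ i → # (A i) * c)  ≡⟨ sum-cong (λ i → cong (_* c) (#A i)) ⟩
    sum {j} (λ i → K * c)  ≡⟨ sum-const j (K * c) ⟩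
    j * (K * c)  ∎
    where open ≤-Reasoning

  -- A good vertex has at least `L` neighbours in each of the `j` parts. Among many good vertices
  -- there are `L` with identical neighbourhoods in the parts; these form the new part, and the old
  -- ones shrink to the common neighbourhoods. As `j ≤ ρ`, the minimum degree leaves a positive
  -- fraction of `S` good.
  extend-multipartite : ∀ ρ j L → j ≤ ρ → 1 ≤ L → ∀ S → SmallNon ρ S →
    suc (2 * ρ) * ((2 ^ (2 * suc ρ * L)) ^ j * L) + 2 * ρ * ρ < # S →
    Multipartite S j (2 * suc ρ * L) → Multipartite S (suc j) L
  extend-multipartite ρ j L j≤ρ 1≤L S non≤ N<#S K₀
    with K₁ , #A ← trim K₀ = aux (X ≤? # (S ∩ good))
    where
    open Multipartite K₁ renaming (part to A)
    K = 2 * suc ρ * L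
    X = (2 ^ K) ^ j * L
    c = ⌈ # S /1+ ρ ⌉
    good : Sub n
    good w = does (all? (λ i → L ≤? nbr G (A i) w))
    ν : Fin n → ℕ
    ν w = sum (λ i → non G (A i) w)
    ν-bad : ∀ w → (S ∖ good) w ≡ true → suc (2 * ρ) * L ≤ ν w
    ν-bad w h with Fin.¬∀⟶∃¬ j (λ i → L ≤ nbr G (A i) w) (λ i → L ≤? nbr G (A i) w)
                     (¬does⇒ (all? (λ i → L ≤? nbr G (A i) w)) (not-true (∧-elimʳ {S w} h)))
    ... | i , few = ≤-trans (certify 0 (+-mono-≤ (≤-reflexive (sym (trans (nbr+non G (A i) w) (#A i)))) (<⇒≤ (≰⇒> few)))
                      (lemma ρ L (nbr G (A i) w) (non G (A i) w))) (term≤sum (λ i → non G (A i) w) i)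
      where
      lemma : ∀ ρ L a b → suc (2 * ρ) * L + (a + b + L) + 0 ≡ b + (2 * suc ρ * L + a)
      lemma = solve-∀
    -- A bad vertex misses at least `K` minus `L`, that is `(2ρ+1)L`, vertices of one part, whereas
    -- the parts send out at most `jKc` missing pairs. The choice of `K` makes the bad fraction
    -- about `2ρ/(2ρ+1)`.
    #bad : # (S ∖ good) * suc (2 * ρ) ≤ 2 * ρ * (# S + ρ)
    #bad = *-cancelʳ-≤ _ _ L {{>-nonZero 1≤L}} (begin
      # (S ∖ good) * suc (2 * ρ) * L  ≡⟨ *-assoc (# (S ∖ good)) _ L ⟩
      # (S ∖ good) * (suc (2 * ρ) * L)  ≤⟨ sum-over-≥ (S ∖ good) ν-bad ⟩
      sum-over (S ∖ good) ν  ≤⟨ sum-mono (λ w → *-monoˡ-≤ (ν w) (⟦⟧-mono (∧-elimˡ {S w}))) ⟩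
      sum-over S ν  ≤⟨ non-count S A K c inside #A non≤ ⟩
      j * (K * c)  ≤⟨ *-monoˡ-≤ (K * c) j≤ρ ⟩
      ρ * (K * c)  ≡⟨ lemma ρ L c ⟩
      2 * ρ * (suc ρ * c) * L  ≤⟨ *-monoˡ-≤ L (*-monoʳ-≤ (2 * ρ) (*⌈⌉≤ ρ (≤-trans z<s N<#S))) ⟩
      2 * ρ * (# S + ρ) * L  ∎)
      where
      open ≤-Reasoning
      lemma : ∀ ρ L c → ρ * (2 * suc ρ * L * c) ≡ 2 * ρ * (suc ρ * c) * L
      lemma = solve-∀
    aux : Dec (X ≤ # (S ∩ good)) → Multipartite S (suc j) L
    aux (no few) = contradiction (certify 0 (+-mono-≤ #bad (+-mono-≤ (*-monoʳ-≤ (suc (2 * ρ)) (<⇒≤ (≰⇒> few)))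
        (*-monoʳ-≤ (suc (2 * ρ)) (≤-reflexive (#-complement S good)))))
        (lemma (# S) ρ X (# (S ∖ good)) (# (S ∩ good)))) (<⇒≱ N<#S)
      where
      lemma : ∀ q ρ X b g → q + (2 * ρ * (q + ρ) + (suc (2 * ρ) * X + suc (2 * ρ) * (g + b))) + 0 ≡
        suc (2 * ρ) * X + 2 * ρ * ρ + (b * suc (2 * ρ) + (suc (2 * ρ) * g + suc (2 * ρ) * q))
      lemma = solve-∀
    aux (yes many)
      with W , W⊑ , L≤#W , same ← homogeneous-subset-family (adj G) K j A #A (S ∩ good) L many
      with w₀ , Ww₀ ← #-inhabited W (≤-trans 1≤L L≤#W)
      = record { part = B ; inside = B⊑ ; large = B-large ; joined = B-joined }
      where
      B : Fin (suc j) → Sub n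
      B zero    = W
      B (suc i) = A i ∩ adj G w₀
      B⊑ : ∀ i → B i ⊑ S
      B⊑ zero    x Wx = ∧-elimˡ (W⊑ x Wx)
      B⊑ (suc i) x h  = inside i x (∧-elimˡ h)
      B-large : ∀ i → L ≤ # (B i)
      B-large zero    = L≤#W
      B-large (suc i) = does⇒ (all? (λ i → L ≤? nbr G (A i) w₀)) (∧-elimʳ {S w₀} (W⊑ w₀ Ww₀)) i
      W~A : ∀ {i x z} → W x ≡ true → B (suc i) z ≡ true → adj G z x ≡ true
      W~A {i} {x} {z} Wx h = trans (same i z (∧-elimˡ h) x w₀ Wx Ww₀) (adj-flip G (∧-elimʳ {A i z} h))
      B-joined : Joined B
      B-joined {zero}  {zero}  i≢k _ _  = contradiction refl i≢k
      B-joined {zero}  {suc k} _   Wx h = adj-flip G (W~A Wx h)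
      B-joined {suc i} {zero}  _   h Wx = W~A Wx h
      B-joined {suc i} {suc k} i≢k h h′ = joined (i≢k ∘ cong suc) (∧-elimˡ h) (∧-elimˡ h′)

multipartite : ∀ ρ j L → j ≤ suc ρ → 1 ≤ L →
  ∃[ N ] ∀ {n} (G : Graph n) S → N < # S → SmallNon G ρ S → Multipartite G S j L
multipartite ρ zero L _ _ = 0 , λ G S _ _ → record { part = λ () ; inside = λ () ; large = λ () ; joined = λ { {()} } }
multipartite ρ (suc j) L j<r 1≤L
  with N , IH ← multipartite ρ j (2 * suc ρ * L) (<⇒≤ j<r) (≤-trans 1≤L (m≤n*m L (2 * suc ρ)))
  = N ⊔ N′ , λ G S N<#S non≤ → extend-multipartite G ρ j L (s≤s⁻¹ j<r) 1≤L S non≤ (≤-<-trans (m≤n⊔m N N′) N<#S)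
                 (IH G S (≤-<-trans (m≤m⊔n N N′) N<#S) non≤)
  where N′ = suc (2 * ρ) * ((2 ^ (2 * suc ρ * L)) ^ j * L) + 2 * ρ * ρ

-- Colouring graphs of large minimum degree

#-disjoint-⊑ : {A B S : Sub n} → A ⊑ S → B ⊑ S → (∀ x → A x ≡ true → B x ≡ true → ⊥) → # A + # B ≤ # S
#-disjoint-⊑ {A = A} {B} {S} A⊑S B⊑S disjoint = ≤-trans (≤-reflexive (sym (sum-+ _ _))) (sum-mono lemma)
  where
  lemma : ∀ x → ⟦ A x ⟧ + ⟦ B x ⟧ ≤ ⟦ S x ⟧
  lemma x with true∨false (A x) | true∨false (B x)
  ... | inj₁ Ax | inj₁ Bx = ⊥-elim (disjoint x Ax Bx)
  ... | inj₁ Ax | inj₂ Bx rewrite Ax | Bx | A⊑S x Ax = ≤-refl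
  ... | inj₂ Ax | inj₁ Bx rewrite Ax | Bx | B⊑S x Bx = ≤-refl
  ... | inj₂ Ax | inj₂ Bx rewrite Ax | Bx = z≤n

module _ (G : Graph n) where

  #≤common+non+non : ∀ A x y → # A ≤ # (A ∩ adj G x ∩ adj G y) + (non G A x + non G A y)
  #≤common+non+non A x y = ≤-trans (sum-mono (λ z → lemma (A z) (adj G x z) (adj G y z)))
    (≤-reflexive (trans (sum-+ _ _) (cong (# (A ∩ adj G x ∩ adj G y) +_) (sum-+ _ _))))
    where
    lemma : ∀ a b c → ⟦ a ⟧ ≤ ⟦ a ∧ b ∧ c ⟧ + (⟦ a ∧ not b ⟧ + ⟦ a ∧ not c ⟧)
    lemma false _     _     = z≤n
    lemma true  false _     = s≤s z≤n
    lemma true  true  false = s≤s z≤n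
    lemma true  true  true  = s≤s z≤n

  -- The part `i` is left whole: `x` and `y` have to be joined to the other parts only.
  cut : ∀ {j} → (Fin j → Sub n) → Fin j → Fin n → Fin n → Fin j → Sub n
  cut A i x y j = A j ∩ (λ z → does (j Fin.≟ i) ∨ (adj G x z ∧ adj G y z))

  cut-≢ : ∀ {j} (A : Fin j → Sub n) {i x y k} → k ≢ i → ∀ {z} → cut A i x y k z ≡ true → adj G x z ∧ adj G y z ≡ true
  cut-≢ A {i} {x} {y} {k} k≢i {z} h rewrite dec-false (k Fin.≟ i) k≢i = ∧-elimʳ {A k z} h

  cut-large : ∀ {j} (A : Fin j → Sub n) {i x y} L → L ≤ # (A i) →
    (∀ k → k ≢ i → L ≤ # (A k ∩ adj G x ∩ adj G y)) → ∀ k → L ≤ # (cut A i x y k)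
  cut-large A {i} L L≤ L≤′ k with k Fin.≟ i
  ... | yes refl = ≤-trans L≤ (#-mono (λ z Az → ∧-intro Az refl))
  ... | no k≢i   = L≤′ k k≢i

  plus-edge : ∀ {S ρ L T} (K : Multipartite G S (suc ρ) L) → let open Multipartite K in ∀ i {x y} →
    S x ≡ true → S y ≡ true → adj G x y ≡ true → T ≤ # (part i) →
    (∀ j → j ≢ i → T ≤ # (part j ∩ adj G x ∩ adj G y)) → PlusEdge G S ρ T
  plus-edge {T = T} K i {x} {y} Sx Sy x~y T≤ T≤′ = record
    { multipartite = record
      { part   = cut part i x y
      ; inside = λ j z h → inside j z (∧-elimˡ h)
      ; large  = cut-large part T T≤ T≤′
      ; joined = λ i≢k h h′ → joined i≢k (∧-elimˡ h) (∧-elimˡ h′)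
      }
    ; i = i ; x = x ; y = y ; x∈S = Sx ; y∈S = Sy ; x~y = x~y
    ; x-joined = λ j≢i h → ∧-elimˡ (cut-≢ part j≢i h)
    ; y-joined = λ {j} j≢i {z} h → ∧-elimʳ {adj G x z} (cut-≢ part j≢i h)
    }
    where open Multipartite K

  -- Independent sets of almost the Turán size. They need not cover `S`; the remaining vertices are
  -- sorted later, by the class that they miss.
  record Classes (S : Sub n) (ρ c γ : ℕ) : Set where
    field
      V           : Fin (suc ρ) → Sub n
      V⊑S         : ∀ i → V i ⊑ S
      independent : ∀ i {x} → V i x ≡ true → nbr G (V i) x ≡ 0
      disjoint    : ∀ {i j} → i ≢ j → ∀ x → V i x ≡ true → V j x ≡ true → ⊥
      large       : ∀ i → c ≤ # (V i) + γ

  module _ {ρ T L : ℕ} {S : Sub n} (1≤T : 1 ≤ T) (2T≤L : 2 * T ≤ L) (0<#S : 0 < # S)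
    (non≤ : SmallNon G ρ S) (free : ¬ PlusEdge G S ρ T)
    (K : Multipartite G S (suc ρ) L) (#A : ∀ i → # (Multipartite.part K i) ≡ L) where

    open Multipartite K renaming (part to A; large to A-large)

    private
      c = ⌈ # S /1+ ρ ⌉
      ν : Fin n → ℕ
      ν w = sum (λ i → non G (A i) w)
      ok : Sub n
      ok w = does (ν w ≤? L)
      T≤L : T ≤ L
      T≤L = ≤-trans (m≤m+n T _) 2T≤L
      V : Fin (suc ρ) → Sub n
      V i w = (S w ∧ ok w) ∧ does (nbr G (A i) w ≟ 0)

      -- Suppose that `w` has a neighbour in every part. Two parts with fewer than `T` neighbours of
      -- `w` already give more than `2L − 2T ≥ L` non-neighbours. With at most one such part, `w`
      -- and a neighbour in it form the additional edge of a `PlusEdge`.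
      misses-part : ∀ w → S w ≡ true → (∃[ i ] nbr G (A i) w ≡ 0) ⊎ L < ν w
      misses-part w Sw with any? (λ i → nbr G (A i) w ≟ 0)
      ... | yes p = inj₁ p
      ... | no ¬p with at-most-one (λ i → nbr G (A i) w < T) (λ i → nbr G (A i) w <? T)
      ...   | inj₁ (i , j , i≢j , few-i , few-j) = inj₂ (≤-trans
                (certify 1 (+-mono-≤ (+-mono-≤ few-i few-j)
                    (+-mono-≤ (+-mono-≤ (≤-reflexive (sym (nbr+non-L i))) (≤-reflexive (sym (nbr+non-L j)))) 2T≤L))
                  (lemma L T (nbr G (A i) w) (nbr G (A j) w) (non G (A i) w) (non G (A j) w)))
                (two-terms≤sum (λ i → non G (A i) w) i≢j))
        where
        nbr+non-L : ∀ i → nbr G (A i) w + non G (A i) w ≡ L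
        nbr+non-L i = trans (nbr+non G (A i) w) (#A i)
        lemma : ∀ L T a b x y → suc L + (T + T + (a + x + (b + y) + L)) + 1 ≡
          x + y + (suc a + suc b + (L + L + 2 * T))
        lemma = solve-∀
      ...   | inj₂ (i , others) with y , h ← #-inhabited (A i ∩ adj G w) (n≢0⇒n>0 (λ eq → ¬p (i , eq)))
        = ⊥-elim (free (plus-edge K i Sw (inside i y (∧-elimˡ h)) (∧-elimʳ {A i y} h)
            (≤-trans T≤L (A-large i))
            (λ j j≢i → ≤-trans (≮⇒≥ (others j j≢i))
              (#-mono (λ z h′ → ∧-intro (∧-elimˡ {A j z} h′) (∧-intro (∧-elimʳ {A j z} h′) (joined (j≢i ∘ sym) (∧-elimˡ h) (∧-elimˡ h′))))))))

      L≤non : ∀ i w → nbr G (A i) w ≡ 0 → non G (A i) w ≡ L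
      L≤non i w eq = trans (cong (_+ non G (A i) w) (sym eq)) (trans (nbr+non G (A i) w) (#A i))

      -- Missing all of `A i` uses up the whole allowance `ν w ≤ L`, so `w` is joined to every other
      -- part.
      V-joined : ∀ {i j} → j ≢ i → ∀ {w} → V i w ≡ true → non G (A j) w ≡ 0
      V-joined {i} {j} j≢i {w} h = n≤0⇒n≡0 (+-cancelˡ-≤ L _ _ (begin
        L + non G (A j) w  ≡⟨ cong (_+ non G (A j) w) (sym (L≤non i w (does⇒ (nbr G (A i) w ≟ 0) (∧-elimʳ {S w ∧ ok w} h)))) ⟩
        non G (A i) w + non G (A j) w  ≤⟨ two-terms≤sum (λ i → non G (A i) w) (j≢i ∘ sym) ⟩
        ν w  ≤⟨ does⇒ (ν w ≤? L) (∧-elimʳ {S w} (∧-elimˡ h)) ⟩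
        L                                   ≡⟨ sym (+-identityʳ L) ⟩
        L + 0  ∎))
        where open ≤-Reasoning

      V⊑S : ∀ i → V i ⊑ S
      V⊑S i w h = ∧-elimˡ (∧-elimˡ h)

      V-independent : ∀ i {x y} → V i x ≡ true → V i y ≡ true → adj G x y ≡ false
      V-independent i {x} {y} Vx Vy with true∨false (adj G x y)
      ... | inj₂ xy = xy
      ... | inj₁ xy = ⊥-elim (free (plus-edge K i (V⊑S i x Vx) (V⊑S i y Vy) xy (≤-trans T≤L (A-large i))
        (λ j j≢i → ≤-trans T≤L (≤-trans (A-large j) (#-mono (λ z Az → ∧-intro Az
          (∧-intro (non≡0⇒adj G (A j) x (V-joined j≢i Vx) z Az) (non≡0⇒adj G (A j) y (V-joined j≢i Vy) z Az))))))))

      V-disjoint : ∀ {i j} → i ≢ j → ∀ x → V i x ≡ true → V j x ≡ true → ⊥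
      V-disjoint {i} {j} i≢j x Vi Vj = >⇒≢ (≤-trans 1≤T T≤L) (trans (sym (#A j)) (trans (sym (nbr+non G (A j) x))
        (cong₂ _+_ (does⇒ (nbr G (A j) x ≟ 0) (∧-elimʳ {S x ∧ ok x} Vj)) (V-joined (i≢j ∘ sym) Vi))))

      V-nbr : ∀ i {x} → V i x ≡ true → nbr G (V i) x ≡ 0
      V-nbr i {x} Vx = ∉⇒#≡0 _ lemma
        where
        lemma : ∀ y → (V i ∩ adj G x) y ≡ false
        lemma y with true∨false (V i y)
        ... | inj₁ Vy rewrite Vy = V-independent i Vx Vy
        ... | inj₂ Vy rewrite Vy = refl

      #V≤c : ∀ i → # (V i) ≤ c
      #V≤c i with 0 <? # (V i)
      ... | no ¬0< = ≤-trans (≮⇒≥ ¬0<) z≤n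
      ... | yes 0< with x , Vx ← #-inhabited (V i) 0< = ≤-trans
              (#-mono {B = S ∩ nonadj G x} (λ y Vy → ∧-intro (V⊑S i y Vy) (cong not (V-independent i Vx Vy))))
              (non≤ x (V⊑S i x Vx))

      -- Every vertex misses at least `L` vertices of the parts and a bad one at least `L + 1`,
      -- while the total is at most `(ρ+1)Lc ≤ L(# S + ρ)`. The surplus over `L * # S` bounds the
      -- number of bad vertices.
      #bad : # (S ∖ ok) ≤ L * ρ
      #bad = certify 0 (+-mono-≤ (+-mono-≤ lower upper) (+-mono-≤ (≤-reflexive (cong (L *_) (#-complement S ok))) (*-monoʳ-≤ L (*⌈⌉≤ ρ 0<#S))))
        (lemma L ρ c (# S) (# (S ∩ ok)) (# (S ∖ ok)) (sum-over S ν))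
        where
        lower : # (S ∩ ok) * L + # (S ∖ ok) * suc L ≤ sum-over S ν
        lower = ≤-trans (+-mono-≤
            (sum-over-≥ (S ∩ ok) (λ w h → [ (λ (i , eq) → ≤-trans (≤-reflexive (sym (L≤non i w eq))) (term≤sum (λ i → non G (A i) w) i)) , <⇒≤ ]′ (misses-part w (∧-elimˡ h))))
            (sum-over-≥ (S ∖ ok) (λ w h → ≰⇒> (¬does⇒ (ν w ≤? L) (not-true (∧-elimʳ {S w} h))))))
          (≤-reflexive (sym (sum-over-+ˡ {A = S} {S ∩ ok} {S ∖ ok} ν (λ w → ⟦⟧-complement (S w) (ok w)))))
        upper : sum-over S ν ≤ suc ρ * (L * c)
        upper = non-count G S A L c inside #A non≤
        lemma : ∀ L ρ c q a b s → b + (s + suc ρ * (L * c) + (L * (a + b) + L * (q + ρ))) + 0 ≡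
          L * ρ + (a * L + b * suc L + s + (L * q + L * (suc ρ * c)))
        lemma = solve-∀

      -- The other `ρ` classes have at most `c` vertices each, and all but `L * ρ` vertices are in a
      -- class; the further `ρ` is the rounding error of `c`.
      V-large : ∀ i → c ≤ # (V i) + (L * ρ + ρ)
      V-large i = certify 0 (+-mono-≤ (+-mono-≤ cover (sum≤term+rest (λ i → # (V i)) i #V≤c)) (+-mono-≤ #bad (*⌈⌉≤ ρ 0<#S)))
          (lemma c ρ (L * ρ) (# S) (# (V i)) (# (S ∖ ok)) (sum (λ i → # (V i))))
        where
        lemma : ∀ c ρ g q v b s → c + (s + b + (v + ρ * c) + (g + (q + ρ))) + 0 ≡
          v + (g + ρ) + (q + s + (b + suc ρ * c))
        lemma = solve-∀
        cover : # S ≤ sum (λ i → # (V i)) + # (S ∖ ok)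
        cover = ≤-trans (sum-mono pointwise)
          (≤-reflexive (trans (sum-+ (λ w → sum (λ i → ⟦ V i w ⟧)) (λ w → ⟦ (S ∖ ok) w ⟧)) (cong (_+ # (S ∖ ok)) (sum-comm _))))
          where
          pointwise : ∀ w → ⟦ S w ⟧ ≤ sum (λ i → ⟦ V i w ⟧) + ⟦ (S ∖ ok) w ⟧
          pointwise w with true∨false (S w) | true∨false (ok w)
          ... | inj₂ Sw | _        rewrite Sw = z≤n
          ... | inj₁ Sw | inj₂ okw rewrite Sw | okw = m≤n+m 1 _
          ... | inj₁ Sw | inj₁ okw with misses-part w Sw
          ...   | inj₂ L<ν = contradiction (does⇒ (ν w ≤? L) okw) (<⇒≱ L<ν)
          ...   | inj₁ (i , eq) = ≤-trans (≤-reflexive (trans (cong ⟦_⟧ Sw) (sym (cong ⟦_⟧ Vw)))) (≤-trans (term≤sum (λ i → ⟦ V i w ⟧) i) (m≤m+n _ _))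
            where
            Vw : V i w ≡ true
            Vw = ∧-intro (∧-intro Sw okw) (dec-true (nbr G (A i) w ≟ 0) eq)

    classes : Classes S ρ c (L * ρ + ρ)
    classes = record { V = V ; V⊑S = V⊑S ; independent = V-nbr ; disjoint = V-disjoint ; large = V-large }

  -- After `T` vertices of the first set are fixed, each other set loses at most `T * γ` vertices
  -- that are not joined to all of them; the surplus in the hypothesis pays for `j` such rounds.
  greedy-multipartite : ∀ j T γ (W : Fin j → Sub n) → (∀ i k → i ≢ k → ∀ x → W i x ≡ true → non G (W k) x ≤ γ) →
    (∀ i → T + j * (T * γ) ≤ # (W i)) →
    Σ (Fin j → Sub n) λ A → (∀ i → A i ⊑ W i) × (∀ i → T ≤ # (A i)) × Joined G A
  greedy-multipartite zero T γ W _ _ = (λ ()) , (λ ()) , (λ ()) , λ { {()} }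
  greedy-multipartite (suc j) T γ W non≤ large
    with A₀ , A₀⊑ , #A₀ ← shrink T (W zero) (≤-trans (m≤m+n T _) (large zero))
    = A , A⊑ , A-large , A-joined
    where
    ok : Sub n
    ok y = does (non G A₀ y ≟ 0)
    W′ : Fin j → Sub n
    W′ k = W (suc k) ∩ ok
    lost : ∀ k → # (W (suc k) ∖ ok) ≤ T * γ
    lost k = begin
      # (W (suc k) ∖ ok)  ≡⟨ sym (*-identityʳ _) ⟩
      # (W (suc k) ∖ ok) * 1  ≤⟨ sum-over-≥ (W (suc k) ∖ ok) (λ y h → n≢0⇒n>0 (¬does⇒ (non G A₀ y ≟ 0) (not-true (∧-elimʳ {W (suc k) y} h)))) ⟩
      sum-over (W (suc k) ∖ ok) (non G A₀)  ≤⟨ sum-mono (λ y → *-monoˡ-≤ (non G A₀ y) (⟦⟧-mono (∧-elimˡ {W (suc k) y}))) ⟩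
      cross (nonadj G) (W (suc k)) A₀  ≡⟨ cross-comm (nonadj G) (nonadj-sym G) (W (suc k)) A₀ ⟩
      cross (nonadj G) A₀ (W (suc k))  ≤⟨ sum-over-≤ A₀ (λ x Ax → non≤ zero (suc k) (λ ()) x (A₀⊑ x Ax)) ⟩
      # A₀ * γ  ≡⟨ cong (_* γ) #A₀ ⟩
      T * γ  ∎
      where open ≤-Reasoning
    large′ : ∀ k → T + j * (T * γ) ≤ # (W′ k)
    large′ k = certify 0 (+-mono-≤ (large (suc k)) (+-mono-≤ (lost k) (≤-reflexive (#-complement (W (suc k)) ok))))
      (lemma T (j * (T * γ)) (T * γ) (# (W (suc k))) (# (W′ k)) (# (W (suc k) ∖ ok)))
      where
      lemma : ∀ T a g w w′ b → T + a + (w + (g + (w′ + b))) + 0 ≡ w′ + (T + (g + a) + (b + w))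
      lemma = solve-∀
    IH = greedy-multipartite j T γ W′
      (λ i k i≢k x h → ≤-trans (non-mono G (∩⊑ˡ (W (suc k)) ok) x) (non≤ (suc i) (suc k) (i≢k ∘ Fin.suc-injective) x (∧-elimˡ h)))
      large′
    A′ = proj₁ IH
    A′⊑ = proj₁ (proj₂ IH)
    A : Fin (suc j) → Sub n
    A zero    = A₀
    A (suc i) = A′ i
    A⊑ : ∀ i → A i ⊑ W i
    A⊑ zero        = A₀⊑
    A⊑ (suc i) x h = ∧-elimˡ (A′⊑ i x h)
    A-large : ∀ i → T ≤ # (A i)
    A-large zero    = ≤-reflexive (sym #A₀)
    A-large (suc i) = proj₁ (proj₂ (proj₂ IH)) i
    A₀~A′ : ∀ {k x y} → A₀ x ≡ true → A′ k y ≡ true → adj G y x ≡ true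
    A₀~A′ {k} {x} {y} Ax A′y = non≡0⇒adj G A₀ y (does⇒ (non G A₀ y ≟ 0) (∧-elimʳ {W (suc k) y} (A′⊑ k y A′y))) x Ax
    A-joined : Joined G A
    A-joined {zero}  {zero}  i≢k _  _  = contradiction refl i≢k
    A-joined {zero}  {suc k} _   Ax Ay = adj-flip G (A₀~A′ Ax Ay)
    A-joined {suc i} {zero}  _   Ax Ay = A₀~A′ Ay Ax
    A-joined {suc i} {suc k} i≢k Ax Ay = proj₂ (proj₂ (proj₂ IH)) (i≢k ∘ cong suc) Ax Ay

  ProperOn : ∀ {k} → Sub n → (Fin n → Fin k) → Set
  ProperOn S π = ∀ x y → S x ≡ true → S y ≡ true → adj G x y ≡ true → π x ≢ π y

  module _ {ρ T γ : ℕ} {S : Sub n} (non≤ : SmallNon G ρ S) (free : ¬ PlusEdge G S ρ T)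
    (C : Classes S ρ ⌈ # S /1+ ρ ⌉ γ) (c-large : 2 * (T + suc ρ * (T * γ)) + 4 * γ < ⌈ # S /1+ ρ ⌉) where

    open Classes C

    private
      c = ⌈ # S /1+ ρ ⌉
      Θ = T + suc ρ * (T * γ)

      two-classes : ∀ {i j} → i ≢ j → ∀ x → S x ≡ true → non G (V i) x + non G (V j) x ≤ c
      two-classes {i} {j} i≢j x Sx = ≤-trans (#-disjoint-⊑
          {A = V i ∩ nonadj G x} {V j ∩ nonadj G x} {S ∩ nonadj G x}
          (λ y h → ∧-intro (V⊑S i y (∧-elimˡ h)) (∧-elimʳ {V i y} h))
          (λ y h → ∧-intro (V⊑S j y (∧-elimˡ h)) (∧-elimʳ {V j y} h))
          (λ y h h′ → disjoint i≢j y (∧-elimˡ h) (∧-elimˡ h′)))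
        (non≤ x Sx)

      -- The missed class already accounts for all but `γ` of the `c` permitted non-neighbours.
      few-non : ∀ {i j} → j ≢ i → ∀ {x} → S x ≡ true → nbr G (V i) x ≡ 0 → non G (V j) x ≤ γ
      few-non {i} {j} j≢i {x} Sx eq = certify 0
        (+-mono-≤ (two-classes (j≢i ∘ sym) x Sx) (+-mono-≤ (large i) (≤-reflexive (sym (trans (cong (_+ non G (V i) x) (sym eq)) (nbr+non G (V i) x))))))
        (lemma (non G (V j) x) (non G (V i) x) c (# (V i)) γ)
        where
        lemma : ∀ b a c v γ → b + (c + (v + γ + a)) + 0 ≡ γ + (a + b + (c + v))
        lemma = solve-∀

      V-few-non : ∀ {i j} → j ≢ i → ∀ {x} → V i x ≡ true → non G (V j) x ≤ γ
      V-few-non {i} j≢i {x} Vx = few-non j≢i (V⊑S i x Vx) (independent i Vx)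

      Θ≤ : ∀ i → Θ ≤ # (V i)
      Θ≤ i = certify (Θ + 3 * γ + 1) (+-mono-≤ c-large (large i)) (lemma Θ γ c (# (V i)))
        where
        lemma : ∀ Θ γ c v → Θ + (c + (v + γ)) + (Θ + 3 * γ + 1) ≡ v + (suc (2 * Θ + 4 * γ) + c)
        lemma = solve-∀

      -- `Θ` is what `greedy-multipartite` needs in order to find parts of size `T` inside the
      -- common neighbourhoods, so the edge `x y` would complete a `PlusEdge`.
      no-edge : ∀ i {x y} → S x ≡ true → S y ≡ true → adj G x y ≡ true →
        ¬ (∀ j → j ≢ i → Θ ≤ # (V j ∩ adj G x ∩ adj G y))
      no-edge i {x} {y} Sx Sy xy common = plus-free (greedy-multipartite (suc ρ) T γ (cut V i x y)
          (λ j k j≢k z h → ≤-trans (non-mono G (∩⊑ˡ (V k) _) z) (V-few-non (j≢k ∘ sym) {z} (∧-elimˡ {V j z} h)))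
          (cut-large V {i} {x} {y} Θ (Θ≤ i) common))
        where
        plus-free : ¬ (Σ (Fin (suc ρ) → Sub n) λ A → (∀ j → A j ⊑ cut V i x y j) × (∀ j → T ≤ # (A j)) × Joined G A)
        plus-free (A , A⊑ , A-large , A-joined) = free record
          { multipartite = record { part = A ; inside = λ j z h → V⊑S j z (∧-elimˡ {V j z} (A⊑ j z h)) ; large = A-large ; joined = A-joined }
          ; i = i ; x = x ; y = y ; x∈S = Sx ; y∈S = Sy ; x~y = xy
          ; x-joined = λ {j} j≢i {z} h → ∧-elimˡ {adj G x z} (cut-≢ V {i} {x} {y} j≢i {z} (A⊑ j z h))
          ; y-joined = λ {j} j≢i {z} h → ∧-elimʳ {adj G x z} (cut-≢ V {i} {x} {y} j≢i {z} (A⊑ j z h))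
          }

      -- The dichotomy of `misses-part`, now with the classes in place of the bounded parts. Since
      -- the classes are almost of size `c`, it leaves no exceptional vertex.
      misses-class : ∀ x → S x ≡ true → ∃[ i ] nbr G (V i) x ≡ 0
      misses-class x Sx with any? (λ i → nbr G (V i) x ≟ 0)
      ... | yes p = p
      ... | no ¬p with at-most-one (λ i → nbr G (V i) x < Θ + γ) (λ i → nbr G (V i) x <? Θ + γ)
      ...   | inj₁ (i , j , i≢j , few-i , few-j) = contradiction c-large (≤⇒≯ (certify 2
                (+-mono-≤ (+-mono-≤ few-i few-j) (+-mono-≤ (two-classes i≢j x Sx)
                  (+-mono-≤ (+-mono-≤ (large i) (large j))
                    (+-mono-≤ (≤-reflexive (sym (nbr+non G (V i) x))) (≤-reflexive (sym (nbr+non G (V j) x)))))))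
                (lemma c Θ γ (nbr G (V i) x) (nbr G (V j) x) (non G (V i) x) (non G (V j) x) (# (V i)) (# (V j)))))
        where
        lemma : ∀ c Θ γ a b d e v w →
          c + (Θ + γ + (Θ + γ) + (c + (v + γ + (w + γ) + (a + d + (b + e))))) + 2 ≡
          2 * Θ + 4 * γ + (suc a + suc b + (d + e + (c + c + (v + w))))
        lemma = solve-∀
      ...   | inj₂ (i , others) with y , h ← #-inhabited (V i ∩ adj G x) (n≢0⇒n>0 (λ eq → ¬p (i , eq)))
        = ⊥-elim (no-edge i Sx (V⊑S i y (∧-elimˡ h)) (∧-elimʳ {V i y} h) (λ j j≢i → certify 0
            (+-mono-≤ (≮⇒≥ (others j j≢i)) (+-mono-≤ (#≤common+non+non (V j) x y)
              (+-mono-≤ (V-few-non j≢i {y} (∧-elimˡ h)) (≤-reflexive (nbr+non G (V j) x)))))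
            (lemma Θ γ (nbr G (V j) x) (# (V j)) (# (V j ∩ adj G x ∩ adj G y)) (non G (V j) x) (non G (V j) y))))
        where
        lemma : ∀ Θ γ a v w d e → Θ + (a + (w + (d + e) + (γ + v))) + 0 ≡ w + (Θ + γ + (v + (e + (a + d))))
        lemma = solve-∀

    proper-colouring : Σ (Fin n → Fin (suc ρ)) (ProperOn S)
    proper-colouring = π , proper
      where
      choose : ∀ x → Dec (∃[ i ] nbr G (V i) x ≡ 0) → Fin (suc ρ)
      choose x (yes (i , _)) = i
      -- A default, taken only outside `S`, by `misses-class`.
      choose x (no _)        = zero
      π : Fin n → Fin (suc ρ)
      π x = choose x (any? (λ i → nbr G (V i) x ≟ 0))
      π-misses : ∀ x → S x ≡ true → nbr G (V (π x)) x ≡ 0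
      π-misses x Sx with any? (λ i → nbr G (V i) x ≟ 0)
      ... | yes (_ , eq) = eq
      ... | no ¬p = contradiction (misses-class x Sx) ¬p
      proper : ProperOn S π
      -- Both ends miss the same class, so each has at most `γ` non-neighbours in every other class
      -- and their common neighbourhoods there are large.
      proper x y Sx Sy xy πx≡πy = no-edge (π x) Sx Sy xy (λ j j≢i → certify (Θ + γ + 1)
        (+-mono-≤ (#≤common+non+non (V j) x y)
          (+-mono-≤ (+-mono-≤ (few-non j≢i Sx (π-misses x Sx)) (few-non j≢i Sy (subst (λ i → nbr G (V i) y ≡ 0) (sym πx≡πy) (π-misses y Sy))))
            (+-mono-≤ c-large (large j))))
        (lemma Θ γ c (# (V j)) (# (V j ∩ adj G x ∩ adj G y)) (non G (V j) x) (non G (V j) y)))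
        where
        lemma : ∀ Θ γ c v w d e → Θ + (w + (d + e) + (γ + γ + (c + (v + γ)))) + (Θ + γ + 1) ≡
          w + (v + (d + e + (suc (2 * Θ + 4 * γ) + c)))
        lemma = solve-∀

ColourableAbove : (N ρ T : ℕ) → Set₁
ColourableAbove N ρ T = ∀ {n} (G : Graph n) S → N < # S → SmallNon G ρ S → ¬ PlusEdge G S ρ T →
  Σ (Fin n → Fin (suc ρ)) (ProperOn G S)

colouring : ∀ ρ T → 1 ≤ T → ∃[ N ] ColourableAbove N ρ T
colouring ρ T 1≤T with N , find ← multipartite ρ (suc ρ) (2 * T) ≤-refl (≤-trans 1≤T (m≤m+n T _))
  = N ⊔ suc ρ * C , λ G S N<#S non≤ free →
      let K , #A = trim G (find G S (≤-<-trans (m≤m⊔n N _) N<#S) non≤) in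
      proper-colouring G non≤ free (classes G 1≤T ≤-refl (≤-trans z<s N<#S) non≤ free K #A)
        (*-cancelˡ-< (suc ρ) C _ (≤-trans (≤-<-trans (m≤n⊔m N _) N<#S) (≤*⌈⌉ ρ (# S))))
  where
  -- The loss in `classes` for `L = 2 * T`; `C` is the lower bound on the class size that
  -- `proper-colouring` requires.
  γ = 2 * T * ρ + ρ
  C = 2 * (T + suc ρ * (T * γ)) + 4 * γ

-- Colourings, cliques and deletion of low-degree vertices

module _ (G : Graph n) where

  proper⇒no-clique : ∀ {ρ S} (π : Fin n → Fin (suc ρ)) → ProperOn G S π → ¬ Clique G S (suc (suc ρ))
  proper⇒no-clique π proper (f , f∈ , f-adj)
    with i , j , i<j , eq ← pigeonhole (n<1+n _) (π ∘ f)
    = proper (f i) (f j) (f∈ i) (f∈ j) (f-adj i j (λ { refl → <-irrefl refl i<j })) eq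

  LowDegree : ℕ → Sub n → Set
  LowDegree ρ S = ∃[ v ] S v ≡ true × ⌈ # S /1+ ρ ⌉ < non G S v

  smallNon? : ∀ ρ S → SmallNon G ρ S ⊎ LowDegree ρ S
  smallNon? ρ S with any? (λ v → S v Bool.≟ true ×-dec ⌈ # S /1+ ρ ⌉ <? non G S v)
  ... | yes p = inj₂ p
  ... | no ¬p = inj₁ (λ x Sx → ≮⇒≥ (λ lt → ¬p (x , Sx , lt)))

  plus-edge-mono : ∀ {S S′ ρ T} → S′ ⊑ S → PlusEdge G S′ ρ T → PlusEdge G S ρ T
  plus-edge-mono {S} {S′} S′⊑S P = record
    { multipartite = record { part = part ; inside = λ i z h → S′⊑S z (inside i z h) ; large = large ; joined = joined }
    ; i = i ; x = x ; y = y ; x∈S = S′⊑S x x∈S ; y∈S = S′⊑S y y∈S ; x~y = x~y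
    ; x-joined = x-joined ; y-joined = y-joined }
    where open PlusEdge P

  multipartite-mono : ∀ {S S′ j L} → S′ ⊑ S → Multipartite G S′ j L → Multipartite G S j L
  multipartite-mono S′⊑S K = record { part = part ; inside = λ i z h → S′⊑S z (inside i z h) ; large = large ; joined = joined }
    where open Multipartite K

  module Delete {ρ q : ℕ} {S : Sub n} {v : Fin n} (Sv : S v ≡ true) (#S : # S ≡ suc q) where
    #S─v : # (S ─ v) ≡ q
    #S─v = suc-injective (trans (sym (#-─ S Sv)) #S)

    deleted : D G S + 2 * non G S v ≡ D G (S ─ v) + 2 * suc q
    deleted = trans (D-─ G S Sv) (cong (λ q → D G (S ─ v) + 2 * q) #S)

    step : ex ρ (suc q) + ⌈ # S /1+ ρ ⌉ ≡ ex ρ q + suc q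
    step = trans (cong (λ q′ → ex ρ (suc q) + ⌈ q′ /1+ ρ ⌉) #S) (ex-suc ρ q)

    open Deletion {D G S} {non G S v} {D G (S ─ v)} {suc q} {ex ρ (suc q)} {⌈ # S /1+ ρ ⌉} {ex ρ q} deleted step public

-- Simonovits' theorem

TuránBoundAbove LowDegreeAbove : (N ρ T : ℕ) → Set₁
TuránBoundAbove N ρ T = ∀ {n} (G : Graph n) S → N ≤ # S → ¬ PlusEdge G S ρ T → TuránBound G ρ S
LowDegreeAbove N ρ T = ∀ {n} (G : Graph n) S → N < # S → ¬ PlusEdge G S ρ T →
  ∃[ v ] S v ≡ true × ⌈ # S /1+ ρ ⌉ ≤ non G S v

NearlyExtremalAbove : (N ρ T d L : ℕ) → Set₁
NearlyExtremalAbove N ρ T d L = ∀ {n} (G : Graph n) S → N < # S → ¬ PlusEdge G S ρ T →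
  2 * ex ρ (# S) ≤ D G S + 2 * d → Multipartite G S (suc ρ) L

-- Every deletion of a vertex of degree below the minimum degree of the Turán graph
-- lowers the excess C ∸ k by one, until it is used up.
module _ {ρ T N : ℕ} (colour : ColourableAbove N ρ T) where

  private
    -- The trivial bound on `D` for `N + 1` vertices, where the deletions stop at the latest.
    C = suc N * suc N

  -- The truncated difference `C ∸ k` is 0 from `k = C` on. Whenever the minimum degree suffices,
  -- `S` is colourable and Turán's theorem settles the case without recursion.
  excess : ∀ {n} (G : Graph n) k S → # S ≡ suc N + k → ¬ PlusEdge G S ρ T →
    D G S ≤ 2 * (ex ρ (suc N + k) + (C ∸ k)) ×
    (C < k → D G S ≡ 2 * ex ρ (suc N + k) → CompleteBalanced G ρ S)
  excess G k S #S free = by-degrees k #S (smallNon? G ρ S)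
    where
    Excess : ℕ → Set
    Excess k = D G S ≤ 2 * (ex ρ (suc N + k) + (C ∸ k)) × (C < k → D G S ≡ 2 * ex ρ (suc N + k) → CompleteBalanced G ρ S)
    colourable : ∀ k → # S ≡ suc N + k → Σ (Fin _ → Fin (suc ρ)) (ProperOn G S) → Excess k
    colourable k #S (π , proper) = ≤-trans (proj₁ t) (*-monoʳ-≤ 2 (m≤m+n (ex ρ (suc N + k)) (C ∸ k))) , λ _ → proj₂ t
      where t = turán G ρ (suc N + k) S #S (proper⇒no-clique G π proper)
    by-degrees : ∀ k → # S ≡ suc N + k → SmallNon G ρ S ⊎ LowDegree G ρ S → Excess k
    by-degrees k #S (inj₁ small) = colourable k #S (colour G S (≤-trans (m≤m+n (suc N) k) (≤-reflexive (sym #S))) small free)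
    by-degrees zero #S (inj₂ _) = ≤-trans (D≤#² G S)
        (≤-trans (≤-reflexive (cong (λ q → q * q) (trans #S (+-identityʳ (suc N)))))
          (≤-trans (m≤n+m C (ex ρ (suc N + 0))) (m≤m+n _ _))) ,
      λ ()
    by-degrees (suc k) #S (inj₂ (v , Sv , c<ν)) = aux (m≤n⇒m<n∨m≡n (z≤n {C ∸ k}))
      where
      q = suc N + k
      #S′ : # S ≡ suc q
      #S′ = trans #S (+-suc (suc N) k)
      open Delete G {ρ} Sv #S′
      IH = excess G k (S ─ v) #S─v (free ∘ plus-edge-mono G (─⊑ S v))
      aux : 0 < C ∸ k ⊎ 0 ≡ C ∸ k → Excess (suc k)
      aux (inj₁ 0<x) = subst (λ q → D G S ≤ 2 * (ex ρ q + (C ∸ suc k))) (sym (+-suc (suc N) k)) D≤ ,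
        λ C<k → contradiction (m∸n≢0⇒n<m (>⇒≢ 0<x)) (≤⇒≯ (s≤s⁻¹ C<k))
        where
        x≡ : C ∸ k ≡ suc (C ∸ suc k)
        x≡ = +-∸-assoc 1 {C} {suc k} (m∸n≢0⇒n<m (>⇒≢ 0<x))
        D≤ : D G S ≤ 2 * (ex ρ (suc q) + (C ∸ suc k))
        -- The strict inequality `c<ν` supplies one non-neighbour more than the Turán step; it pays
        -- for the unit by which the excess falls.
        D≤ = Deletion.D≤2t {c = suc ⌈ # S /1+ ρ ⌉} {ex ρ q + suc (C ∸ suc k)} deleted
          (trans (lemma (ex ρ (suc q)) (C ∸ suc k) ⌈ # S /1+ ρ ⌉)
            (trans (cong (_+ suc (C ∸ suc k)) step) (lemma′ (ex ρ q) (suc q) (suc (C ∸ suc k)))))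
          c<ν (subst (λ x → D G (S ─ v) ≤ 2 * (ex ρ q + x)) x≡ (proj₁ IH))
          where
          lemma : ∀ t x c → t + x + suc c ≡ t + c + suc x
          lemma = solve-∀
          lemma′ : ∀ t q x → t + q + x ≡ t + x + q
          lemma′ = solve-∀
      -- Here the excess is used up, and a further vertex of too small degree makes the bound
      -- strict. Equality is therefore possible only in the colourable case.
      aux (inj₂ 0≡x) = ≤-trans (<⇒≤ (subst (λ q → D G S < 2 * ex ρ q) (sym (+-suc (suc N) k)) D<)) (*-monoʳ-≤ 2 (m≤m+n (ex ρ (suc N + suc k)) (C ∸ suc k))) ,
        λ _ D≡ → contradiction (subst (λ q → D G S ≡ 2 * ex ρ q) (+-suc (suc N) k) D≡) (<⇒≢ D<)
        where
        D< : D G S < 2 * ex ρ (suc q)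
        D< = ≰⇒> (λ 2t≤D → <⇒≱ c<ν (ν≤c (≤-trans (proj₁ IH) (≤-reflexive (cong (2 *_) (trans (cong (ex ρ q +_) (sym 0≡x)) (+-identityʳ _))))) 2t≤D))

  excess-used-up : ∀ {n} (G : Graph n) S → suc N + suc C ≤ # S → ¬ PlusEdge G S ρ T →
    TuránBound G ρ S
  excess-used-up G S N≤ free = rephrase (excess G κ S #S≡ free)
    where
    κ : ℕ
    κ = # S ∸ suc N
    #S≡ : # S ≡ suc N + κ
    #S≡ = sym (m+[n∸m]≡n (≤-trans (m≤m+n (suc N) (suc C)) N≤))
    C<k : C < κ
    C<k = subst (_≤ κ) (m+n∸m≡n (suc N) (suc C)) (∸-monoˡ-≤ (suc N) N≤)
    rephrase : D G S ≤ 2 * (ex ρ (suc N + κ) + (C ∸ κ)) × (C < κ → D G S ≡ 2 * ex ρ (suc N + κ) → CompleteBalanced G ρ S) →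
      TuránBound G ρ S
    rephrase (D≤ , D≡) =
      subst (D G S ≤_) (cong (2 *_) (trans (cong₂ (λ q x → ex ρ q + x) (sym #S≡) (m≤n⇒m∸n≡0 (<⇒≤ C<k))) (+-identityʳ _))) D≤ ,
      λ eq → D≡ C<k (trans eq (cong (λ q → 2 * ex ρ q) #S≡))

simonovits : ∀ ρ T → 1 ≤ T → ∃[ N ] TuránBoundAbove N ρ T
simonovits ρ T 1≤T = _ , excess-used-up (proj₂ (colouring ρ T 1≤T))

-- It provides the vertex of M to be deleted. Either the degree is strictly too small somewhere, or
-- the graph is colourable, hence without a clique of size `ρ + 2`, and `vertex-of-small-degree`
-- applies.
low-degree-vertex : ∀ ρ T → 1 ≤ T → ∃[ N ] LowDegreeAbove N ρ T
low-degree-vertex ρ T 1≤T = _ , find (proj₂ (colouring ρ T 1≤T))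
  where
  find : ∀ {N} → (ColourableAbove N ρ T) →
    LowDegreeAbove N ρ T
  find colour G S N<#S free = by-degrees (smallNon? G ρ S)
    where
    by-degrees : SmallNon G ρ S ⊎ (LowDegree G ρ S) → ∃[ v ] S v ≡ true × ⌈ # S /1+ ρ ⌉ ≤ non G S v
    by-degrees (inj₁ small) = vertex-of-small-degree G ρ S (≤-trans z<s N<#S)
      (proper⇒no-clique G (proj₁ (colour G S N<#S small free)) (proj₂ (colour G S N<#S small free)))
    by-degrees (inj₂ (v , Sv , c<ν)) = v , Sv , <⇒≤ c<ν

-- Induction on the deficiency `d`. A vertex of too small degree can be deleted at the price of one
-- unit of `d`; at `d = 0` it would contradict Simonovits' theorem. Without such a vertex the
-- minimum degree yields the multipartite subgraph.
near-extremal : ∀ ρ T L → 1 ≤ T → 1 ≤ L → ∀ d → ∃[ N ] NearlyExtremalAbove N ρ T d L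
near-extremal ρ T L 1≤T 1≤L d = by-deletion (proj₂ (multipartite ρ (suc ρ) L ≤-refl 1≤L)) d
  where
  module _ {N₁} (find : ∀ {n} (G : Graph n) S → N₁ < # S → SmallNon G ρ S → Multipartite G S (suc ρ) L) where

    extremal : ∀ {N₂} → (TuránBoundAbove N₂ ρ T) → NearlyExtremalAbove (N₁ ⊔ N₂) ρ T 0 L
    extremal {N₂} sim G S N<#S free 2t≤D = by-degrees (smallNon? G ρ S)
      where
      by-degrees : SmallNon G ρ S ⊎ (LowDegree G ρ S) → Multipartite G S (suc ρ) L
      by-degrees (inj₁ small) = find G S (≤-<-trans (m≤m⊔n N₁ N₂) N<#S) small
      by-degrees (inj₂ (v , Sv , c<ν)) = contradiction c<ν (≤⇒≯ (ν≤c
          (proj₁ (sim G (S ─ v) (s≤s⁻¹ (≤-trans (≤-<-trans (m≤n⊔m N₁ N₂) N<#S) (≤-reflexive (#-─ S Sv)))) (free ∘ plus-edge-mono G (─⊑ S v))))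
          (subst (λ q → 2 * ex ρ q ≤ D G S) (#-─ S Sv) (≤-trans 2t≤D (≤-reflexive (+-identityʳ _))))))
        where open Delete G {ρ} Sv (#-─ S Sv)

    step-up : ∀ {d N₂} → NearlyExtremalAbove N₂ ρ T d L → NearlyExtremalAbove (N₁ ⊔ suc N₂) ρ T (suc d) L
    step-up {d} {N₂} IH G S N<#S free 2t≤D = by-degrees (smallNon? G ρ S)
      where
      by-degrees : SmallNon G ρ S ⊎ (LowDegree G ρ S) → Multipartite G S (suc ρ) L
      by-degrees (inj₁ small) = find G S (≤-<-trans (m≤m⊔n N₁ (suc N₂)) N<#S) small
      by-degrees (inj₂ (v , Sv , c<ν)) = multipartite-mono G (─⊑ S v) (IH G (S ─ v)
          (s≤s⁻¹ (≤-trans (≤-<-trans (m≤n⊔m N₁ (suc N₂)) N<#S) (≤-reflexive (#-─ S Sv))))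
          (free ∘ plus-edge-mono G (─⊑ S v))
          -- One surplus non-neighbour of `v` is charged to the deficiency, whence the predecessor.
          (Deletion.2t′≤d {D G S + 2 * suc d} {pred (non G S v)} {D G (S ─ v) + 2 * d} {# S} {ex ρ (# S)} {⌈ # S /1+ ρ ⌉} {ex ρ (# (S ─ v))}
            (trans (lemma (D G S) d (pred (non G S v))) (trans (cong (λ ν → D G S + 2 * ν + 2 * d) (suc-pred (non G S v) {{>-nonZero (≤-trans z<s c<ν)}}))
              (trans (cong (_+ 2 * d) (D-─ G S Sv)) (lemma′ (D G (S ─ v)) (# S) d))))
            (subst (λ q → ex ρ q + ⌈ # S /1+ ρ ⌉ ≡ ex ρ (# (S ─ v)) + q) (sym (#-─ S Sv)) (Delete.step G {ρ} Sv (#-─ S Sv)))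
            (<⇒≤pred c<ν) 2t≤D))
        where
        lemma : ∀ D d ν → D + 2 * suc d + 2 * ν ≡ D + 2 * suc ν + 2 * d
        lemma = solve-∀
        lemma′ : ∀ D q d → D + 2 * q + 2 * d ≡ D + 2 * d + 2 * q
        lemma′ = solve-∀

    by-deletion : ∀ d → ∃[ N ] NearlyExtremalAbove N ρ T d L
    by-deletion zero    = _ , extremal (proj₂ (simonovits ρ T 1≤T))
    by-deletion (suc d) = _ , step-up (proj₂ (by-deletion d))

-- Turán numbers in closed form

-- The two admissible values of κ at a multiple of s = σ + 1 give the same equation.
ex-formula-/ : ∀ σ m → 2 * ex σ m + (2 * (m / suc σ) + 1) * m ≡ m * m + suc σ * ((m / suc σ) * suc (m / suc σ))
ex-formula-/ σ zero = trans (cong₂ (λ x y → 2 * x + y) (ex-zero σ) (*-zeroʳ (2 * (0 / suc σ) + 1))) (sym (trans (cong (λ q → suc σ * (q * suc q)) (0/n≡0 (suc σ))) (*-zeroʳ (suc σ))))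
ex-formula-/ σ (suc m) = aux (divmod-suc (suc σ) m)
  where
  q = m / suc σ
  old : 2 * ex σ (suc m) + (2 * q + 1) * suc m ≡ suc m * suc m + suc σ * (q * suc q)
  old = +-cancelʳ-≡ (2 * suc q) _ _ (begin
    2 * ex σ (suc m) + (2 * q + 1) * suc m + 2 * suc q  ≡⟨ lemma₁ (ex σ (suc m)) q m ⟩
    2 * (ex σ (suc m) + suc q) + (2 * q + 1) * suc m  ≡⟨ cong (λ x → 2 * x + (2 * q + 1) * suc m) (ex-suc σ m) ⟩
    2 * (ex σ m + suc m) + (2 * q + 1) * suc m  ≡⟨ lemma₂ (ex σ m) q m ⟩
    2 * ex σ m + (2 * q + 1) * m + (2 * suc m + (2 * q + 1))    ≡⟨ cong (_+ (2 * suc m + (2 * q + 1))) (ex-formula-/ σ m) ⟩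
    m * m + suc σ * (q * suc q) + (2 * suc m + (2 * q + 1))     ≡⟨ lemma₃ m q (suc σ) ⟩
    suc m * suc m + suc σ * (q * suc q) + 2 * suc q  ∎)
    where
    open ≡-Reasoning
    lemma₁ : ∀ t q m → 2 * t + (2 * q + 1) * suc m + 2 * suc q ≡ 2 * (t + suc q) + (2 * q + 1) * suc m
    lemma₁ = solve-∀
    lemma₂ : ∀ t q m → 2 * (t + suc m) + (2 * q + 1) * suc m ≡ 2 * t + (2 * q + 1) * m + (2 * suc m + (2 * q + 1))
    lemma₂ = solve-∀
    lemma₃ : ∀ m q s → m * m + s * (q * suc q) + (2 * suc m + (2 * q + 1)) ≡ suc m * suc m + s * (q * suc q) + 2 * suc q
    lemma₃ = solve-∀
  aux : (suc m / suc σ ≡ q × suc m % suc σ ≡ suc (m % suc σ)) ⊎ (suc m / suc σ ≡ suc q × suc m % suc σ ≡ 0 × suc (m % suc σ) ≡ suc σ) →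
    2 * ex σ (suc m) + (2 * (suc m / suc σ) + 1) * suc m ≡ suc m * suc m + suc σ * ((suc m / suc σ) * suc (suc m / suc σ))
  aux (inj₁ (eq , _)) rewrite eq = old
  aux (inj₂ (eq , _ , j≡s)) rewrite eq = begin
    2 * ex σ (suc m) + (2 * suc q + 1) * suc m  ≡⟨ lemma₁ (ex σ (suc m)) q m ⟩
    2 * ex σ (suc m) + (2 * q + 1) * suc m + 2 * suc m  ≡⟨ cong₂ (λ x y → x + 2 * y) old m+1≡ ⟩
    suc m * suc m + suc σ * (q * suc q) + 2 * (suc q * suc σ)  ≡⟨ lemma₂ (suc m) (suc σ) q ⟩
    suc m * suc m + suc σ * (suc q * suc (suc q))  ∎
    where
    open ≡-Reasoning
    m+1≡ : suc m ≡ suc q * suc σ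
    m+1≡ = trans (cong suc (m≡m%n+[m/n]*n m (suc σ))) (cong (_+ q * suc σ) j≡s)
    lemma₁ : ∀ t q m → 2 * t + (2 * suc q + 1) * suc m ≡ 2 * t + (2 * q + 1) * suc m + 2 * suc m
    lemma₁ = solve-∀
    lemma₂ : ∀ m s q → m * m + s * (q * suc q) + 2 * (suc q * s) ≡ m * m + s * (suc q * suc (suc q))
    lemma₂ = solve-∀

-- Twice the Turán number is `m²` minus the sum of the squared part sizes. A size `p` that is `κ` or
-- `κ + 1` satisfies `p² = (2κ+1)p − κ(κ+1)`, so that sum depends on `m` and `κ` alone. Admitting
-- both ends of the range lets two groups share one `κ`.
ex-formula : ∀ σ m κ → suc σ * κ ≤ m → m ≤ suc σ * suc κ →
  2 * ex σ m + (2 * κ + 1) * m ≡ m * m + suc σ * (κ * suc κ)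
ex-formula σ m κ lo hi = aux (m≤n⇒m<n∨m≡n hi)
  where
  -- m = s(κ + 1) is the only value in the range whose quotient is not κ.
  aux : m < suc σ * suc κ ⊎ m ≡ suc σ * suc κ → 2 * ex σ m + (2 * κ + 1) * m ≡ m * m + suc σ * (κ * suc κ)
  aux (inj₁ lt) = subst (λ q → 2 * ex σ m + (2 * q + 1) * m ≡ m * m + suc σ * (q * suc q)) m/s (ex-formula-/ σ m)
    where
    m/s : m / suc σ ≡ κ
    m/s = ≤-antisym (s≤s⁻¹ (m<n*o⇒m/o<n (≤-trans lt (≤-reflexive (*-comm (suc σ) (suc κ))))))
      (≤-trans (≤-reflexive (sym (trans (cong (_/ suc σ) (*-comm (suc σ) κ)) (m*n/n≡m κ (suc σ))))) (/-monoˡ-≤ (suc σ) lo))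
  aux (inj₂ refl) = +-cancelʳ-≡ (2 * m) _ _ (begin
    2 * ex σ m + (2 * κ + 1) * m + 2 * m  ≡⟨ lemma₁ (ex σ m) κ m ⟩
    2 * ex σ m + (2 * suc κ + 1) * m  ≡⟨ subst (λ q → 2 * ex σ m + (2 * q + 1) * m ≡ m * m + suc σ * (q * suc q)) m/s (ex-formula-/ σ m) ⟩
    m * m + suc σ * (suc κ * suc (suc κ))  ≡⟨ lemma₂ (m * m) (suc σ) κ ⟩
    m * m + suc σ * (κ * suc κ) + 2 * m  ∎)
    where
    open ≡-Reasoning
    m/s : m / suc σ ≡ suc κ
    m/s = trans (cong (_/ suc σ) (*-comm (suc σ) (suc κ))) (m*n/n≡m (suc κ) (suc σ))
    lemma₁ : ∀ t q m → 2 * t + (2 * q + 1) * m + 2 * m ≡ 2 * t + (2 * suc q + 1) * m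
    lemma₁ = solve-∀
    lemma₂ : ∀ m s q → m + s * (suc q * suc (suc q)) ≡ m + s * (q * suc q) + 2 * (s * suc q)
    lemma₂ = solve-∀

bound : ℕ → ℕ → ℕ → ℕ → ℕ
bound σ τ m ν = m * ν + ex σ m + ex τ ν

-- All parts of both groups have size `κ` or `κ + 1`, so together they are balanced; in numbers, the
-- formulas for the two groups add up to that for `m + ν`.
bound≡ex : ∀ σ τ m ν κ → suc σ * κ ≤ m → m ≤ suc σ * suc κ → suc τ * κ ≤ ν → ν ≤ suc τ * suc κ →
  bound σ τ m ν ≡ ex (σ + suc τ) (m + ν)
bound≡ex σ τ m ν κ m≥ m≤ ν≥ ν≤ = *-cancelˡ-≡ _ _ 2 (+-cancelʳ-≡ ((2 * κ + 1) * m + (2 * κ + 1) * ν) _ _ (begin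
  2 * (m * ν + ex σ m + ex τ ν) + ((2 * κ + 1) * m + (2 * κ + 1) * ν)
    ≡⟨ lemma₁ m ν (ex σ m) (ex τ ν) κ ⟩
  2 * (m * ν) + (2 * ex σ m + (2 * κ + 1) * m) + (2 * ex τ ν + (2 * κ + 1) * ν)
    ≡⟨ cong₂ (λ x y → 2 * (m * ν) + x + y) (ex-formula σ m κ m≥ m≤) (ex-formula τ ν κ ν≥ ν≤) ⟩
  2 * (m * ν) + (m * m + suc σ * (κ * suc κ)) + (ν * ν + suc τ * (κ * suc κ))
    ≡⟨ lemma₂ m ν (κ * suc κ) σ (suc τ) ⟩
  (m + ν) * (m + ν) + suc (σ + suc τ) * (κ * suc κ)
    ≡⟨ sym (ex-formula (σ + suc τ) (m + ν) κ split≤ join≤) ⟩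
  2 * ex (σ + suc τ) (m + ν) + (2 * κ + 1) * (m + ν)
    ≡⟨ cong (2 * ex (σ + suc τ) (m + ν) +_) (*-distribˡ-+ (2 * κ + 1) m ν) ⟩
  2 * ex (σ + suc τ) (m + ν) + ((2 * κ + 1) * m + (2 * κ + 1) * ν) ∎))
  where
  open ≡-Reasoning
  lemma₁ : ∀ m ν a b κ → 2 * (m * ν + a + b) + ((2 * κ + 1) * m + (2 * κ + 1) * ν) ≡
    2 * (m * ν) + (2 * a + (2 * κ + 1) * m) + (2 * b + (2 * κ + 1) * ν)
  lemma₁ = solve-∀
  lemma₂ : ∀ m ν z s t → 2 * (m * ν) + (m * m + suc s * z) + (ν * ν + t * z) ≡ (m + ν) * (m + ν) + suc (s + t) * z
  lemma₂ = solve-∀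
  split≤ : suc (σ + suc τ) * κ ≤ m + ν
  split≤ = ≤-trans (≤-reflexive (*-distribʳ-+ κ (suc σ) (suc τ))) (+-mono-≤ m≥ ν≥)
  join≤ : m + ν ≤ suc (σ + suc τ) * suc κ
  join≤ = ≤-trans (+-mono-≤ m≤ ν≤) (≤-reflexive (sym (*-distribʳ-+ (suc κ) (suc σ) (suc τ))))

-- The total size of the s largest parts of T_r(n), where s = σ + 1 and r = ρ + 1
largest : ℕ → ℕ → ℕ → ℕ
largest σ ρ n = suc σ * (n / suc ρ) + (suc σ ⊓ (n % suc ρ))

-- While the quotient stays, the minimum grows by at most one. When the remainder returns to 0, it
-- was `ρ ≥ suc σ` before, so the largest parts had all been enlarged already and the value does not
-- change.
largest-suc : ∀ σ ρ n → suc σ ≤ ρ → largest σ ρ n ≤ largest σ ρ (suc n) × largest σ ρ (suc n) ≤ suc (largest σ ρ n)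
largest-suc σ ρ n s≤ρ = [ (λ (eq , eq′) → same-quotient eq eq′) , (λ (eq , eq′ , j≡r) → next-quotient eq eq′ j≡r) ]′ (divmod-suc (suc ρ) n)
  where
  Goal : ℕ → Set
  Goal l = largest σ ρ n ≤ l × l ≤ suc (largest σ ρ n)
  same-quotient : suc n / suc ρ ≡ n / suc ρ → suc n % suc ρ ≡ suc (n % suc ρ) → Goal (largest σ ρ (suc n))
  same-quotient eq eq′ = subst₂ (λ q j → Goal (suc σ * q + (suc σ ⊓ j))) (sym eq) (sym eq′)
    ( +-monoʳ-≤ (suc σ * (n / suc ρ)) (⊓-monoʳ-≤ (suc σ) (n≤1+n (n % suc ρ)))
    , ≤-trans (+-monoʳ-≤ (suc σ * (n / suc ρ)) (⊓-monoˡ-≤ (suc (n % suc ρ)) (n≤1+n (suc σ)))) (≤-reflexive (+-suc _ _)))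
  next-quotient : suc n / suc ρ ≡ suc (n / suc ρ) → suc n % suc ρ ≡ 0 → suc (n % suc ρ) ≡ suc ρ → Goal (largest σ ρ (suc n))
  next-quotient eq eq′ j≡r = subst₂ (λ q j → Goal (suc σ * q + (suc σ ⊓ j))) (sym eq) (sym eq′)
    (≤-reflexive same , ≤-trans (≤-reflexive (sym same)) (n≤1+n _))
    where
    same : suc σ * (n / suc ρ) + (suc σ ⊓ (n % suc ρ)) ≡ suc σ * suc (n / suc ρ) + 0
    same = trans (cong (suc σ * (n / suc ρ) +_) (m≤n⇒m⊓n≡m (≤-trans s≤ρ (≤-reflexive (suc-injective (sym j≡r))))))
      (lemma (suc σ) (n / suc ρ))
      where
      lemma : ∀ s q → s * q + s ≡ s * suc q + 0
      lemma = solve-∀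

bound-largest : ∀ σ τ ν m → m ≡ largest σ (σ + suc τ) (m + ν) → bound σ τ m ν ≡ ex (σ + suc τ) (m + ν)
bound-largest σ τ ν m m≡ = bound≡ex σ τ m ν κ
    (≤-trans (m≤m+n _ _) (≤-reflexive (sym m≡)))
    (≤-trans (≤-reflexive m≡) (≤-trans (+-monoʳ-≤ (suc σ * κ) (m⊓n≤m (suc σ) j)) (≤-reflexive (lemma (suc σ) κ))))
    (≤-trans (m≤m+n _ _) (≤-reflexive (sym ν≡)))
    (≤-trans (≤-reflexive ν≡) (≤-trans (+-monoʳ-≤ (suc τ * κ) (m≤n+o⇒m∸n≤o j x (j≤ (≤-total (suc σ) j)))) (≤-reflexive (lemma (suc τ) κ))))
  where
  open ≡-Reasoning
  r = suc (σ + suc τ)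
  κ = (m + ν) / r
  j = (m + ν) % r
  x = suc σ ⊓ j
  lemma : ∀ s q → s * q + s ≡ s * suc q
  lemma = solve-∀
  lemma′ : ∀ s t q x y → x + y + q * (s + t) ≡ s * q + x + (t * q + y)
  lemma′ = solve-∀
  ν≡ : ν ≡ suc τ * κ + (j ∸ x)
  ν≡ = +-cancelˡ-≡ m _ _ (begin
    m + ν  ≡⟨ m≡m%n+[m/n]*n (m + ν) r ⟩
    j + κ * r  ≡⟨ cong (_+ κ * r) (sym (m+[n∸m]≡n (m⊓n≤n (suc σ) j))) ⟩
    x + (j ∸ x) + κ * (suc σ + suc τ)  ≡⟨ lemma′ (suc σ) (suc τ) κ x (j ∸ x) ⟩
    suc σ * κ + x + (suc τ * κ + (j ∸ x))  ≡⟨ cong (_+ (suc τ * κ + (j ∸ x))) (sym m≡) ⟩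
    m + (suc τ * κ + (j ∸ x))  ∎)
  j≤ : suc σ ≤ j ⊎ j ≤ suc σ → j ≤ x + suc τ
  j≤ (inj₁ s≤j) = ≤-trans (<⇒≤ (m%n<n (m + ν) r)) (≤-reflexive (cong (_+ suc τ) (sym (m≤n⇒m⊓n≡m s≤j))))
  j≤ (inj₂ j≤s) = ≤-trans (≤-reflexive (sym (m≥n⇒m⊓n≡n j≤s))) (m≤m+n x (suc τ))

-- Graphs split into two vertex sets

module _ (G : Graph n) where

  -- One equation of indicators expresses both disjointness and covering, and splits sums over `S`
  -- directly.
  Partition : Sub n → Sub n → Sub n → Set
  Partition S M N = ∀ x → ⟦ S x ⟧ ≡ ⟦ M x ⟧ + ⟦ N x ⟧

  module _ {S M N : Sub n} (split : Partition S M N) where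

    partition-⊑ˡ : M ⊑ S
    partition-⊑ˡ x Mx = ⟦⟧≤⇒true z<s (≤-trans (≤-trans (≤-reflexive (cong ⟦_⟧ (sym Mx))) (m≤m+n _ _)) (≤-reflexive (sym (split x))))

    partition-⊑ʳ : N ⊑ S
    partition-⊑ʳ x Nx = ⟦⟧≤⇒true z<s (≤-trans (≤-trans (≤-reflexive (cong ⟦_⟧ (sym Nx))) (m≤n+m _ _)) (≤-reflexive (sym (split x))))

    partition-∉ : ∀ x → M x ≡ true → N x ≡ false
    partition-∉ x Mx with true∨false (N x)
    ... | inj₂ Nx = Nx
    ... | inj₁ Nx = contradiction (trans (split x) (cong₂ (λ a b → ⟦ a ⟧ + ⟦ b ⟧) Mx Nx)) (at-most-1 (S x))
      where
      at-most-1 : ∀ b → ⟦ b ⟧ ≢ 2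
      at-most-1 true  ()
      at-most-1 false ()

    #-partition : # S ≡ # M + # N
    #-partition = trans (sum-cong split) (sum-+ _ _)

    non-partition : ∀ v → non G S v ≡ non G M v + non G N v
    non-partition v = trans (sum-cong (λ x → lemma (S x) (M x) (N x) (nonadj G v x) (split x))) (sum-+ _ _)
      where
      lemma : ∀ a b c d → ⟦ a ⟧ ≡ ⟦ b ⟧ + ⟦ c ⟧ → ⟦ a ∧ d ⟧ ≡ ⟦ b ∧ d ⟧ + ⟦ c ∧ d ⟧
      lemma a b c true eq = subst₂ (λ x y → x ≡ y) (cong ⟦_⟧ (sym (Bool.∧-identityʳ a))) (cong₂ (λ x y → ⟦ x ⟧ + ⟦ y ⟧) (sym (Bool.∧-identityʳ b)) (sym (Bool.∧-identityʳ c))) eq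
      lemma a b c false eq = trans (cong ⟦_⟧ (Bool.∧-zeroʳ a)) (sym (cong₂ (λ x y → ⟦ x ⟧ + ⟦ y ⟧) (Bool.∧-zeroʳ b) (Bool.∧-zeroʳ c)))

    D-partition : D G S ≡ D G M + D G N + 2 * cross (adj G) M N
    D-partition = begin
      cross a S S  ≡⟨ sum-over-+ˡ {A = S} {M} {N} _ split ⟩
      cross a M S + cross a N S  ≡⟨ cong₂ _+_ (cross-comm a (adj-sym G) M S) (cross-comm a (adj-sym G) N S) ⟩
      cross a S M + cross a S N  ≡⟨ cong₂ _+_ (sum-over-+ˡ {A = S} {M} {N} _ split) (sum-over-+ˡ {A = S} {M} {N} _ split) ⟩
      D G M + cross a N M + (cross a M N + D G N)  ≡⟨ cong (λ x → D G M + x + (cross a M N + D G N)) (cross-comm a (adj-sym G) N M) ⟩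
      D G M + cross a M N + (cross a M N + D G N)  ≡⟨ lemma (D G M) (cross a M N) (D G N) ⟩
      D G M + D G N + 2 * cross a M N  ∎
      where
      open ≡-Reasoning
      a = adj G
      lemma : ∀ x y z → x + y + (y + z) ≡ x + z + 2 * y
      lemma = solve-∀

    partition-─ : ∀ {v} → M v ≡ true → Partition (S ─ v) (M ─ v) N
    partition-─ {v} Mv x with v Fin.≟ x
    ... | yes refl rewrite partition-∉ v Mv | Mv = cong ⟦_⟧ (Bool.∧-zeroʳ (S v))
    ... | no _ rewrite Bool.∧-identityʳ (S x) | Bool.∧-identityʳ (M x) = split x

  cross-complement : ∀ M N → cross (adj G) M N + cross (nonadj G) M N ≡ # M * # N
  cross-complement M N = begin
    cross (adj G) M N + cross (nonadj G) M N  ≡⟨ sym (sum-+ _ _) ⟩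
    sum (λ x → ⟦ M x ⟧ * nbr G N x + ⟦ M x ⟧ * non G N x) ≡⟨ sum-cong (λ x → trans (sym (*-distribˡ-+ ⟦ M x ⟧ _ _)) (cong (⟦ M x ⟧ *_) (nbr+non G N x))) ⟩
    sum (λ x → ⟦ M x ⟧ * # N)  ≡⟨ sym (sum-* (# N) (λ x → ⟦ M x ⟧)) ⟩
    # M * # N  ∎
    where open ≡-Reasoning

  CompleteBetween : Sub n → Sub n → Set
  CompleteBetween M N = ∀ x y → M x ≡ true → N y ≡ true → adj G x y ≡ true

  complete⇒cross : ∀ M N → CompleteBetween M N → cross (adj G) M N ≡ # M * # N
  complete⇒cross M N complete = trans (sum-over-cong M (λ x Mx → sum-cong (λ y → cong ⟦_⟧ (lemma x Mx y)))) (sum-over-const M (# N))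
    where
    lemma : ∀ x → M x ≡ true → ∀ y → N y ∧ adj G x y ≡ N y
    lemma x Mx y with true∨false (N y)
    ... | inj₁ Ny rewrite Ny = complete x y Mx Ny
    ... | inj₂ Ny rewrite Ny = refl

  cross-nonadj≡0⇒complete : ∀ M N → cross (nonadj G) M N ≡ 0 → CompleteBetween M N
  cross-nonadj≡0⇒complete M N eq x y Mx Ny = non≡0⇒adj G N x (n≤0⇒n≡0 (≤-trans
    (≤-trans (≤-reflexive (sym (trans (cong (λ b → ⟦ b ⟧ * non G N x) Mx) (*-identityˡ _)))) (term≤sum (λ x → ⟦ M x ⟧ * non G N x) x))
    (≤-reflexive eq))) y Ny

  -- S contains no join K_{τ+2} ∨ K_{σ+1}(T).
  JoinFree : Sub n → ℕ → ℕ → ℕ → Set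
  JoinFree S σ τ T = (K : Multipartite G S (suc σ) T) ((f , _) : Clique G S (suc (suc τ))) →
    ¬ (∀ i j x → Multipartite.part K j x ≡ true → adj G (f i) x ≡ true)

  clique-mono : ∀ {S S′ k} → S′ ⊑ S → Clique G S′ k → Clique G S k
  clique-mono S′⊑S (f , f∈ , f-adj) = f , (λ i → S′⊑S _ (f∈ i)) , f-adj

  JoinFree-mono : ∀ {S S′ σ τ T} → S′ ⊑ S → JoinFree S σ τ T → JoinFree S′ σ τ T
  JoinFree-mono S′⊑S free K f = free (multipartite-mono G S′⊑S K) (clique-mono S′⊑S f)

  no-clique-opposite : ∀ {S M N σ τ T} → M ⊑ S → N ⊑ S → JoinFree S σ τ T → (K : Multipartite G M (suc σ) T) →
    (∀ j x y → Multipartite.part K j x ≡ true → N y ≡ true → adj G x y ≡ true) → ¬ Clique G N (suc (suc τ))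
  no-clique-opposite M⊑S N⊑S free K complete f = free (multipartite-mono G M⊑S K) (clique-mono N⊑S f)
    (λ i j x h → adj-flip G (complete j x _ h (proj₁ (proj₂ f) i)))

  module _ {S M N : Sub n} {σ τ T : ℕ} (split : Partition S M N) (free : JoinFree S σ τ T)
    (D-M≤ : D G M ≤ 2 * ex σ (# M)) (D-M≡ : D G M ≡ 2 * ex σ (# M) → CompleteBalanced G σ M)
    (complete : CompleteBetween M N) (K : Multipartite G M (suc σ) T) where

    private
      D-N : TuránBound G τ N
      D-N = turán G τ (# N) N refl (no-clique-opposite (partition-⊑ˡ split) (partition-⊑ʳ split) free K
        (λ j x y h Ny → complete x y (Multipartite.inside K j x h) Ny))
      D-S : D G S ≡ D G M + D G N + 2 * (# M * # N)
      D-S = trans (D-partition {S} {M} {N} split) (cong (λ x → D G M + D G N + 2 * x) (complete⇒cross M N complete))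
      lemma : ∀ mν a b → 2 * a + 2 * b + 2 * mν ≡ 2 * (mν + a + b)
      lemma = solve-∀

    D-S≤bound : D G S ≤ 2 * bound σ τ (# M) (# N)
    D-S≤bound = ≤-trans (≤-reflexive D-S) (≤-trans (+-monoˡ-≤ _ (+-mono-≤ D-M≤ (proj₁ D-N)))
      (≤-reflexive (lemma (# M * # N) (ex σ (# M)) (ex τ (# N)))))

    -- The term for the pairs between the sets is fixed, so equality in the sum forces equality in
    -- each of the two remaining bounds.
    D-S≡bound : D G S ≡ 2 * bound σ τ (# M) (# N) → CompleteBalanced G σ M × CompleteBalanced G τ N
    D-S≡bound eq = D-M≡ (≤-antisym D-M≤ (+-cancelʳ-≤ (D G N) _ _ (≤-trans (+-monoʳ-≤ _ (proj₁ D-N)) tight))) ,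
                   proj₂ D-N (≤-antisym (proj₁ D-N) (+-cancelˡ-≤ (D G M) _ _ (≤-trans (+-monoˡ-≤ _ D-M≤) tight)))
      where
      tight : 2 * ex σ (# M) + 2 * ex τ (# N) ≤ D G M + D G N
      tight = +-cancelʳ-≤ (2 * (# M * # N)) _ _ (≤-reflexive (trans (lemma (# M * # N) (ex σ (# M)) (ex τ (# N))) (trans (sym eq) D-S)))

  -- If N is bounded, then M is extremal up to a bounded number of edges, and all but
  -- boundedly many pairs between M and N are adjacent.
  module _ {S M N : Sub n} {σ τ T B : ℕ} (split : Partition S M N) (free : JoinFree S σ τ T)
    (D-M≤ : D G M ≤ 2 * ex σ (# M)) (#N≤B : # N ≤ B)
    (extremal : 2 * ex σ (# M) ≤ D G M + 2 * (B * B) → Multipartite G M (suc σ) (T + B * B))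
    (D-S≥ : 2 * bound σ τ (# M) (# N) ≤ D G S) where

    private
      missing = cross (nonadj G) M N
      ν² = # N * # N
      ν²≤B² : ν² ≤ B * B
      ν²≤B² = *-mono-≤ #N≤B #N≤B
      -- Adjacent and non-adjacent pairs between `M` and `N` add up to `# M * # N`. Hence every
      -- missing pair has to be paid for by edges inside `M` or inside `N`.
      missing+ : 2 * ex σ (# M) + 2 * ex τ (# N) + 2 * missing ≤ D G M + D G N
      missing+ = certify 0 (+-mono-≤ (≤-trans D-S≥ (≤-reflexive (D-partition {S} {M} {N} split))) (≤-reflexive (cong (2 *_) (cross-complement M N))))
        (lemma (ex σ (# M)) (ex τ (# N)) missing (D G M) (D G N) (cross (adj G) M N) (# M * # N))
        where
        lemma : ∀ a b x d d′ c p → 2 * a + 2 * b + 2 * x + (d + d′ + 2 * c + 2 * p) + 0 ≡ d + d′ + (2 * (p + a + b) + 2 * (c + x))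
        lemma = solve-∀
      nearly : 2 * ex σ (# M) ≤ D G M + 2 * (B * B)
      nearly = certify (2 * ex τ (# N) + 2 * missing + B * B) (+-mono-≤ missing+ (+-mono-≤ (D≤#² G N) ν²≤B²))
        (lemma (ex σ (# M)) (ex τ (# N)) missing (D G M) (D G N) ν² (B * B))
        where
        lemma : ∀ a b x d d′ v B → 2 * a + (d + d′ + (v + B)) + (2 * b + 2 * x + B) ≡ d + 2 * B + (2 * a + 2 * b + 2 * x + (d′ + v))
        lemma = solve-∀
      missing≤ : missing ≤ B * B
      missing≤ = *-cancelˡ-≤ 2 (certify (2 * ex τ (# N) + B * B) (+-mono-≤ missing+ (+-mono-≤ D-M≤ (+-mono-≤ (D≤#² G N) ν²≤B²)))
        (lemma (ex σ (# M)) (ex τ (# N)) missing (D G M) (D G N) ν² (B * B)))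
        where
        lemma : ∀ a b x d d′ v B → 2 * x + (d + d′ + (2 * a + (v + B))) + (2 * b + B) ≡ 2 * B + (2 * a + 2 * b + 2 * x + (d + (d′ + v)))
        lemma = solve-∀
      ok : Sub n
      ok x = does (non G N x ≟ 0)
      few-bad : # (M ∖ ok) ≤ B * B
      few-bad = ≤-trans (≤-trans (≤-reflexive (sym (*-identityʳ _)))
          (≤-trans (sum-over-≥ (M ∖ ok) (λ x h → n≢0⇒n>0 (¬does⇒ (non G N x ≟ 0) (not-true (∧-elimʳ {M x} h)))))
            (sum-mono (λ x → *-monoˡ-≤ (non G N x) (⟦⟧-mono (∧-elimˡ {M x}))))))
        missing≤
      K₀ = extremal nearly
      open Multipartite K₀

    -- At most `B * B` vertices of `M` have a non-neighbour in `N`; the parts were chosen larger by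
    -- just this number, so that they can be discarded.
    complete-part : Multipartite G M (suc σ) T
    complete-part = record
      { part   = λ j → part j ∩ ok
      ; inside = λ j x h → inside j x (∧-elimˡ {part j x} h)
      ; large  = λ j → +-cancelʳ-≤ (B * B) _ _ (≤-trans (large j) (≤-trans (≤-reflexive (#-complement (part j) ok))
          (+-monoʳ-≤ _ (≤-trans (#-mono {A = part j ∖ ok} {M ∖ ok} (λ x h → ∧-intro (inside j x (∧-elimˡ {part j x} h)) (∧-elimʳ {part j x} h))) few-bad))))
      ; joined = λ i≢k h h′ → joined i≢k (∧-elimˡ {part _ _} h) (∧-elimˡ {part _ _} h′)
      }

    -- A second use of `missing+`. With `complete-part` at hand, Turán's theorem in `N` replaces the
    -- crude bound `ν²`, and nothing is left to pay for a missing pair.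
    complete-between : CompleteBetween M N
    complete-between = cross-nonadj≡0⇒complete M N (n≤0⇒n≡0 (*-cancelˡ-≤ 2 (certify 0
        (+-mono-≤ missing+ (+-mono-≤ D-M≤ (proj₁ D-N))) (lemma (ex σ (# M)) (ex τ (# N)) missing (D G M) (D G N)))))
      where
      D-N : TuránBound G τ N
      D-N = turán G τ (# N) N refl (no-clique-opposite (partition-⊑ˡ split) (partition-⊑ʳ split) free complete-part
        (λ j x y h Ny → non≡0⇒adj G N x (does⇒ (non G N x ≟ 0) (∧-elimʳ {part j x} h)) y Ny))
      lemma : ∀ a b x d d′ → 2 * x + (d + d′ + (2 * a + 2 * b)) + 0 ≡ 2 * 0 + (2 * a + 2 * b + 2 * x + (d + d′))
      lemma = solve-∀

-- The descent on M

module PartSizes {ρ κ j : ℕ} (p : Fin (suc ρ) → ℕ) (κ≤p : ∀ i → κ ≤ p i) (p≤κ+1 : ∀ i → p i ≤ suc κ)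
  (Σp : sum p ≡ j + κ * suc ρ) where

  big : Sub (suc ρ)
  big i = does (p i ≟ suc κ)

  p≡ : ∀ i → p i ≡ κ + ⟦ big i ⟧
  p≡ i = aux (p i ≟ suc κ)
    where
    aux : Dec (p i ≡ suc κ) → p i ≡ κ + ⟦ big i ⟧
    aux (yes eq) = trans eq (trans (+-comm 1 κ) (cong (λ b → κ + ⟦ b ⟧) (sym (dec-true (p i ≟ suc κ) eq))))
    aux (no ne)  = trans (≤-antisym (s≤s⁻¹ (≤∧≢⇒< (p≤κ+1 i) ne)) (κ≤p i))
      (trans (sym (+-identityʳ κ)) (cong (λ b → κ + ⟦ b ⟧) (sym (dec-false (p i ≟ suc κ) ne))))

  sum-over-p : ∀ I → sum-over I p ≡ # I * κ + # (I ∩ big)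
  sum-over-p I = begin
    sum (λ i → ⟦ I i ⟧ * p i)  ≡⟨ sum-cong (λ i → trans (cong (⟦ I i ⟧ *_) (p≡ i)) (*-distribˡ-+ ⟦ I i ⟧ κ ⟦ big i ⟧)) ⟩
    sum (λ i → ⟦ I i ⟧ * κ + ⟦ I i ⟧ * ⟦ big i ⟧)  ≡⟨ sum-+ _ _ ⟩
    sum-over I (λ _ → κ) + sum (λ i → ⟦ I i ⟧ * ⟦ big i ⟧)  ≡⟨ cong₂ _+_ (sum-over-const I κ) (sum-cong (λ i → lemma (I i) (big i))) ⟩
    # I * κ + # (I ∩ big)  ∎
    where
    open ≡-Reasoning
    lemma : ∀ a b → ⟦ a ⟧ * ⟦ b ⟧ ≡ ⟦ a ∧ b ⟧
    lemma true  b = *-identityˡ ⟦ b ⟧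
    lemma false b = refl

  #big : # big ≡ j
  #big = +-cancelˡ-≡ (suc ρ * κ) _ _ (begin
    suc ρ * κ + # big  ≡⟨ cong (λ r → r * κ + # big) (sym (#-full (suc ρ))) ⟩
    # (full {suc ρ}) * κ + # big  ≡⟨ sym (sum-over-p full) ⟩
    sum-over full p  ≡⟨ sum-over-full p ⟩
    sum p  ≡⟨ Σp ⟩
    j + κ * suc ρ  ≡⟨ trans (+-comm j _) (cong (_+ j) (*-comm κ (suc ρ))) ⟩
    suc ρ * κ + j  ∎)
    where open ≡-Reasoning

module BalancedSizes {ρ q : ℕ} (p : Fin (suc ρ) → ℕ) (Σp : sum p ≡ q) (bal : Balanced full p) where

  private
    κ = q / suc ρ

  κ≤p : ∀ i → κ ≤ p i
  κ≤p i = balanced-≥ full bal κ (begin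
    # (full {suc ρ}) * κ      ≡⟨ cong (_* κ) (#-full (suc ρ)) ⟩
    suc ρ * κ  ≡⟨ *-comm (suc ρ) κ ⟩
    κ * suc ρ  ≤⟨ m/n*n≤m q (suc ρ) ⟩
    q                         ≡⟨ sym (trans (sum-over-full p) Σp) ⟩
    sum-over full p  ∎) i refl
    where open ≤-Reasoning

  p≤κ+1 : ∀ i → p i ≤ suc κ
  p≤κ+1 i = balanced-≤ full bal (suc κ) (begin
    sum-over full p  ≡⟨ trans (sum-over-full p) Σp ⟩
    q                            ≡⟨ m≡m%n+[m/n]*n q (suc ρ) ⟩
    q % suc ρ + κ * suc ρ  ≤⟨ +-monoˡ-≤ (κ * suc ρ) (<⇒≤ (m%n<n q (suc ρ))) ⟩
    suc κ * suc ρ  ≡⟨ *-comm (suc κ) (suc ρ) ⟩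
    suc ρ * suc κ  ≡⟨ cong (_* suc κ) (sym (#-full (suc ρ))) ⟩
    # (full {suc ρ}) * suc κ     ∎) i refl
    where open ≤-Reasoning

  open PartSizes p κ≤p p≤κ+1 (trans Σp (m≡m%n+[m/n]*n q (suc ρ))) public

module _ (G : Graph n) where

  -- If M has the total size of the s = σ + 1 largest parts of a Turán graph and
  -- contains no K_s(T) with an additional edge, it is the union of s parts.
  module _ {S M : Sub n} {σ ρ T : ℕ} (M⊑S : M ⊑ S) (1≤T : 1 ≤ T) (plus-free : ¬ PlusEdge G M σ T)
    (#M : # M ≡ largest σ ρ (# S)) (κ-large : σ + suc ρ * T < # S / suc ρ) (turán-graph : CompleteBalanced G ρ S) where

    private
      κ = # S / suc ρ
      π = proj₁ turán-graph
      p Q : Fin (suc ρ) → ℕ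
      p i = # (S ∩ cls π i)
      Q i = # (M ∩ cls π i)
      open BalancedSizes p (sum-cls S π) (proj₂ (proj₂ turán-graph))
      Q≤p : ∀ i → Q i ≤ p i
      Q≤p i = #-mono {A = M ∩ cls π i} {S ∩ cls π i} (λ x h → ∧-intro (M⊑S x (∧-elimˡ {M x} h)) (∧-elimʳ {M x} h))

      large-parts : Sub (suc ρ)
      large-parts i = does (T ≤? Q i)
      -- With at most `σ` large intersections, `M` would have at most `σ(κ+1) + (ρ+1)T` vertices,
      -- but it has at least `(σ+1)κ`. This is the origin of the lower bound on `κ`.
      #large : suc σ ≤ # large-parts
      #large with suc σ ≤? # large-parts
      ... | yes le = le
      ... | no ¬le = contradiction κ-large (≤⇒≯ (certify (suc σ ⊓ (# S % suc ρ))
          (+-mono-≤ (≤-trans (≤-reflexive (sym #M)) upper) (*-monoˡ-≤ (suc κ) (s≤s⁻¹ (≰⇒> ¬le))))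
          (lemma σ κ (suc ρ * T) (# large-parts) (suc σ ⊓ (# S % suc ρ)))))
        where
        upper : # M ≤ # large-parts * suc κ + suc ρ * T
        upper = begin
          # M  ≡⟨ sym (sum-cls M π) ⟩
          sum Q  ≤⟨ sum-mono pointwise ⟩
          sum (λ i → ⟦ large-parts i ⟧ * suc κ + T)  ≡⟨ sum-+ (λ i → ⟦ large-parts i ⟧ * suc κ) (λ _ → T) ⟩
          sum (λ i → ⟦ large-parts i ⟧ * suc κ) + sum {suc ρ} (λ _ → T)  ≡⟨ cong₂ _+_ (sum-over-const large-parts (suc κ)) (sum-const (suc ρ) T) ⟩
          # large-parts * suc κ + suc ρ * T  ∎
          where
          open ≤-Reasoning
          pointwise : ∀ i → Q i ≤ ⟦ large-parts i ⟧ * suc κ + T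
          pointwise i = aux (T ≤? Q i)
            where
            aux : (d : Dec (T ≤ Q i)) → Q i ≤ ⟦ does d ⟧ * suc κ + T
            aux (yes _)  = ≤-trans (Q≤p i) (≤-trans (p≤κ+1 i) (≤-trans (≤-reflexive (sym (*-identityˡ (suc κ)))) (m≤m+n _ T)))
            aux (no ¬le) = <⇒≤ (≰⇒> ¬le)
        lemma : ∀ σ κ t l x → κ + (l * suc κ + t + σ * suc κ) + x ≡ σ + t + (suc σ * κ + x + l * suc κ)
        lemma = solve-∀

      chosen : ∃[ I ] I ⊑ large-parts × # I ≡ suc σ
      chosen = shrink (suc σ) large-parts #large
      I = proj₁ chosen
      #I = proj₂ (proj₂ chosen)
      named : Σ (Fin (suc σ) → Fin (suc ρ)) λ ι → (∀ a → I (ι a) ≡ true) × (∀ {a b} → ι a ≡ ι b → a ≡ b)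
      named = enumerate (suc σ) I (≤-reflexive (sym #I))
      ι = proj₁ named

      ∈part : ∀ {x i} → (M ∩ cls π i) x ≡ true → π x ≡ i
      ∈part {x} {i} h = does⇒ (π x Fin.≟ i) (∧-elimʳ {M x} h)

      different-parts : ∀ {x y} → S x ≡ true → S y ≡ true → π x ≢ π y → adj G x y ≡ true
      different-parts {x} {y} Sx Sy ne = trans (proj₁ (proj₂ turán-graph) x y Sx Sy) (cong not (dec-false (π x Fin.≟ π y) ne))

    large-multipartite : Multipartite G M (suc σ) T
    large-multipartite = record
      { part   = λ a → M ∩ cls π (ι a)
      ; inside = λ a x h → ∧-elimˡ h
      ; large  = λ a → does⇒ (T ≤? Q (ι a)) (proj₁ (proj₂ chosen) (ι a) (proj₁ (proj₂ named) a))
      ; joined = λ {a} {b} a≢b {x} {y} h h′ → different-parts (M⊑S x (∧-elimˡ h)) (M⊑S y (∧-elimˡ h′))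
          (λ eq → a≢b (proj₂ (proj₂ named) (trans (sym (∈part {x} h)) (trans eq (∈part {y} h′)))))
      }

    private
      -- A vertex of `M` outside the chosen parts is joined to all of them; its edge to a vertex `y`
      -- of the first chosen part would be the additional edge.
      M-in-chosen : ∀ x → M x ≡ true → I (π x) ≡ true
      M-in-chosen x Mx = aux (true∨false (I (π x)))
        where
        open Multipartite large-multipartite
        joined-to-x : ∀ a {z} → part a z ≡ true → I (π x) ≡ false → adj G x z ≡ true
        joined-to-x a {z} h ¬Ix = different-parts (M⊑S x Mx) (M⊑S z (∧-elimˡ h))
          (λ eq → true≢false (proj₁ (proj₂ named) a) (trans (cong I (sym (trans eq (∈part {z} h)))) ¬Ix))
        aux : I (π x) ≡ true ⊎ I (π x) ≡ false → I (π x) ≡ true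
        aux (inj₁ Ix)  = Ix
        aux (inj₂ ¬Ix) = ⊥-elim (plus-free record
            { multipartite = large-multipartite ; i = zero ; x = x ; y = y ; x∈S = Mx ; y∈S = inside zero y y∈
            ; x~y = joined-to-x zero y∈ ¬Ix
            ; x-joined = λ {a} _ h → joined-to-x a h ¬Ix
            ; y-joined = λ {a} a≢0 h → joined (a≢0 ∘ sym) y∈ h })
          where
          y = proj₁ (#-inhabited (part zero) (≤-trans 1≤T (large zero)))
          y∈ = proj₂ (#-inhabited (part zero) (≤-trans 1≤T (large zero)))

      -- At most `min(σ+1, j)` of the chosen parts have size `κ + 1`, with `j` the remainder, so
      -- together they have at most `largest σ ρ (# S)` vertices, which is the size of `M`.
      chosen-in-M : S ∩ (I ∘ π) ⊑ M
      chosen-in-M = #-≥⇒⊒ {A = M} {S ∩ (I ∘ π)} (λ x Mx → ∧-intro (M⊑S x Mx) (M-in-chosen x Mx)) (begin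
        # (S ∩ (I ∘ π))  ≡⟨ sym (sum-over-cls S π I) ⟩
        sum-over I p  ≡⟨ sum-over-p I ⟩
        # I * κ + # (I ∩ big)  ≤⟨ +-mono-≤ (≤-reflexive (cong (_* κ) #I))
                                                   (⊓-glb (≤-trans (#-mono {A = I ∩ big} {I} (∩⊑ˡ I big)) (≤-reflexive #I))
                                                     (≤-trans (#-mono {A = I ∩ big} {big} (λ i → ∧-elimʳ {I i})) (≤-reflexive #big))) ⟩
        largest σ ρ (# S)  ≡⟨ sym #M ⟩
        # M  ∎)
        where open ≤-Reasoning

    complete-outside : ∀ x y → M x ≡ true → S y ≡ true → M y ≡ false → adj G x y ≡ true
    complete-outside x y Mx Sy ¬My = different-parts (M⊑S x Mx) Sy
      (λ eq → true≢false (chosen-in-M y (∧-intro Sy (trans (cong I (sym eq)) (M-in-chosen x Mx)))) ¬My)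

module Descent (σ τ T N₁ N₂ N₃ : ℕ) (1≤T : 1 ≤ T)
  (low-degree : LowDegreeAbove N₁ σ T)
  (extremal-σ : TuránBoundAbove N₂ σ T)
  (extremal-ρ : TuránBoundAbove N₃ (σ + suc τ) T)
  where

  private
    ρ = σ + suc τ

  -- One number above the thresholds of the three theorems and above the `κ` that the identification
  -- of `M` with a union of parts requires.
  threshold : ℕ
  threshold = suc (N₁ + N₂ + N₃ + (σ + suc ρ * T))

  module _ {n} (G : Graph n) {N : Sub n} (N-large : suc ρ * threshold ≤ # N) where

    -- The multipartite subgraph is kept because it excludes cliques of size `τ + 2` in `N`, as
    -- Turán's theorem there demands.
    Rigid : Sub n → Set
    Rigid M = CompleteBetween G M N × Multipartite G M (suc σ) T

    private
      κ-large : ∀ {m q} → q ≡ m + # N → threshold ≤ q / suc ρ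
      κ-large {m} {q} q≡ = ≤-trans (≤-reflexive (sym (m*n/n≡m threshold (suc ρ))))
        (/-monoˡ-≤ (suc ρ) (≤-trans (≤-reflexive (*-comm threshold (suc ρ))) (≤-trans N-large (≤-trans (m≤n+m (# N) m) (≤-reflexive (sym q≡))))))

      largest-large : ∀ {m q} → q ≡ m + # N → threshold ≤ largest σ ρ q
      largest-large {m} {q} q≡ = ≤-trans (κ-large {m} q≡) (≤-trans (m≤m+n (q / suc ρ) (σ * (q / suc ρ))) (m≤m+n _ _))

    -- Both the lower bound on `D G S` and the relation of `m` to `largest` survive a deletion. As
    -- `N` does not change, its size keeps every graph in the recursion above the thresholds.
    descend : ∀ m {S M} → # M ≡ m → Partition G S M N → largest σ ρ (m + # N) ≤ m →
      ¬ PlusEdge G M σ T → ¬ PlusEdge G S ρ T → JoinFree G S σ τ T → 2 * bound σ τ m (# N) ≤ D G S → Rigid M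
    -- The empty set is never reached, since `largest` is at least the positive `threshold`.
    descend zero #M _ hi _ _ _ _ = contradiction (largest-large {0} refl) (<⇒≱ (s≤s (≤-trans hi z≤n)))
    descend (suc m) {S} {M} #M split hi M-free S-free J-free D≥ = by-size (m≤n⇒m<n∨m≡n hi)
      where
      #S : # S ≡ suc m + # N
      #S = trans (#-partition G {S} {M} {N} split) (cong (_+ # N) #M)
      base : suc m ≡ largest σ ρ (suc m + # N) → Rigid M
      base m≡ = (λ x y Mx Ny → outside x y Mx (partition-⊑ʳ G {S} {M} {N} split y Ny) (∉M y Ny)) , parts
        where
        D≤ = extremal-ρ G S (≤-trans (≤-trans (≤-trans (m≤n+m N₃ (N₁ + N₂)) (m≤m+n _ _)) (n≤1+n _))
               (≤-trans (largest-large {suc m} refl) (≤-trans hi (≤-trans (m≤m+n (suc m) (# N)) (≤-reflexive (sym #S)))))) S-free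
        bound-ex : bound σ τ (suc m) (# N) ≡ ex ρ (# S)
        bound-ex = trans (bound-largest σ τ (# N) (suc m) m≡) (cong (ex ρ) (sym #S))
        ∉M : ∀ y → N y ≡ true → M y ≡ false
        ∉M y Ny with true∨false (M y)
        ... | inj₂ My = My
        ... | inj₁ My = ⊥-elim (true≢false Ny (partition-∉ G {S} {M} {N} split y My))
        κ> : σ + suc ρ * T < # S / suc ρ
        κ> = ≤-trans (s≤s (m≤n+m (σ + suc ρ * T) (N₁ + N₂ + N₃))) (κ-large {suc m} #S)
        tight : D G S ≡ 2 * ex ρ (# S)
        tight = ≤-antisym (proj₁ D≤) (≤-trans (≤-reflexive (cong (2 *_) (sym bound-ex))) D≥)
        #M≡ : # M ≡ largest σ ρ (# S)
        #M≡ = trans #M (trans m≡ (cong (largest σ ρ) (sym #S)))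
        turán-graph : CompleteBalanced G ρ S
        turán-graph = proj₂ D≤ tight
        outside : ∀ x y → M x ≡ true → S y ≡ true → M y ≡ false → adj G x y ≡ true
        outside = complete-outside G (partition-⊑ˡ G {S} {M} {N} split) 1≤T M-free #M≡ κ> turán-graph
        parts : Multipartite G M (suc σ) T
        parts = large-multipartite G (partition-⊑ˡ G {S} {M} {N} split) 1≤T M-free #M≡ κ> turán-graph

      delete : largest σ ρ (suc m + # N) < suc m → ∃[ v ] M v ≡ true × ⌈ # M /1+ σ ⌉ ≤ non G M v → Rigid M
      delete lt (v , Mv , c≤) = complete , multipartite-mono G (─⊑ M v) (proj₂ IH)
        where
        S′ = S ─ v
        M′ = M ─ v
        #M′ : # M′ ≡ m
        #M′ = suc-injective (trans (sym (#-─ M Mv)) #M)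
        split′ : Partition G S′ M′ N
        split′ = partition-─ G {S} {M} {N} split Mv
        c = ⌈ # M /1+ σ ⌉
        deleted : D G S + 2 * non G S v ≡ D G S′ + 2 * (suc m + # N)
        deleted = trans (D-─ G S (partition-⊑ˡ G {S} {M} {N} split v Mv)) (cong (λ q → D G S′ + 2 * q) #S)
        step : bound σ τ (suc m) (# N) + c ≡ bound σ τ m (# N) + (suc m + # N)
        step = trans (cong (λ q → bound σ τ (suc m) (# N) + ⌈ q /1+ σ ⌉) #M)
          (trans (lemma₁ m (# N) (ex σ (suc m)) (ex τ (# N)) (suc (m / suc σ)))
            (trans (cong (λ x → m * # N + # N + ex τ (# N) + x) (ex-suc σ m)) (lemma₂ m (# N) (ex σ m) (ex τ (# N)))))
          where
          lemma₁ : ∀ m ν a b c → suc m * ν + a + b + c ≡ m * ν + ν + b + (a + c)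
          lemma₁ = solve-∀
          lemma₂ : ∀ m ν a b → m * ν + ν + b + (a + suc m) ≡ m * ν + a + b + (suc m + ν)
          lemma₂ = solve-∀
        open Deletion {D G S} {non G S v} {D G S′} {suc m + # N} {bound σ τ (suc m) (# N)} {c} {bound σ τ m (# N)} deleted step
        non-S : non G S v ≡ non G M v + non G N v
        non-S = non-partition G {S} {M} {N} split v
        M′-free : ¬ PlusEdge G M′ σ T
        M′-free = M-free ∘ plus-edge-mono G (─⊑ M v)
        J′-free : JoinFree G S′ σ τ T
        J′-free = JoinFree-mono G (─⊑ S v) J-free
        m-large : N₂ ≤ m
        m-large = s≤s⁻¹ (≤-trans (s≤s (≤-trans (≤-trans (m≤n+m N₂ N₁) (m≤m+n (N₁ + N₂) N₃)) (m≤m+n _ _))) (≤-trans (largest-large {suc m} refl) hi))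
        IH : Rigid M′
        IH = descend m #M′ split′ (≤-trans (proj₁ (largest-suc σ ρ (m + # N) (≤-trans (m≤m+n (suc σ) τ) (≤-reflexive (sym (+-suc σ τ)))))) (s≤s⁻¹ lt))
          M′-free (S-free ∘ plus-edge-mono G (─⊑ S v)) J′-free
          (2t′≤d (≤-trans c≤ (≤-trans (m≤m+n _ _) (≤-reflexive (sym non-S)))) D≥)
        D′≤ : D G S′ ≤ 2 * bound σ τ m (# N)
        D′≤ = subst (λ q → D G S′ ≤ 2 * bound σ τ q (# N)) #M′
          (D-S≤bound G {S′} {M′} {N} split′ J′-free
            (proj₁ (extremal-σ G M′ (≤-trans m-large (≤-reflexive (sym #M′))) M′-free))
            (proj₂ (extremal-σ G M′ (≤-trans m-large (≤-reflexive (sym #M′))) M′-free))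
            (proj₁ IH) (proj₂ IH))
        -- By pinching, `v` has at most `c` non-neighbours in `S`, but at least `c` of them are in
        -- `M`.
        v-complete : non G N v ≡ 0
        v-complete = n≤0⇒n≡0 (+-cancelˡ-≤ (non G M v) _ _ (≤-trans (≤-reflexive (sym non-S))
          (≤-trans (ν≤c D′≤ D≥) (≤-trans c≤ (≤-reflexive (sym (+-identityʳ _)))))))
        complete : CompleteBetween G M N
        complete x y Mx Ny = aux (v Fin.≟ x)
          where
          aux : Dec (v ≡ x) → adj G x y ≡ true
          aux (yes refl) = non≡0⇒adj G N v v-complete y Ny
          aux (no v≢x)   = proj₁ IH x y (─-∈ M Mx v≢x) Ny

      by-size : largest σ ρ (suc m + # N) < suc m ⊎ largest σ ρ (suc m + # N) ≡ suc m → Rigid M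
      by-size (inj₂ eq) = base (sym eq)
      by-size (inj₁ lt) = delete lt (low-degree G M
        (≤-trans (s≤s (≤-trans (≤-trans (m≤m+n N₁ N₂) (m≤m+n (N₁ + N₂) N₃)) (m≤m+n _ _)))
          (≤-trans (largest-large {suc m} refl) (≤-trans hi (≤-reflexive (sym #M))))) M-free)

-- The bound and its equality case

sum-↑ : ∀ a b (f : Fin (a + b) → ℕ) → sum f ≡ sum (λ i → f (i Fin.↑ˡ b)) + sum (λ j → f (a Fin.↑ʳ j))
sum-↑ zero    b f = cong (_+ sum f) (sym (sum-empty _))
sum-↑ (suc a) b f = begin
  sum f  ≡⟨ sum-suc f ⟩
  f zero + sum (f ∘ suc)  ≡⟨ cong (f zero +_) (sum-↑ a b (f ∘ suc)) ⟩
  f zero + (sum (λ i → f (suc (i Fin.↑ˡ b))) + rest)  ≡⟨ sym (+-assoc (f zero) _ rest) ⟩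
  f zero + sum (λ i → f (suc (i Fin.↑ˡ b))) + rest  ≡⟨ cong (_+ rest) (sym (sum-suc _)) ⟩
  sum (λ i → f (i Fin.↑ˡ b)) + rest  ∎
  where
  open ≡-Reasoning
  rest = sum (λ j → f (suc a Fin.↑ʳ j))

record Grouped (G : Graph n) (σ ρ m : ℕ) : Set where
  field
    π           : Fin n → Fin (suc ρ)
    complete    : ∀ x y → adj G x y ≡ not (cls π (π y) x)
    I           : Sub (suc ρ)
    #I          : # I ≡ suc σ
    total       : # (I ∘ π) ≡ m
    balanced    : Balanced I (λ i → # (cls π i))
    balanced-∁  : Balanced (not ∘ I) (λ i → # (cls π i))

-- c parts of size κ + 1 and s − c parts of size κ form the first group.
choose-group : ∀ {ρ} (big : Sub (suc ρ)) s c → c ≤ s → c ≤ # big → s + # big ≤ suc ρ + c →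
  ∃[ I ] # I ≡ s × # (I ∩ big) ≡ c
choose-group {ρ} big s c c≤s c≤big s+big≤ = I , #I≡ , #I∩big
  where
  small : Sub (suc ρ)
  small = not ∘ big
  #small : # big + # small ≡ suc ρ
  #small = trans (sym (#-complement full big)) (#-full (suc ρ))
  fits : s ∸ c ≤ # small
  fits = m≤n+o⇒m∸n≤o s c (certify 0 (+-mono-≤ s+big≤ (≤-reflexive (sym #small))) (lemma s (# big) (# small) (suc ρ) c))
    where
    lemma : ∀ s b w r c → s + (r + c + (b + w)) + 0 ≡ c + w + (s + b + r)
    lemma = solve-∀
  B₁ = shrink c big c≤big
  B₂ = shrink (s ∸ c) small fits
  A₁ = proj₁ B₁
  A₂ = proj₁ B₂
  I : Sub (suc ρ)
  I i = A₁ i ∨ A₂ i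
  pointwise : ∀ i → ⟦ I i ⟧ ≡ ⟦ A₁ i ⟧ + ⟦ A₂ i ⟧
  pointwise i = lemma (A₁ i) (A₂ i) (λ a b → true≢false (proj₁ (proj₂ B₁) i a) (not-true (proj₁ (proj₂ B₂) i b)))
    where
    lemma : ∀ a b → (a ≡ true → b ≡ true → ⊥) → ⟦ a ∨ b ⟧ ≡ ⟦ a ⟧ + ⟦ b ⟧
    lemma true  true  h = ⊥-elim (h refl refl)
    lemma true  false h = refl
    lemma false b     h = refl
  #I≡ : # I ≡ s
  #I≡ = trans (sum-cong pointwise) (trans (sum-+ _ _) (trans (cong₂ _+_ (proj₂ (proj₂ B₁)) (proj₂ (proj₂ B₂))) (m+[n∸m]≡n c≤s)))
  #I∩big : # (I ∩ big) ≡ c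
  #I∩big = trans (sum-cong (λ i → cong ⟦_⟧ (restrict i))) (proj₂ (proj₂ B₁))
    where
    restrict : ∀ i → I i ∧ big i ≡ A₁ i
    restrict i = lemma (A₁ i) (A₂ i) (big i) (proj₁ (proj₂ B₁) i) (not-true ∘ proj₁ (proj₂ B₂) i)
      where
      lemma : ∀ a b c → (a ≡ true → c ≡ true) → (b ≡ true → c ≡ false) → (a ∨ b) ∧ c ≡ a
      lemma true  b     c h _ = h refl
      lemma false true  c _ h = h refl
      lemma false false c _ _ = refl

-- The range of m in which the bound equals the Turán number of the whole graph.
module TuránRange (σ τ m ν : ℕ) (m-large : suc σ * (m + ν) ≤ suc (σ + suc τ) * m)
  (m-small : m ≤ largest σ (σ + suc τ) (m + ν)) where

  private
    s t r κ j : ℕ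
    s = suc σ
    t = suc τ
    r = suc (σ + suc τ)
    κ = (m + ν) / r
    j = (m + ν) % r
    n≡ : m + ν ≡ j + κ * r
    n≡ = m≡m%n+[m/n]*n (m + ν) r
    sκ≤m : s * κ ≤ m
    sκ≤m = *-cancelˡ-≤ r (≤-trans (certify (s * j) (*-monoʳ-≤ s (≤-reflexive (sym n≡))) (lemma s r κ j (m + ν))) m-large)
      where
      lemma : ∀ s r κ j n → r * (s * κ) + s * n + s * j ≡ s * n + s * (j + κ * r)
      lemma = solve-∀
    m≤ : m ≤ s * suc κ
    m≤ = ≤-trans m-small (≤-trans (+-monoʳ-≤ (s * κ) (m⊓n≤m s j)) (≤-reflexive (lemma s κ)))
      where
      lemma : ∀ s κ → s * κ + s ≡ s * suc κ
      lemma = solve-∀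
    tκ≤ν : t * κ ≤ ν
    tκ≤ν = certify 0 (+-mono-≤ (≤-trans m-small (+-monoʳ-≤ (s * κ) (m⊓n≤n s j))) (≤-reflexive (sym n≡))) (lemma s t κ j m ν)
      where
      lemma : ∀ s t κ j m ν → t * κ + (s * κ + j + (m + ν)) + 0 ≡ ν + (m + (j + κ * (s + t)))
      lemma = solve-∀
    ν≤ : ν ≤ t * suc κ
    ν≤ = *-cancelˡ-≤ r (certify 0 (+-mono-≤ m-large (*-monoʳ-≤ t n≤)) (lemma s t κ m ν))
      where
      n≤ : m + ν ≤ suc κ * r
      n≤ = ≤-trans (≤-reflexive n≡) (+-monoˡ-≤ (κ * r) (<⇒≤ (m%n<n (m + ν) r)))
      lemma : ∀ s t κ m ν → (s + t) * ν + ((s + t) * m + t * (suc κ * (s + t))) + 0 ≡ (s + t) * (t * suc κ) + (s * (m + ν) + t * (m + ν))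
      lemma = solve-∀

  range-bound : bound σ τ m ν ≡ ex (σ + suc τ) (m + ν)
  range-bound = bound≡ex σ τ m ν κ sκ≤m m≤ tκ≤ν ν≤

  private
    -- The number of parts of size `κ + 1` in the group of total size `m`.
    c : ℕ
    c = m ∸ s * κ
    m≡ : m ≡ s * κ + c
    m≡ = sym (m+[n∸m]≡n sκ≤m)
    c≤s⊓j : c ≤ s ⊓ j
    c≤s⊓j = m≤n+o⇒m∸n≤o m (s * κ) m-small
    -- The group also needs `s − c` parts of size `κ`, of which there are `r − j`. After
    -- multiplication by `r`, the inequality `sj ≤ rc` reduces the claim to `(r−s)(r−j) ≥ 0`; this
    -- product is the slack `t * w`.
    s+j≤r+c : s + j ≤ r + c
    s+j≤r+c = lemma s t j (r ∸ j) c (sym (m+[n∸m]≡n (<⇒≤ (m%n<n (m + ν) r)))) sj≤rc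
      where
      sj≤rc : s * j ≤ r * c
      sj≤rc = certify 0 (+-mono-≤ m-large (+-mono-≤ (*-monoʳ-≤ r (≤-reflexive m≡)) (*-monoʳ-≤ s (≤-reflexive (sym n≡)))))
          (lemma′ s r κ j c m (m + ν))
        where
        lemma′ : ∀ s r κ j c m n → s * j + (r * m + (r * (s * κ + c) + s * n)) + 0 ≡ r * c + (s * n + (r * m + s * (j + κ * r)))
        lemma′ = solve-∀
      lemma : ∀ s t .{{_ : NonZero (s + t)}} j w c → s + t ≡ j + w → s * j ≤ (s + t) * c → s + j ≤ s + t + c
      lemma s t j w c eq sj≤rc = *-cancelˡ-≤ (s + t) (certify {X = (s + t) * (s + j)} {(s + t) * (s + t + c)} (t * w)
          (+-mono-≤ sj≤rc (+-mono-≤ (*-monoʳ-≤ (s + t) (≤-reflexive (sym eq))) (*-monoʳ-≤ s (≤-reflexive eq))))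
          (identity s t j w c))
        where
        identity : ∀ s t j w c → (s + t) * (s + j) + ((s + t) * c + ((s + t) * (s + t) + s * (j + w))) + t * w ≡
          (s + t) * (s + t + c) + (s * j + ((s + t) * (j + w) + s * (s + t)))
        identity = solve-∀

  group : ∀ {n} (G : Graph n) → n ≡ m + ν → CompleteBalanced G (σ + suc τ) full → Grouped G σ (σ + suc τ) m
  group {n} G n≡m+ν (π , complete , bal) = record
    { π = π ; complete = λ x y → complete x y refl refl ; I = I ; #I = proj₁ (proj₂ chosen)
    ; total = trans (sym (sum-over-cls full π I)) (trans (sum-over-p I)
        (trans (cong₂ (λ a b → a * (n / suc (σ + suc τ)) + b) (proj₁ (proj₂ chosen)) (proj₂ (proj₂ chosen)))
          (trans (cong (λ q → s * (q / suc (σ + suc τ)) + c) n≡m+ν) (sym m≡))))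
    ; balanced   = λ i j _ _ → bal i j refl refl
    ; balanced-∁ = λ i j _ _ → bal i j refl refl
    }
    where
    open BalancedSizes (λ i → # (full ∩ cls π i)) (trans (sum-cls full π) (#-full n)) bal
    #big≡j : # big ≡ j
    #big≡j = trans #big (cong (_% suc (σ + suc τ)) n≡m+ν)
    chosen : ∃[ I ] # I ≡ s × # (I ∩ big) ≡ c
    chosen = choose-group big s c (≤-trans c≤s⊓j (m⊓n≤m s j)) (≤-trans (≤-trans c≤s⊓j (m⊓n≤n s j)) (≤-reflexive (sym #big≡j)))
      (≤-trans (≤-reflexive (cong (s +_) #big≡j)) s+j≤r+c)
    I = proj₁ chosen

module _ (G : Graph n) {σ τ m : ℕ} (M : Sub n) (#M : # M ≡ m) (complete-between : CompleteBetween G M (not ∘ M))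
  (M-balanced : CompleteBalanced G σ M) (N-balanced : CompleteBalanced G τ (not ∘ M)) where

  private
    s = suc σ
    t = suc τ
    πᴹ = proj₁ M-balanced
    πᴺ = proj₁ N-balanced
    π : Fin n → Fin (s + t)
    π x = if M x then πᴹ x Fin.↑ˡ t else s Fin.↑ʳ πᴺ x
    I : Sub (s + t)
    I i = [ (λ _ → true) , (λ _ → false) ]′ (Fin.splitAt s i)
    I-ˡ : ∀ a → I (a Fin.↑ˡ t) ≡ true
    I-ˡ a = cong [ (λ _ → true) , (λ _ → false) ]′ (Fin.splitAt-↑ˡ s a t)
    I-ʳ : ∀ b → I (s Fin.↑ʳ b) ≡ false
    I-ʳ b = cong [ (λ _ → true) , (λ _ → false) ]′ (Fin.splitAt-↑ʳ s t b)
    π-M : ∀ x → M x ≡ true → π x ≡ πᴹ x Fin.↑ˡ t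
    π-M x Mx = cong (λ b → if b then πᴹ x Fin.↑ˡ t else s Fin.↑ʳ πᴺ x) Mx
    π-N : ∀ x → M x ≡ false → π x ≡ s Fin.↑ʳ πᴺ x
    π-N x Mx = cong (λ b → if b then πᴹ x Fin.↑ˡ t else s Fin.↑ʳ πᴺ x) Mx
    I-π : ∀ x → I (π x) ≡ M x
    I-π x with true∨false (M x)
    ... | inj₁ Mx = trans (cong I (π-M x Mx)) (trans (I-ˡ (πᴹ x)) (sym Mx))
    ... | inj₂ Mx = trans (cong I (π-N x Mx)) (trans (I-ʳ (πᴺ x)) (sym Mx))
    ↑ˡ≢↑ʳ : ∀ a b → a Fin.↑ˡ t ≢ s Fin.↑ʳ b
    ↑ˡ≢↑ʳ a b eq = true≢false (trans (cong I (sym eq)) (I-ˡ a)) (I-ʳ b)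
    class-ˡ : ∀ a x → (M ∩ cls πᴹ a) x ≡ cls π (a Fin.↑ˡ t) x
    class-ˡ a x with true∨false (M x)
    ... | inj₁ Mx = trans (cong (_∧ cls πᴹ a x) Mx) (trans (does-⇔ (πᴹ x Fin.≟ a) (πᴹ x Fin.↑ˡ t Fin.≟ a Fin.↑ˡ t) (cong (Fin._↑ˡ t)) (Fin.↑ˡ-injective t _ _))
            (cong (λ j → does (j Fin.≟ a Fin.↑ˡ t)) (sym (π-M x Mx))))
    ... | inj₂ Mx = trans (cong (_∧ cls πᴹ a x) Mx) (sym (dec-false (π x Fin.≟ a Fin.↑ˡ t) (λ eq → ↑ˡ≢↑ʳ a (πᴺ x) (sym (trans (sym (π-N x Mx)) eq)))))
    class-ʳ : ∀ b x → ((not ∘ M) ∩ cls πᴺ b) x ≡ cls π (s Fin.↑ʳ b) x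
    class-ʳ b x with true∨false (M x)
    ... | inj₂ Mx = trans (cong (λ c → not c ∧ cls πᴺ b x) Mx) (trans (does-⇔ (πᴺ x Fin.≟ b) (s Fin.↑ʳ πᴺ x Fin.≟ s Fin.↑ʳ b) (cong (s Fin.↑ʳ_)) (Fin.↑ʳ-injective s _ _))
            (cong (λ j → does (j Fin.≟ s Fin.↑ʳ b)) (sym (π-N x Mx))))
    ... | inj₁ Mx = trans (cong (λ c → not c ∧ cls πᴺ b x) Mx) (sym (dec-false (π x Fin.≟ s Fin.↑ʳ b) (λ eq → ↑ˡ≢↑ʳ (πᴹ x) b (trans (sym (π-M x Mx)) eq))))
    size-ˡ : ∀ a → # (M ∩ cls πᴹ a) ≡ # (cls π (a Fin.↑ˡ t))
    size-ˡ a = sum-cong (λ x → cong ⟦_⟧ (class-ˡ a x))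
    size-ʳ : ∀ b → # ((not ∘ M) ∩ cls πᴺ b) ≡ # (cls π (s Fin.↑ʳ b))
    size-ʳ b = sum-cong (λ x → cong ⟦_⟧ (class-ʳ b x))
    Side : Fin (s + t) → Set
    Side i = Σ (Fin s) (λ a → i ≡ a Fin.↑ˡ t) ⊎ Σ (Fin t) (λ b → i ≡ s Fin.↑ʳ b)
    side : ∀ i → Side i
    side i = aux (Fin.splitAt s i) (Fin.join-splitAt s t i)
      where
      aux : ∀ z → Fin.join s t z ≡ i → Side i
      aux (inj₁ a) eq = inj₁ (a , sym eq)
      aux (inj₂ b) eq = inj₂ (b , sym eq)

    complete-inside : ∀ x y → M x ≡ true ⊎ M x ≡ false → M y ≡ true ⊎ M y ≡ false → adj G x y ≡ not (cls π (π y) x)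
    complete-inside x y (inj₁ Mx) (inj₁ My) = trans (proj₁ (proj₂ M-balanced) x y Mx My) (cong not
      (trans (sym (cong (_∧ cls πᴹ (πᴹ y) x) Mx)) (trans (class-ˡ (πᴹ y) x) (cong (λ j → cls π j x) (sym (π-M y My))))))
    complete-inside x y (inj₁ Mx) (inj₂ My) = trans (complete-between x y Mx (cong not My)) (cong not
      (sym (dec-false (π x Fin.≟ π y) (λ eq → ↑ˡ≢↑ʳ (πᴹ x) (πᴺ y) (trans (sym (π-M x Mx)) (trans eq (π-N y My)))))))
    complete-inside x y (inj₂ Mx) (inj₁ My) = trans (adj-sym G x y) (trans (complete-between y x My (cong not Mx)) (cong not
      (sym (dec-false (π x Fin.≟ π y) (λ eq → ↑ˡ≢↑ʳ (πᴹ y) (πᴺ x) (trans (sym (π-M y My)) (trans (sym eq) (π-N x Mx))))))))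
    complete-inside x y (inj₂ Mx) (inj₂ My) = trans (proj₁ (proj₂ N-balanced) x y (cong not Mx) (cong not My)) (cong not
      (trans (sym (cong (λ c → not c ∧ cls πᴺ (πᴺ y) x) Mx)) (trans (class-ʳ (πᴺ y) x) (cong (λ j → cls π j x) (sym (π-N y My))))))

    bal : Balanced I (λ i → # (cls π i))
    bal i j Ii Ij = aux (side i) (side j)
      where
      aux : Side i → Side j → # (cls π i) ≤ suc (# (cls π j))
      aux (inj₁ (a , refl)) (inj₁ (b , refl)) = subst₂ (λ x y → x ≤ suc y) (size-ˡ a) (size-ˡ b) (proj₂ (proj₂ M-balanced) a b refl refl)
      aux (inj₂ (b , refl)) _ = ⊥-elim (true≢false Ii (I-ʳ b))
      aux (inj₁ _) (inj₂ (b , refl)) = ⊥-elim (true≢false Ij (I-ʳ b))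

    bal-∁ : Balanced (not ∘ I) (λ i → # (cls π i))
    bal-∁ i j Ii Ij = aux (side i) (side j)
      where
      aux : Side i → Side j → # (cls π i) ≤ suc (# (cls π j))
      aux (inj₂ (a , refl)) (inj₂ (b , refl)) = subst₂ (λ x y → x ≤ suc y) (size-ʳ a) (size-ʳ b) (proj₂ (proj₂ N-balanced) a b refl refl)
      aux (inj₁ (a , refl)) _ = ⊥-elim (true≢false (I-ˡ a) (not-true Ii))
      aux (inj₂ _) (inj₁ (a , refl)) = ⊥-elim (true≢false (I-ˡ a) (not-true Ij))

  combine-groups : Grouped G σ (σ + suc τ) m
  combine-groups = record
    { π = π
    ; complete = λ x y → complete-inside x y (true∨false (M x)) (true∨false (M y))
    ; I = I
    ; #I = trans (sum-↑ s t (λ i → ⟦ I i ⟧)) (trans (cong₂ _+_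
        (trans (sum-cong (λ a → cong ⟦_⟧ (I-ˡ a))) (#-full s))
        (trans (sum-cong (λ b → cong ⟦_⟧ (I-ʳ b))) (sum-zero t))) (+-identityʳ s))
    ; total = trans (sum-cong (λ x → cong ⟦_⟧ (I-π x))) #M
    ; balanced = bal
    ; balanced-∁ = bal-∁
    }

module Assemble (σ τ T N₁ N₂ N₃ N₄ : ℕ) (1≤T : 1 ≤ T)
  (low-degree : LowDegreeAbove N₁ σ T)
  (extremal-σ : TuránBoundAbove N₂ σ T)
  (extremal-ρ : TuránBoundAbove N₃ (σ + suc τ) T)
  where

  open Descent σ τ T N₁ N₂ N₃ 1≤T low-degree extremal-σ extremal-ρ

  private
    ρ B : ℕ
    ρ = σ + suc τ
    -- The dividing line between the descent and the case of bounded `N`.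
    B = suc ρ * threshold

  B² : ℕ
  B² = B * B

  module _ (nearly-extremal : NearlyExtremalAbove N₄ σ T B² (T + B²)) where

    bounded-with-equality : ∀ {n} (G : Graph n) (M : Sub n) → suc ρ * suc (N₂ + N₄) + N₃ ≤ n →
      suc σ * n ≤ suc ρ * # M → ¬ PlusEdge G M σ T → ¬ PlusEdge G full ρ T → JoinFree G full σ τ T →
      D G full ≤ 2 * bound σ τ (# M) (# (not ∘ M)) ×
      (D G full ≡ 2 * bound σ τ (# M) (# (not ∘ M)) → Grouped G σ ρ (# M))
    bounded-with-equality {n} G M n-large M-large M-free G-free J-free = by-range (# M ≤? largest σ ρ (# M + ν))
      where
      N : Sub n
      N = not ∘ M
      ν : ℕ
      ν = # N
      b : ℕ
      b = 2 * bound σ τ (# M) ν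
      split : Partition G full M N
      split x = aux (M x)
        where
        aux : ∀ c → 1 ≡ ⟦ c ⟧ + ⟦ not c ⟧
        aux true  = refl
        aux false = refl
      n≡ : n ≡ # M + ν
      n≡ = trans (sym (#-full n)) (#-partition G {full} {M} {N} split)
      #M-large : suc (N₂ + N₄) ≤ # M
      #M-large = *-cancelˡ-≤ (suc ρ) (≤-trans (≤-trans (m≤m+n _ N₃) n-large) (≤-trans (m≤n*m n (suc σ)) M-large))
      ext-M : TuránBound G σ M
      ext-M = extremal-σ G M (≤-trans (≤-trans (m≤m+n N₂ N₄) (n≤1+n _)) #M-large) M-free

      Conclusion : Set
      Conclusion = D G full ≤ b × (D G full ≡ b → Grouped G σ ρ (# M))

      in-range : # M ≤ largest σ ρ (# M + ν) → Conclusion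
      in-range small = ≤-trans (proj₁ ext-G) (≤-reflexive ex≡b) , λ eq → group G n≡ (proj₂ ext-G (trans eq (sym ex≡b)))
        where
        open TuránRange σ τ (# M) ν (≤-trans (≤-reflexive (cong (suc σ *_) (sym n≡))) M-large) small
        ext-G : TuránBound G ρ full
        ext-G = extremal-ρ G full (≤-trans (≤-trans (m≤n+m N₃ _) n-large) (≤-reflexive (sym (#-full n)))) G-free
        ex≡b : 2 * ex ρ (# (full {n})) ≡ b
        ex≡b = cong (2 *_) (trans (cong (ex ρ) (trans (#-full n) n≡)) (sym range-bound))

      rigid-conclusion : CompleteBetween G M N × Multipartite G M (suc σ) T → Conclusion
      rigid-conclusion (complete , K) =
        D-S≤bound G {full} {M} {N} split J-free (proj₁ ext-M) (proj₂ ext-M) complete K ,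
        λ eq → let MB , NB = D-S≡bound G {full} {M} {N} split J-free (proj₁ ext-M) (proj₂ ext-M) complete K eq in
          combine-groups G M refl complete MB NB

      rigid : largest σ ρ (# M + ν) ≤ # M → b ≤ D G full → CompleteBetween G M N × Multipartite G M (suc σ) T
      rigid hi b≤ with B ≤? ν
      ... | yes N-large = descend G N-large (# M) refl split hi M-free G-free J-free b≤
      ... | no ¬N-large = complete-between G {full} {M} {N} {B = B} split J-free (proj₁ ext-M) (<⇒≤ (≰⇒> ¬N-large)) near b≤ ,
                          complete-part G {full} {M} {N} {B = B} split J-free (proj₁ ext-M) (<⇒≤ (≰⇒> ¬N-large)) near b≤
        where
        near : 2 * ex σ (# M) ≤ D G M + 2 * (B * B) → Multipartite G M (suc σ) (T + B * B)
        near = nearly-extremal G M (≤-trans (s≤s (m≤n+m N₄ N₂)) #M-large) M-free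

      by-excess : largest σ ρ (# M + ν) ≤ # M → Dec (b ≤ D G full) → Conclusion
      by-excess hi (yes b≤) = rigid-conclusion (rigid hi b≤)
      -- Below the bound there is nothing to prove, so the structural arguments may assume the
      -- opposite inequality.
      by-excess hi (no ¬b≤) = <⇒≤ (≰⇒> ¬b≤) , λ eq → contradiction (≤-reflexive (sym eq)) ¬b≤

      by-range : Dec (# M ≤ largest σ ρ (# M + ν)) → Conclusion
      by-range (yes small) = in-range small
      by-range (no ¬small) = by-excess (<⇒≤ (≰⇒> ¬small)) (b ≤? D G full)

PartitionBoundAbove : (n₀ σ τ T : ℕ) → Set₁
PartitionBoundAbove n₀ σ τ T = ∀ {n} (G : Graph n) (M : Sub n) → n₀ ≤ n → suc σ * n ≤ suc (σ + suc τ) * # M →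
  ¬ PlusEdge G M σ T → ¬ PlusEdge G full (σ + suc τ) T → JoinFree G full σ τ T →
  D G full ≤ 2 * bound σ τ (# M) (# (not ∘ M)) ×
  (D G full ≡ 2 * bound σ τ (# M) (# (not ∘ M)) → Grouped G σ (σ + suc τ) (# M))

extremal-partition : ∀ σ τ T → 1 ≤ T → ∃[ n₀ ] PartitionBoundAbove n₀ σ τ T
extremal-partition σ τ T 1≤T = assemble (proj₂ (low-degree-vertex σ T 1≤T)) (proj₂ (simonovits σ T 1≤T))
    (proj₂ (simonovits (σ + suc τ) T 1≤T)) (λ L 1≤L → near-extremal σ T L 1≤T 1≤L)
  where
  assemble : ∀ {N₁ N₂ N₃} →
    (LowDegreeAbove N₁ σ T) →
    (TuránBoundAbove N₂ σ T) →
    (TuránBoundAbove N₃ (σ + suc τ) T) →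
    (∀ L → 1 ≤ L → ∀ d → ∃[ N ] NearlyExtremalAbove N σ T d L) →
    ∃[ n₀ ] PartitionBoundAbove n₀ σ τ T
  assemble {N₁} {N₂} {N₃} low-degree extremal-σ extremal-ρ nearly-extremal = _ ,
      Assemble.bounded-with-equality σ τ T N₁ N₂ N₃ (proj₁ near) 1≤T low-degree extremal-σ extremal-ρ (proj₂ near)
    where
    -- `B²` does not depend on `N₄`, for which 0 stands in here. This breaks the apparent circle:
    -- `N₄` is chosen for the deficiency `B²`.
    B² : ℕ
    B² = Assemble.B² σ τ T N₁ N₂ N₃ 0 1≤T low-degree extremal-σ extremal-ρ
    near : ∃[ N ] NearlyExtremalAbove N σ T B² (T + B²)
    near = nearly-extremal (T + B²) (≤-trans 1≤T (m≤m+n T B²)) B²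

-- Pairs inside the parts and pairs between them make up all ordered pairs. Stated for sizes alone,
-- this spares an isomorphism with `turánGraph`.
sum-squares : ∀ {k} (J : Sub k) (p : Fin k → ℕ) σ m → # J ≡ suc σ → sum-over J p ≡ m → Balanced J p →
  sum-over J (λ i → p i * p i) + 2 * ex σ m ≡ m * m
sum-squares J p σ m #J total bal = +-cancelʳ-≡ (suc σ * (κ * suc κ)) _ _ (begin
  sum-over J (λ i → p i * p i) + 2 * ex σ m + suc σ * (κ * suc κ)  ≡⟨ cong (λ x → sum-over J (λ i → p i * p i) + 2 * ex σ m + x * (κ * suc κ)) (sym #J) ⟩
  sum-over J (λ i → p i * p i) + 2 * ex σ m + # J * (κ * suc κ)  ≡⟨ lemma₁ (sum-over J (λ i → p i * p i)) (2 * ex σ m) (# J * (κ * suc κ)) ⟩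
  sum-over J (λ i → p i * p i) + # J * (κ * suc κ) + 2 * ex σ m  ≡⟨ cong (_+ 2 * ex σ m) linear ⟩
  (2 * κ + 1) * m + 2 * ex σ m  ≡⟨ +-comm ((2 * κ + 1) * m) _ ⟩
  2 * ex σ m + (2 * κ + 1) * m  ≡⟨ ex-formula-/ σ m ⟩
  m * m + suc σ * (κ * suc κ)  ∎)
  where
  open ≡-Reasoning
  κ : ℕ
  κ = m / suc σ
  lemma₁ : ∀ a b c → a + b + c ≡ a + c + b
  lemma₁ = solve-∀
  lower : ∀ i → J i ≡ true → κ ≤ p i
  lower = balanced-≥ J bal κ (≤-trans (≤-reflexive (trans (cong (_* κ) #J) (*-comm (suc σ) κ))) (≤-trans (m/n*n≤m m (suc σ)) (≤-reflexive (sym total))))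
  upper : ∀ i → J i ≡ true → p i ≤ suc κ
  upper = balanced-≤ J bal (suc κ) (≤-trans (≤-reflexive (trans total (m≡m%n+[m/n]*n m (suc σ))))
    (≤-trans (+-monoˡ-≤ (κ * suc σ) (<⇒≤ (m%n<n m (suc σ)))) (≤-reflexive (trans (*-comm (suc κ) (suc σ)) (cong (_* suc κ) (sym #J))))))
  -- (x − κ)(x − κ − 1) = 0 makes the square an affine function of x.
  square : ∀ x → κ ≤ x → x ≤ suc κ → x * x + κ * suc κ ≡ (2 * κ + 1) * x
  square x κ≤x x≤ = aux (m≤n⇒m<n∨m≡n x≤)
    where
    identity₁ : ∀ κ → κ * κ + κ * suc κ ≡ (2 * κ + 1) * κ
    identity₁ = solve-∀
    identity₂ : ∀ κ → suc κ * suc κ + κ * suc κ ≡ (2 * κ + 1) * suc κ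
    identity₂ = solve-∀
    aux : x < suc κ ⊎ x ≡ suc κ → x * x + κ * suc κ ≡ (2 * κ + 1) * x
    aux (inj₁ lt) = subst (λ x → x * x + κ * suc κ ≡ (2 * κ + 1) * x) (≤-antisym κ≤x (s≤s⁻¹ lt)) (identity₁ κ)
    aux (inj₂ eq) = subst (λ x → x * x + κ * suc κ ≡ (2 * κ + 1) * x) (sym eq) (identity₂ κ)
  linear : sum-over J (λ i → p i * p i) + # J * (κ * suc κ) ≡ (2 * κ + 1) * m
  linear = begin
    sum-over J (λ i → p i * p i) + # J * (κ * suc κ)  ≡⟨ cong (sum-over J (λ i → p i * p i) +_) (sym (sum-over-const J (κ * suc κ))) ⟩
    sum-over J (λ i → p i * p i) + sum-over J (λ _ → κ * suc κ)  ≡⟨ sym (sum-+ _ _) ⟩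
    sum (λ i → ⟦ J i ⟧ * (p i * p i) + ⟦ J i ⟧ * (κ * suc κ))  ≡⟨ sum-cong (λ i → sym (*-distribˡ-+ ⟦ J i ⟧ (p i * p i) (κ * suc κ))) ⟩
    sum-over J (λ i → p i * p i + κ * suc κ)  ≡⟨ sum-over-cong J (λ i Ji → square (p i) (lower i Ji) (upper i Ji)) ⟩
    sum-over J (λ i → (2 * κ + 1) * p i)  ≡⟨ sum-cong (λ i → lemma₂ ⟦ J i ⟧ (2 * κ + 1) (p i)) ⟩
    sum (λ i → (2 * κ + 1) * (⟦ J i ⟧ * p i))  ≡⟨ sym (*-sum (2 * κ + 1) _) ⟩
    (2 * κ + 1) * sum-over J p  ≡⟨ cong ((2 * κ + 1) *_) total ⟩
    (2 * κ + 1) * m  ∎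
    where
    lemma₂ : ∀ a b c → a * (b * c) ≡ b * (a * c)
    lemma₂ = solve-∀

-- The converse of the equality case: the ordered non-adjacent pairs are those inside a part, so
-- their number is the sum of the squared part sizes, evaluated group by group.
grouped⇒D : ∀ (G : Graph n) σ τ m ν → n ≡ m + ν → Grouped G σ (σ + suc τ) m → D G full ≡ 2 * bound σ τ m ν
grouped⇒D {n} G σ τ m ν n≡ grouped = +-cancelʳ-≡ (squares I + squares (not ∘ I) + (2 * ex σ m + 2 * ex τ ν)) _ _ (begin
  D G full + (squares I + squares (not ∘ I) + (2 * ex σ m + 2 * ex τ ν))
    ≡⟨ sym (+-assoc (D G full) _ _) ⟩
  D G full + (squares I + squares (not ∘ I)) + (2 * ex σ m + 2 * ex τ ν)
    ≡⟨ cong (λ x → D G full + x + (2 * ex σ m + 2 * ex τ ν)) (sym non-edges) ⟩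
  D G full + cross (nonadj G) full full + (2 * ex σ m + 2 * ex τ ν)
    ≡⟨ cong (_+ (2 * ex σ m + 2 * ex τ ν)) (trans (cross-complement G full full) (cong₂ _*_ (#-full n) (#-full n))) ⟩
  n * n + (2 * ex σ m + 2 * ex τ ν)
    ≡⟨ cong (λ n → n * n + (2 * ex σ m + 2 * ex τ ν)) n≡ ⟩
  (m + ν) * (m + ν) + (2 * ex σ m + 2 * ex τ ν)
    ≡⟨ lemma₁ m ν (ex σ m) (ex τ ν) ⟩
  2 * bound σ τ m ν + (m * m + ν * ν)
    ≡⟨ cong₂ (λ x y → 2 * bound σ τ m ν + (x + y)) (sym (sum-squares I p σ m #I total-I balanced)) (sym (sum-squares (not ∘ I) p τ ν #∁I total-∁I balanced-∁)) ⟩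
  2 * bound σ τ m ν + (squares I + 2 * ex σ m + (squares (not ∘ I) + 2 * ex τ ν))
    ≡⟨ cong (2 * bound σ τ m ν +_) (lemma₂ (squares I) (squares (not ∘ I)) (2 * ex σ m) (2 * ex τ ν)) ⟩
  2 * bound σ τ m ν + (squares I + squares (not ∘ I) + (2 * ex σ m + 2 * ex τ ν)) ∎)
  where
  open ≡-Reasoning
  open Grouped grouped
  p : Fin (suc (σ + suc τ)) → ℕ
  p i = # (cls π i)
  squares : Sub (suc (σ + suc τ)) → ℕ
  squares J = sum-over J (λ i → p i * p i)
  split-I : ∀ i → ⟦ full {suc (σ + suc τ)} i ⟧ ≡ ⟦ I i ⟧ + ⟦ not (I i) ⟧
  split-I i = ⟦⟧-complement true (I i)
  lemma₁ : ∀ m ν a b → (m + ν) * (m + ν) + (2 * a + 2 * b) ≡ 2 * (m * ν + a + b) + (m * m + ν * ν)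
  lemma₁ = solve-∀
  lemma₂ : ∀ a b c d → a + c + (b + d) ≡ a + b + (c + d)
  lemma₂ = solve-∀
  total-I : sum-over I p ≡ m
  total-I = trans (sum-over-cls full π I) total
  total-∁I : sum-over (not ∘ I) p ≡ ν
  total-∁I = +-cancelˡ-≡ m _ _ (begin
    m + sum-over (not ∘ I) p  ≡⟨ cong (_+ sum-over (not ∘ I) p) (sym total-I) ⟩
    sum-over I p + sum-over (not ∘ I) p  ≡⟨ sym (sum-over-+ˡ {A = full} {I} {not ∘ I} p split-I) ⟩
    sum-over full p  ≡⟨ sum-over-full p ⟩
    sum p  ≡⟨ trans (sum-cls full π) (#-full n) ⟩
    n                                         ≡⟨ n≡ ⟩
    m + ν  ∎)
  #∁I : # (not ∘ I) ≡ suc τ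
  #∁I = +-cancelˡ-≡ (suc σ) _ _ (trans (cong (_+ # (not ∘ I)) (sym #I))
    (trans (sym (#-complement full I)) (#-full (suc (σ + suc τ)))))
  non-full : ∀ x → non G full x ≡ # (cls π (π x))
  non-full x = sum-cong (λ y → cong ⟦_⟧ (trans (cong not (complete x y)) (trans (Bool.not-involutive _)
    (does-⇔ (π x Fin.≟ π y) (π y Fin.≟ π x) sym sym))))
  non-edges : cross (nonadj G) full full ≡ squares I + squares (not ∘ I)
  non-edges = begin
    sum-over full (non G full)  ≡⟨ sum-over-full (non G full) ⟩
    sum (non G full)  ≡⟨ sum-cong (λ x → trans (non-full x) (sym (sum-⁅⁆ (π x) p))) ⟩
    sum (λ x → sum (λ i → ⟦ cls π i x ⟧ * p i))  ≡⟨ sum-comm _ ⟩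
    sum (λ i → sum (λ x → ⟦ cls π i x ⟧ * p i))  ≡⟨ sum-cong (λ i → sym (sum-* (p i) (λ x → ⟦ cls π i x ⟧))) ⟩
    sum (λ i → p i * p i)  ≡⟨ sym (sum-over-full (λ i → p i * p i)) ⟩
    squares full  ≡⟨ sum-over-+ˡ {A = full} {I} {not ∘ I} (λ i → p i * p i) split-I ⟩
    squares I + squares (not ∘ I)  ∎

-- Embedding edge-critical graphs and their cores

CriticalColouring : Graph k → ℕ → Set
CriticalColouring {k} F j = Σ (Fin k) λ u → Σ (Fin k) λ v → Adj F u v × Σ (Fin k → Fin j) λ c →
  (∀ x y → Adj F x y → ¬ SamePair u v x y → c x ≢ c y) × c u ≡ c v

-- An optimal colouring of the graph without the critical edge. Its ends must share a colour, since
-- otherwise the colouring would be proper for `F` with too few colours.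
critical-colouring : ∀ (F : Graph k) σ → EdgeCritical F → χ F ≡ suc (suc σ) → CriticalColouring F (suc σ)
critical-colouring F σ (u , v , uv , drops) χ≡ = u , v , uv , c , c-proper , same (c u Fin.≟ c v)
  where
  F′ = deleteEdge F u v
  χ′ : ℕ
  χ′ = χ F′
  χ′≤ : χ′ ≤ suc σ
  χ′≤ = s≤s⁻¹ (≤-trans drops (≤-reflexive χ≡))
  d : Colourable F′ χ′
  d = proj₁ (proj₂ (leastColourable F′))
  c : Fin _ → Fin (suc σ)
  c x = Fin.inject≤ (proj₁ d x) χ′≤
  c-proper : ∀ x y → Adj F x y → ¬ SamePair u v x y → c x ≢ c y
  c-proper x y xy other eq = proj₂ d x y (xy , other) (Fin.inject≤-injective χ′≤ χ′≤ _ _ eq)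
  same : Dec (c u ≡ c v) → c u ≡ c v
  same (yes eq) = eq
  same (no ne)  = contradiction (≤-trans (≤-reflexive (sym χ≡)) (proj₂ (proj₂ (leastColourable F)) (suc σ) (c , proper))) 1+n≰n
    where
    proper : Proper F c
    proper x y xy = aux (samePair? u v x y)
      where
      aux : Dec (SamePair u v x y) → c x ≢ c y
      aux (no other)                  = c-proper x y xy other
      aux (yes (inj₁ (refl , refl))) = ne
      aux (yes (inj₂ (refl , refl))) = ne ∘ sym

adj⇒Adj : (G : Graph n) → ∀ {x y} → adj G x y ≡ true → Adj G x y
adj⇒Adj G {x} {y} = does⇒ (adj? G x y)

-- The ends of the critical edge go to `x` and `y`, every other vertex to the part of its colour.
-- Each part holds places for all `k` vertices, so colour classes need not be counted.
plus-edge⊇critical : (G : Graph n) (F : Graph k) → ∀ {S σ T} → EdgeCritical F → χ F ≡ suc (suc σ) → 2 + k ≤ T →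
  PlusEdge G S σ T → Σ (Contains G F) λ (f , _) → ∀ w → S (f w) ≡ true
plus-edge⊇critical {n} {k} G F {S} {σ} {T} critical χ≡ k+2≤T P = embed (critical-colouring F σ critical χ≡)
  where
  open PlusEdge P
  -- `x` and `y` may lie in the part `i`; removing them costs at most two vertices, whence
  -- `2 + k ≤ T`.
  free-part : Fin (suc σ) → Sub n
  free-part j = (part j ─ x) ─ y
  enum : ∀ j → Σ (Fin k → Fin n) λ f → (∀ w → free-part j (f w) ≡ true) × (∀ {w w′} → f w ≡ f w′ → w ≡ w′)
  enum j = enumerate k (free-part j) (s≤s⁻¹ (s≤s⁻¹ (≤-trans k+2≤T (≤-trans (large j) (≤-trans (#-─-≥ (part j) x) (s≤s (#-─-≥ (part j ─ x) y)))))))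
  place : Fin (suc σ) → Fin k → Fin n
  place j = proj₁ (enum j)
  place∈ : ∀ j w → part j (place j w) ≡ true
  place∈ j w = ─⊑ (part j) x _ (─⊑ (part j ─ x) y _ (proj₁ (proj₂ (enum j)) w))
  place≢x : ∀ j w → x ≢ place j w
  place≢x j w = ∉─ (part j) {x} (─⊑ (part j ─ x) y _ (proj₁ (proj₂ (enum j)) w))
  place≢y : ∀ j w → y ≢ place j w
  place≢y j w = ∉─ (part j ─ x) {y} (proj₁ (proj₂ (enum j)) w)

  embed : CriticalColouring F (suc σ) → Σ (Contains G F) λ (f , _) → ∀ w → S (f w) ≡ true
  embed (u , v , uv , c₀ , proper₀ , cu≡cv) = (f , (λ {a} {b} → f-injective {a} {b}) , λ {a} {b} ab → adj⇒Adj G (f-adj ab (locate a) (locate b))) , f∈S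
    where
    -- The colours are permuted so that the colour of u and v names the part i
    c : Fin k → Fin (suc σ)
    c w = transpose (c₀ u) i (c₀ w)
    c-injective : ∀ {a b} → c a ≡ c b → c₀ a ≡ c₀ b
    c-injective {a} {b} eq = trans (sym (transpose-inverse i (c₀ u))) (trans (cong (transpose i (c₀ u)) eq) (transpose-inverse i (c₀ u)))
    c-u : c u ≡ i
    c-u rewrite dec-true (c₀ u Fin.≟ c₀ u) refl = refl
    proper : ∀ a b → Adj F a b → ¬ SamePair u v a b → c a ≢ c b
    proper a b ab other = proper₀ a b ab other ∘ c-injective

    f′ : ∀ w → Dec (w ≡ u) → Dec (w ≡ v) → Fin n
    f′ w (yes _) _       = x
    f′ w (no _)  (yes _) = y
    f′ w (no _)  (no _)  = place (c w) w
    f : Fin k → Fin n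
    f w = f′ w (w Fin.≟ u) (w Fin.≟ v)

    Location : Fin k → Set
    Location w = (w ≡ u × f w ≡ x) ⊎ (w ≡ v × f w ≡ y) ⊎ (w ≢ u × w ≢ v × f w ≡ place (c w) w)
    locate : ∀ w → Location w
    locate w = aux (w Fin.≟ u) (w Fin.≟ v)
      where
      aux : ∀ p q → (w ≡ u × f′ w p q ≡ x) ⊎ (w ≡ v × f′ w p q ≡ y) ⊎ (w ≢ u × w ≢ v × f′ w p q ≡ place (c w) w)
      aux (yes eq) _        = inj₁ (eq , refl)
      aux (no _)   (yes eq) = inj₂ (inj₁ (eq , refl))
      aux (no p)   (no q)   = inj₂ (inj₂ (p , q , refl))

    x-place : ∀ {w} → c w ≢ i → adj G x (place (c w) w) ≡ true
    x-place {w} ne = x-joined ne (place∈ (c w) w)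
    y-place : ∀ {w} → c w ≢ i → adj G y (place (c w) w) ≡ true
    y-place {w} ne = y-joined ne (place∈ (c w) w)
    c-v : c v ≡ i
    c-v = trans (cong (transpose (c₀ u) i) (sym cu≡cv)) c-u

    not-u : ∀ {w} → w ≢ v → w ≢ u → ¬ SamePair u v u w
    not-u w≢v w≢u (inj₁ (_ , eq)) = w≢v eq
    not-u w≢v w≢u (inj₂ (_ , eq)) = w≢u eq
    not-v : ∀ {w} → w ≢ v → w ≢ u → ¬ SamePair u v v w
    not-v w≢v w≢u (inj₁ (_ , eq)) = w≢v eq
    not-v w≢v w≢u (inj₂ (_ , eq)) = w≢u eq

    u-other : ∀ {w} → w ≢ u → w ≢ v → Adj F u w → adj G x (place (c w) w) ≡ true
    u-other {w} w≢u w≢v uw = x-place (λ eq → proper u w uw (not-u w≢v w≢u) (trans c-u (sym eq)))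
    v-other : ∀ {w} → w ≢ u → w ≢ v → Adj F v w → adj G y (place (c w) w) ≡ true
    v-other {w} w≢u w≢v vw = y-place (λ eq → proper v w vw (not-v w≢v w≢u) (trans c-v (sym eq)))

    via : ∀ {z w p q} → z ≡ p → w ≡ q → adj G p q ≡ true → adj G z w ≡ true
    via p q = subst₂ (λ p q → adj G p q ≡ true) (sym p) (sym q)

    f-adj : ∀ {a b} → Adj F a b → Location a → Location b → adj G (f a) (f b) ≡ true
    f-adj ab (inj₁ (refl , _)) (inj₁ (refl , _)) = contradiction ab (irrefl F refl)
    f-adj ab (inj₁ (_ , p)) (inj₂ (inj₁ (_ , q))) = via p q x~y
    f-adj ab (inj₁ (refl , p)) (inj₂ (inj₂ (b≢u , b≢v , q))) = via p q (u-other b≢u b≢v ab)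
    f-adj ab (inj₂ (inj₁ (_ , p))) (inj₁ (_ , q)) = via p q (adj-flip G x~y)
    f-adj ab (inj₂ (inj₁ (refl , _))) (inj₂ (inj₁ (refl , _))) = contradiction ab (irrefl F refl)
    f-adj ab (inj₂ (inj₁ (refl , p))) (inj₂ (inj₂ (b≢u , b≢v , q))) = via p q (v-other b≢u b≢v ab)
    f-adj ab (inj₂ (inj₂ (a≢u , a≢v , p))) (inj₁ (refl , q)) = via p q (adj-flip G (u-other a≢u a≢v (symm F ab)))
    f-adj ab (inj₂ (inj₂ (a≢u , a≢v , p))) (inj₂ (inj₁ (refl , q))) = via p q (adj-flip G (v-other a≢u a≢v (symm F ab)))
    f-adj {a} {b} ab (inj₂ (inj₂ (a≢u , a≢v , p))) (inj₂ (inj₂ (b≢u , b≢v , q))) =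
      via p q (joined (proper a b ab (λ { (inj₁ (eq , _)) → a≢u eq ; (inj₂ (eq , _)) → a≢v eq })) (place∈ (c a) a) (place∈ (c b) b))

    f-injective : ∀ {a b} → f a ≡ f b → a ≡ b
    f-injective {a} {b} eq = aux (locate a) (locate b)
      where
      aux : Location a → Location b → a ≡ b
      aux (inj₁ (p , _)) (inj₁ (q , _)) = trans p (sym q)
      aux (inj₁ (_ , p)) (inj₂ (inj₁ (_ , q))) = contradiction (trans (sym p) (trans eq q)) (adj⇒≢ G x~y)
      aux (inj₁ (_ , p)) (inj₂ (inj₂ (_ , _ , q))) = contradiction (trans (sym p) (trans eq q)) (place≢x (c b) b)
      aux (inj₂ (inj₁ (_ , p))) (inj₁ (_ , q)) = contradiction (trans (sym q) (trans (sym eq) p)) (adj⇒≢ G x~y)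
      aux (inj₂ (inj₁ (p , _))) (inj₂ (inj₁ (q , _))) = trans p (sym q)
      aux (inj₂ (inj₁ (_ , p))) (inj₂ (inj₂ (_ , _ , q))) = contradiction (trans (sym p) (trans eq q)) (place≢y (c b) b)
      aux (inj₂ (inj₂ (_ , _ , p))) (inj₁ (_ , q)) = contradiction (trans (sym q) (trans (sym eq) p)) (place≢x (c a) a)
      aux (inj₂ (inj₂ (_ , _ , p))) (inj₂ (inj₁ (_ , q))) = contradiction (trans (sym q) (trans (sym eq) p)) (place≢y (c a) a)
      aux (inj₂ (inj₂ (_ , _ , p))) (inj₂ (inj₂ (_ , _ , q))) = same-class (c a Fin.≟ c b) (trans (sym p) (trans eq q))
        where
        same-class : Dec (c a ≡ c b) → place (c a) a ≡ place (c b) b → a ≡ b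
        same-class (yes ca≡cb) eq′ = proj₂ (proj₂ (enum (c b))) (trans (cong (λ j → place j a) (sym ca≡cb)) eq′)
        same-class (no ca≢cb) eq′ = contradiction eq′ (adj⇒≢ G (joined ca≢cb (place∈ (c a) a) (place∈ (c b) b)))

    f∈S : ∀ w → S (f w) ≡ true
    f∈S w = aux (locate w)
      where
      aux : Location w → S (f w) ≡ true
      aux (inj₁ (_ , p))               = trans (cong S p) x∈S
      aux (inj₂ (inj₁ (_ , p)))        = trans (cong S p) y∈S
      aux (inj₂ (inj₂ (_ , _ , p)))    = trans (cong S p) (inside (c w) _ (place∈ (c w) w))

nth-surjective : (M : Subset n) → ∀ {x} → lookup M x ≡ true → ∃[ i ] nth M i ≡ x
nth-surjective (true  ∷ M) {zero}  _ = zero , refl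
nth-surjective (true  ∷ M) {suc x} h = let i , eq = nth-surjective M h in suc i , cong suc eq
nth-surjective (false ∷ M) {suc x} h = let i , eq = nth-surjective M h in i , cong suc eq

induced-contains : (G : Graph n) (M : Subset n) (F : Graph k) → ((f , _) : Contains G F) → (∀ w → lookup M (f w) ≡ true) →
  Contains (G [ M ]) F
induced-contains G M F (f , f-inj , f-adj) f∈M = (λ w → proj₁ (at w)) ,
    (λ {a} {b} eq → f-inj (trans (sym (proj₂ (at a))) (trans (cong (nth M) eq) (proj₂ (at b))))) ,
    λ {a} {b} ab → subst₂ (Adj G) (sym (proj₂ (at a))) (sym (proj₂ (at b))) (f-adj ab)
  where
  at : ∀ w → ∃[ i ] nth M i ≡ f w
  at w = nth-surjective M (f∈M w)

firstVertices⁻ : ∀ {h t} i (vs : Vec (Fin h) t) {w} → w ∈ firstVertices i vs → ∃[ a ] lookup vs a ≡ w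
firstVertices⁻ zero    vs       w∈ = contradiction w∈ ∉⊥
firstVertices⁻ (suc i) []       w∈ = contradiction w∈ ∉⊥
firstVertices⁻ (suc i) (v ∷ vs) w∈ = [ (λ w∈v → zero , sym (x∈⁅y⁆⇒x≡y v w∈v))
                                     , (λ w∈vs → let a , eq = firstVertices⁻ i vs w∈vs in suc a , eq)
                                     ]′ (x∈p∪q⁻ ⁅ v ⁆ _ w∈)

-- The `t` vertices removed from `H` go to `t` vertices of the clique, and one end `u` of the
-- critical edge of the core to the remaining one. What is left of the core is properly coloured
-- with `suc σ` colours and fits into the multipartite part, to which the clique is joined.
join⊇ : (G : Graph n) → ∀ {h t} (H : Graph h) (vs : Vec (Fin h) t) σ {S T} → let F = H -vertices firstVertices t vs in
  EdgeCritical F → χ F ≡ suc (suc σ) → h ≤ T →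
  (K : Multipartite G S (suc σ) T) ((q , _) : Clique G S (suc t)) →
  (∀ a j x → Multipartite.part K j x ≡ true → adj G (q a) x ≡ true) → Contains G H
join⊇ {n} G {h} {t} H vs σ {S} {T} critical χ≡ h≤T K (q , _ , q-adj) q-joined = embed (critical-colouring F σ critical χ≡)
  where
  P : Subset h
  P = firstVertices t vs
  F = H -vertices P
  open Multipartite K
  enum : ∀ j → Σ (Fin ∣ ∁ P ∣ → Fin n) λ f → (∀ w → part j (f w) ≡ true) × (∀ {w w′} → f w ≡ f w′ → w ≡ w′)
  enum j = enumerate ∣ ∁ P ∣ (part j) (≤-trans (∣p∣≤n (∁ P)) (≤-trans h≤T (large j)))
  place : Fin (suc σ) → Fin ∣ ∁ P ∣ → Fin n
  place j = proj₁ (enum j)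
  place∈ : ∀ j w → part j (place j w) ≡ true
  place∈ j = proj₁ (proj₂ (enum j))

  embed : CriticalColouring F (suc σ) → Contains G H
  embed (u , v , _ , c , proper , _) = f , (λ {a} {b} → f-injective {a} {b}) , λ {a} {b} ab → adj⇒Adj G (f-adj ab (locate a) (locate b))
    where
    Kind : Fin h → Set
    Kind w = (∃[ a ] lookup vs a ≡ w) ⊎ (∃[ b ] nth (∁ P) b ≡ w)
    kind : ∀ w → Kind w
    kind w = aux (w ∈? P)
      where
      aux : Dec (w ∈ P) → Kind w
      aux (yes w∈P) = inj₁ (firstVertices⁻ t vs w∈P)
      aux (no w∉P)  = inj₂ (nth-surjective (∁ P) ([]=⇒lookup (x∉p⇒x∈∁p w∉P)))
    f′ : ∀ {w} → Kind w → Fin n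
    f″ : ∀ b → Dec (b ≡ u) → Fin n
    f″ b (yes _) = q zero
    f″ b (no _)  = place (c b) b
    f′ (inj₁ (a , _)) = q (suc a)
    f′ (inj₂ (b , _)) = f″ b (b Fin.≟ u)
    f : Fin h → Fin n
    f w = f′ (kind w)

    Location : Fin h → Set
    Location w = (Σ (Fin t) λ a → lookup vs a ≡ w × f w ≡ q (suc a)) ⊎
                 (nth (∁ P) u ≡ w × f w ≡ q zero) ⊎
                 (Σ (Fin ∣ ∁ P ∣) λ b → nth (∁ P) b ≡ w × b ≢ u × f w ≡ place (c b) b)
    locate : ∀ w → Location w
    locate w = aux (kind w)
      where
      aux″ : ∀ b → nth (∁ P) b ≡ w → (d : Dec (b ≡ u)) →
        (Σ (Fin t) λ a → lookup vs a ≡ w × f″ b d ≡ q (suc a)) ⊎ (nth (∁ P) u ≡ w × f″ b d ≡ q zero) ⊎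
        (Σ (Fin ∣ ∁ P ∣) λ b′ → nth (∁ P) b′ ≡ w × b′ ≢ u × f″ b d ≡ place (c b′) b′)
      aux″ b eq (yes b≡u) = inj₂ (inj₁ (trans (cong (nth (∁ P)) (sym b≡u)) eq , refl))
      aux″ b eq (no b≢u)  = inj₂ (inj₂ (b , eq , b≢u , refl))
      aux : (κ : Kind w) → (Σ (Fin t) λ a → lookup vs a ≡ w × f′ κ ≡ q (suc a)) ⊎ (nth (∁ P) u ≡ w × f′ κ ≡ q zero) ⊎
        (Σ (Fin ∣ ∁ P ∣) λ b → nth (∁ P) b ≡ w × b ≢ u × f′ κ ≡ place (c b) b)
      aux (inj₁ (a , eq)) = inj₁ (a , eq , refl)
      aux (inj₂ (b , eq)) = aux″ b eq (b Fin.≟ u)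

    via : ∀ {z w p q} → z ≡ p → w ≡ q → adj G p q ≡ true → adj G z w ≡ true
    via p q = subst₂ (λ p q → adj G p q ≡ true) (sym p) (sym q)

    to-place : ∀ a b → adj G (q a) (place (c b) b) ≡ true
    to-place a b = q-joined a (c b) _ (place∈ (c b) b)

    f-adj : ∀ {x y} → Adj H x y → Location x → Location y → adj G (f x) (f y) ≡ true
    f-adj xy (inj₁ (a , refl , p)) (inj₁ (b , refl , r)) = via p r (q-adj (suc a) (suc b) (λ eq → irrefl H (cong (lookup vs) (Fin.suc-injective eq)) xy))
    f-adj xy (inj₁ (a , _ , p)) (inj₂ (inj₁ (_ , r))) = via p r (q-adj (suc a) zero λ ())
    f-adj xy (inj₁ (a , _ , p)) (inj₂ (inj₂ (b , _ , _ , r))) = via p r (to-place (suc a) b)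
    f-adj xy (inj₂ (inj₁ (_ , p))) (inj₁ (b , _ , r)) = via p r (q-adj zero (suc b) λ ())
    f-adj xy (inj₂ (inj₁ (refl , _))) (inj₂ (inj₁ (refl , _))) = contradiction xy (irrefl H refl)
    f-adj xy (inj₂ (inj₁ (_ , p))) (inj₂ (inj₂ (b , _ , _ , r))) = via p r (to-place zero b)
    f-adj xy (inj₂ (inj₂ (a , _ , _ , p))) (inj₁ (b , _ , r)) = via p r (adj-flip G (to-place (suc b) a))
    f-adj xy (inj₂ (inj₂ (a , _ , _ , p))) (inj₂ (inj₁ (_ , r))) = via p r (adj-flip G (to-place zero a))
    f-adj xy (inj₂ (inj₂ (a , refl , a≢u , p))) (inj₂ (inj₂ (b , refl , b≢u , r))) = via p r
      (joined (proper a b xy (λ { (inj₁ (eq , _)) → a≢u eq ; (inj₂ (_ , eq)) → b≢u eq })) (place∈ (c a) a) (place∈ (c b) b))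

    distinct : ∀ {z w p q} {X : Set} → z ≡ w → z ≡ p → w ≡ q → adj G p q ≡ true → X
    distinct eq p q pq = ⊥-elim (adj⇒≢ G pq (trans (sym p) (trans eq q)))

    f-injective : ∀ {x y} → f x ≡ f y → x ≡ y
    f-injective {x} {y} eq = aux (locate x) (locate y)
      where
      aux : Location x → Location y → x ≡ y
      aux (inj₁ (a , ax , p)) (inj₁ (b , by , r)) = same (a Fin.≟ b)
        where
        same : Dec (a ≡ b) → x ≡ y
        same (yes a≡b) = trans (sym ax) (trans (cong (lookup vs) a≡b) by)
        same (no a≢b)  = distinct eq p r (q-adj (suc a) (suc b) (a≢b ∘ Fin.suc-injective))
      aux (inj₁ (a , _ , p)) (inj₂ (inj₁ (_ , r))) = distinct eq p r (q-adj (suc a) zero λ ())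
      aux (inj₁ (a , _ , p)) (inj₂ (inj₂ (b , _ , _ , r))) = distinct eq p r (to-place (suc a) b)
      aux (inj₂ (inj₁ (_ , p))) (inj₁ (b , _ , r)) = distinct eq p r (q-adj zero (suc b) λ ())
      aux (inj₂ (inj₁ (ux , _))) (inj₂ (inj₁ (uy , _))) = trans (sym ux) uy
      aux (inj₂ (inj₁ (_ , p))) (inj₂ (inj₂ (b , _ , _ , r))) = distinct eq p r (to-place zero b)
      aux (inj₂ (inj₂ (a , _ , _ , p))) (inj₁ (b , _ , r)) = distinct eq p r (adj-flip G (to-place (suc b) a))
      aux (inj₂ (inj₂ (a , _ , _ , p))) (inj₂ (inj₁ (_ , r))) = distinct eq p r (adj-flip G (to-place zero a))
      aux (inj₂ (inj₂ (a , ax , _ , p))) (inj₂ (inj₂ (b , by , _ , r))) = same (c a Fin.≟ c b)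
        where
        same : Dec (c a ≡ c b) → x ≡ y
        same (yes ca≡cb) = trans (sym ax) (trans (cong (nth (∁ P)) (proj₂ (proj₂ (enum (c b)))
          (trans (cong (λ j → place j a) (sym ca≡cb)) (trans (sym p) (trans eq r))))) by)
        same (no ca≢cb)  = distinct eq p r (joined ca≢cb (place∈ (c a) a) (place∈ (c b) b))

-- Translation

count-allFin : ∀ {P : Fin n → Set} (P? : ∀ i → Dec (P i)) → count P? (allFin n) ≡ # (λ i → does (P? i))
count-allFin P? = count-tabulate P? id
  where
  count-tabulate : ∀ {m} {A : Set} {P : A → Set} (P? : ∀ i → Dec (P i)) (f : Fin m → A) →
    count P? (Vec.tabulate f) ≡ sum (λ i → ⟦ does (P? (f i)) ⟧)
  count-tabulate {zero}  P? f = sym (sum-empty _)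
  count-tabulate {suc m} P? f = trans (aux (does (P? (f zero)))) (sym (sum-suc _))
    where
    aux : ∀ b → (if b then suc else id) (count P? (Vec.tabulate (f ∘ suc))) ≡ ⟦ b ⟧ + sum (λ i → ⟦ does (P? (f (suc i))) ⟧)
    aux true  = cong suc (count-tabulate P? (f ∘ suc))
    aux false = count-tabulate P? (f ∘ suc)

∣∣≡# : (p : Subset n) → ∣ p ∣ ≡ # (lookup p)
∣∣≡# []          = sym (sum-empty _)
∣∣≡# (true ∷ p)  = trans (cong suc (∣∣≡# p)) (sym (sum-suc _))
∣∣≡# (false ∷ p) = trans (∣∣≡# p) (sym (sum-suc _))

does-∈? : (p : Subset n) → ∀ x → does (x ∈? p) ≡ lookup p x
does-∈? p x = aux (true∨false (lookup p x))
  where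
  aux : lookup p x ≡ true ⊎ lookup p x ≡ false → does (x ∈? p) ≡ lookup p x
  aux (inj₁ px) = trans (dec-true (x ∈? p) (lookup⇒[]= x p px)) (sym px)
  aux (inj₂ px) = trans (dec-false (x ∈? p) (λ x∈p → true≢false ([]=⇒lookup x∈p) px)) (sym px)

totalSize≡# : (π : Fin n → Fin k) (I : Subset k) → totalSize π I ≡ # (lookup I ∘ π)
totalSize≡# π I = trans (count-allFin (λ v → π v ∈? I)) (sum-cong (λ v → cong ⟦_⟧ (does-∈? I (π v))))

partSize≡# : (π : Fin n → Fin k) → ∀ i → partSize π i ≡ # (cls π i)
partSize≡# π i = count-allFin (λ v → π v Fin.≟ i)

module _ (π : Fin n → Fin k) (I : Subset k) where

  asEqualAsPossible⇒balanced : AsEqualAsPossible π I → Balanced (lookup I) (λ i → # (cls π i))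
  asEqualAsPossible⇒balanced eq i j Ii Ij = subst₂ (λ a b → a ≤ suc b) (partSize≡# π i) (partSize≡# π j)
    (eq i j (lookup⇒[]= i I Ii) (lookup⇒[]= j I Ij))

  balanced⇒asEqualAsPossible : Balanced (lookup I) (λ i → # (cls π i)) → AsEqualAsPossible π I
  balanced⇒asEqualAsPossible bal i j i∈I j∈I = subst₂ (λ a b → a ≤ suc b) (sym (partSize≡# π i)) (sym (partSize≡# π j))
    (bal i j ([]=⇒lookup i∈I) ([]=⇒lookup j∈I))

balanced-cong : {J J′ : Sub k} {p : Fin k → ℕ} → (∀ i → J i ≡ J′ i) → Balanced J p → Balanced J′ p
balanced-cong J≗J′ bal i j Ji Jj = bal i j (trans (J≗J′ i) Ji) (trans (J≗J′ j) Jj)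

lookup-∁ : (I : Subset k) → ∀ i → lookup (∁ I) i ≡ not (lookup I i)
lookup-∁ I i = lookup-map i not I

GroupedPartite : Graph n → (r s t m ν : ℕ) → Set
GroupedPartite {n} G r s t m ν =
  Σ (Fin n → Fin r) λ π → CompletePartiteWith G π × (∃[ I ] BalancedGroup π I s m × BalancedGroup π (∁ I) t ν)

module _ (G : Graph n) (σ τ m ν : ℕ) (n≡ : n ≡ m + ν) where

  grouped⇒partite : Grouped G σ (σ + suc τ) m → GroupedPartite G (suc σ + suc τ) (suc σ) (suc τ) m ν
  grouped⇒partite grouped = π , completePartite , I′ , (#I′ , total′ , balanced′) , (#∁I′ , total-∁ , balanced-∁′)
    where
    open Grouped grouped
    I′ : Subset (suc σ + suc τ)
    I′ = Vec.tabulate I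
    I≗ : ∀ i → I i ≡ lookup I′ i
    I≗ i = sym (lookup∘tabulate I i)
    ∁I≗ : ∀ i → not (I i) ≡ lookup (∁ I′) i
    ∁I≗ i = trans (cong not (I≗ i)) (sym (lookup-∁ I′ i))
    completePartite : CompletePartiteWith G π
    completePartite u v = mk⇔
      (λ uv eq → true≢false (trans (sym (complete u v)) (dec-true (adj? G u v) uv)) (cong not (dec-true (π u Fin.≟ π v) eq)))
      (λ ne → adj⇒Adj G (trans (complete u v) (cong not (dec-false (π u Fin.≟ π v) ne))))
    #I′ : ∣ I′ ∣ ≡ suc σ
    #I′ = trans (∣∣≡# I′) (trans (sum-cong (λ i → cong ⟦_⟧ (sym (I≗ i)))) #I)
    #∁I′ : ∣ ∁ I′ ∣ ≡ suc τ
    #∁I′ = trans (∣∁p∣≡n∸∣p∣ I′) (trans (cong (suc σ + suc τ ∸_) #I′) (m+n∸m≡n (suc σ) (suc τ)))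
    total′ : totalSize π I′ ≡ m
    total′ = trans (totalSize≡# π I′) (trans (sum-cong (λ v → cong ⟦_⟧ (sym (I≗ (π v))))) total)
    total-∁ : totalSize π (∁ I′) ≡ ν
    total-∁ = trans (totalSize≡# π (∁ I′)) (trans (sum-cong (λ v → cong ⟦_⟧ (sym (∁I≗ (π v)))))
      (+-cancelˡ-≡ m _ _ (trans (cong (_+ # (not ∘ I ∘ π)) (sym total)) (trans (sym (#-complement full (I ∘ π))) (trans (#-full n) n≡)))))
    balanced′ : AsEqualAsPossible π I′
    balanced′ = balanced⇒asEqualAsPossible π I′ (balanced-cong I≗ balanced)
    balanced-∁′ : AsEqualAsPossible π (∁ I′)
    balanced-∁′ = balanced⇒asEqualAsPossible π (∁ I′) (balanced-cong ∁I≗ balanced-∁)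

  partite⇒grouped : GroupedPartite G (suc σ + suc τ) (suc σ) (suc τ) m ν → Grouped G σ (σ + suc τ) m
  partite⇒grouped (π , completePartite , I , (#I , total , balanced) , (_ , _ , balanced-∁)) = record
    { π = π
    ; complete = λ u v → does-⇔ (adj? G u v) (¬? (π u Fin.≟ π v)) (Equivalence.to (completePartite u v)) (Equivalence.from (completePartite u v))
    ; I = lookup I
    ; #I = trans (sym (∣∣≡# I)) #I
    ; total = trans (sym (totalSize≡# π I)) total
    ; balanced = asEqualAsPossible⇒balanced π I balanced
    ; balanced-∁ = balanced-cong (lookup-∁ I) (asEqualAsPossible⇒balanced π (∁ I) balanced-∁)
    }

-- `n₀` is fixed before the core: a core has at most `h` vertices, so `T = 2 + h` serves `H` and all
-- its cores at once.
corollary-ℕ : ∀ σ τ {h} (H : Graph h) → EdgeCritical H → χ H ≡ suc σ + suc τ + 1 →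
  ∃[ n₀ ] (∀ {k} (F : Graph k) → Core (suc τ) H F → ∀ n → n ≥ n₀ → (G : Graph n) → G IsFreeOf H →
    ∀ (M : Subset n) (m : ℕ) → ∣ M ∣ ≡ m → (G [ M ]) IsFreeOf F → suc σ * n ≤ (suc σ + suc τ) * m →
    let bnd = m * (n ∸ m) + turánNumber (suc σ) m + turánNumber (suc τ) (n ∸ m) in
    e G ≤ bnd × (e G ≡ bnd ⇔ GroupedPartite G (suc σ + suc τ) (suc σ) (suc τ) m (n ∸ m)))
corollary-ℕ σ τ {h} H H-critical χ≡ = _ , main (proj₂ (extremal-partition σ τ (2 + h) (s≤s z≤n)))
  where
  T : ℕ
  T = 2 + h
  χ-H : χ H ≡ suc (suc (σ + suc τ))
  χ-H = trans χ≡ (+-comm (suc σ + suc τ) 1)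
  main : ∀ {n₀} → (PartitionBoundAbove n₀ σ τ T) →
    ∀ {k} (F : Graph k) → Core (suc τ) H F → ∀ n → n ≥ n₀ → (G : Graph n) → G IsFreeOf H →
    ∀ (M : Subset n) (m : ℕ) → ∣ M ∣ ≡ m → (G [ M ]) IsFreeOf F → suc σ * n ≤ (suc σ + suc τ) * m →
    let bnd = m * (n ∸ m) + turánNumber (suc σ) m + turánNumber (suc τ) (n ∸ m) in
    e G ≤ bnd × (e G ≡ bnd ⇔ GroupedPartite G (suc σ + suc τ) (suc σ) (suc τ) m (n ∸ m))
  main stability F (core vs critical) n n≥ G H-free M m #M F-free m-large =
    *-cancelˡ-≤ 2 (≤-trans (≤-reflexive (sym (D-full G))) (≤-trans (proj₁ result′) (≤-reflexive bounds))) ,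
    mk⇔ (λ eq → grouped⇒partite G σ τ m (n ∸ m) n≡ (subst (Grouped G σ (σ + suc τ)) #M≡
          (proj₂ result′ (trans (D-full G) (trans (cong (2 *_) eq) (sym bounds))))))
        (λ partite → *-cancelˡ-≡ _ _ 2 (trans (sym (D-full G))
          (trans (grouped⇒D G σ τ m (n ∸ m) n≡ (partite⇒grouped G σ τ m (n ∸ m) n≡ partite)) (cong (2 *_) bound≡))))
    where
    M′ : Sub n
    M′ = lookup M
    #M≡ : # M′ ≡ m
    #M≡ = trans (sym (∣∣≡# M)) #M
    n≡ : n ≡ m + (n ∸ m)
    n≡ = sym (m+[n∸m]≡n (≤-trans (≤-reflexive (sym #M)) (∣p∣≤n M)))
    #N≡ : # (not ∘ M′) ≡ n ∸ m
    #N≡ = +-cancelˡ-≡ m _ _ (trans (cong (_+ # (not ∘ M′)) (sym #M≡)) (trans (sym (#-complement full M′)) (trans (#-full n) n≡)))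
    bound≡ : bound σ τ m (n ∸ m) ≡ m * (n ∸ m) + turánNumber (suc σ) m + turánNumber (suc τ) (n ∸ m)
    bound≡ = cong₂ (λ a b → m * (n ∸ m) + a + b) (ex≡turánNumber σ m) (ex≡turánNumber τ (n ∸ m))
    bounds : 2 * bound σ τ (# M′) (# (not ∘ M′)) ≡ 2 * (m * (n ∸ m) + turánNumber (suc σ) m + turánNumber (suc τ) (n ∸ m))
    bounds = cong (2 *_) (trans (cong₂ (bound σ τ) #M≡ #N≡) bound≡)
    F-critical : EdgeCritical F
    F-critical = proj₁ (critical (suc τ) (s≤s z≤n) ≤-refl)
    χ-F : χ F ≡ suc (suc σ)
    χ-F = +-cancelʳ-≡ (suc τ) _ _ (trans (proj₂ (critical (suc τ) (s≤s z≤n) ≤-refl)) χ-H)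
    M-free : ¬ PlusEdge G M′ σ T
    M-free P = let f , f∈ = plus-edge⊇critical G F F-critical χ-F (s≤s (s≤s (∣p∣≤n (∁ (firstVertices (suc τ) vs))))) P in
      F-free (induced-contains G M F f f∈)
    G-free : ¬ PlusEdge G full (σ + suc τ) T
    G-free P = H-free (proj₁ (plus-edge⊇critical G H H-critical χ-H ≤-refl P))
    J-free : JoinFree G full σ τ T
    J-free K q joined = H-free (join⊇ G H vs σ F-critical χ-F (m≤n+m h 2) K q joined)
    result′ : D G full ≤ 2 * bound σ τ (# M′) (# (not ∘ M′)) ×
      (D G full ≡ 2 * bound σ τ (# M′) (# (not ∘ M′)) → Grouped G σ (σ + suc τ) (# M′))
    result′ = stability G M′ n≥ (≤-trans m-large (≤-reflexive (cong ((suc σ + suc τ) *_) (sym #M≡)))) M-free G-free J-free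

-- Rational ceilings and the final form

open import Data.Integer using (+_) renaming (_≥_ to _≥ᶻ_)
import Data.Integer as ℤ
import Data.Integer.DivMod as ℤ
import Data.Integer.GCD as ℤ
import Data.Integer.Properties as ℤ
open import Data.Rational using (ceiling; ↥_; ↧_) renaming (_/_ to _/ℚ_)
import Data.Rational as ℚ
import Data.Rational.Properties as ℚ

-- `ceiling p` is minus the floor of `- p`, so this is the inequality for the floor of `- p` with
-- reversed signs.
↥≤ceiling*↧ : ∀ p → ↥ p ℤ.≤ ceiling p ℤ.* ↧ p
↥≤ceiling*↧ p@record{} = begin
  ↥ p  ≡⟨ sym (ℤ.neg-involutive (↥ p)) ⟩
  ℤ.- (ℤ.- (↥ p))  ≡⟨ cong ℤ.-_ (sym (ℚ.↥-neg p)) ⟩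
  ℤ.- (↥ (ℚ.- p))  ≤⟨ ℤ.neg-mono-≤ (floor*↧≤↥ (ℚ.- p)) ⟩
  ℤ.- (ℚ.floor (ℚ.- p) ℤ.* ↧ (ℚ.- p))      ≡⟨ ℤ.neg-distribˡ-* (ℚ.floor (ℚ.- p)) (↧ (ℚ.- p)) ⟩
  ceiling p ℤ.* ↧ (ℚ.- p)  ≡⟨ cong (ceiling p ℤ.*_) (ℚ.↧-neg p) ⟩
  ceiling p ℤ.* ↧ p  ∎
  where
  open ℤ.≤-Reasoning
  floor*↧≤↥ : ∀ q → ℚ.floor q ℤ.* ↧ q ℤ.≤ ↥ q
  floor*↧≤↥ q@record{} = ℤ.[n/d]*d≤n (↥ q) (↧ q)

-- The fraction is stored in lowest terms; multiplying by the gcd restores `a` and `r`.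
≥ceiling⇒≤* : ∀ a r .{{_ : NonZero r}} m → + m ≥ᶻ ceiling (+ a /ℚ r) → a ≤ r * m
≥ceiling⇒≤* a r m m≥ = ℤ.drop‿+≤+ (begin
  + a  ≡⟨ sym (ℚ.↥-/ (+ a) r) ⟩
  ↥ p ℤ.* g  ≤⟨ ℤ.*-monoʳ-≤-nonNeg g (↥≤ceiling*↧ p) ⟩
  ceiling p ℤ.* ↧ p ℤ.* g  ≡⟨ ℤ.*-assoc (ceiling p) (↧ p) g ⟩
  ceiling p ℤ.* (↧ p ℤ.* g)  ≡⟨ cong (ceiling p ℤ.*_) (ℚ.↧-/ (+ a) r) ⟩
  ceiling p ℤ.* + r  ≤⟨ ℤ.*-monoʳ-≤-nonNeg (+ r) m≥ ⟩
  + m ℤ.* + r  ≡⟨ ℤ.*-comm (+ m) (+ r) ⟩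
  + r ℤ.* + m  ≡⟨ sym (ℤ.pos-* r m) ⟩
  + (r * m)  ∎)
  where
  open ℤ.≤-Reasoning
  p = + a /ℚ r
  g = ℤ.gcd (+ a) (+ r)

-- A separate variable `t` for `r ∸ s` allows matching on `r ≡ s + t`, so that no term is
-- transported along an identity of truncated subtraction.
corollary-split : ∀ r s t .{{_ : NonZero r}} .{{_ : NonZero s}} .{{_ : NonZero t}} → r ≡ s + t → s ≥ 1 → t ≥ 1 →
  ∀ {h} (H : Graph h) → EdgeCritical H → χ H ≡ r + 1 →
  ∃[ n₀ ] (∀ {k} (F : Graph k) → Core t H F → ∀ n → n ≥ n₀ → (G : Graph n) → G IsFreeOf H →
    ∀ (M : Subset n) (m : ℕ) → ∣ M ∣ ≡ m → (G [ M ]) IsFreeOf F → + m ≥ᶻ ceiling (+ (s * n) /ℚ r) →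
    let bnd = m * (n ∸ m) + turánNumber s m + turánNumber t (n ∸ m) in
    e G ≤ bnd × (e G ≡ bnd ⇔ GroupedPartite G r s t m (n ∸ m)))
corollary-split _ (suc σ) (suc τ) refl _ _ H H-critical χ≡ = _ ,
  λ F F-core n n≥ G H-free M m #M F-free m≥ → proj₂ (corollary-ℕ σ τ H H-critical χ≡) F F-core n n≥ G H-free M m #M F-free
    (≥ceiling⇒≤* (suc σ * n) (suc σ + suc τ) m m≥)

corollary1 :
    ∀ (r s : ℕ) (r>s : r > s) (s≥1 : s ≥ 1) →
    let instance
          r≢0 : NonZero r
          r≢0 = >-nonZero (m<n⇒0<n r>s)
          s≢0 : NonZero s
          s≢0 = >-nonZero s≥1
          r∸s≢0 : NonZero (r ∸ s)
          r∸s≢0 = >-nonZero (m<n⇒0<n∸m r>s)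
    in
    ∀ {h} (H : Graph h) → ProgressiveEdgeCritical (r ∸ s) H → χ H ≡ r + 1 →
    ∃[ n₀ ] (∀ {k} (F : Graph k) → Core (r ∸ s) H F →
      ∀ n → n ≥ n₀ → (G : Graph n) → G IsFreeOf H →
      ∀ (M : Subset n) (m : ℕ) → ∣ M ∣ ≡ m → (G [ M ]) IsFreeOf F →
      + m ≥ᶻ ceiling (+ (s * n) /ℚ r) →
      let bound = m * (n ∸ m) + turánNumber s m + turánNumber (r ∸ s) (n ∸ m) in
      e G ≤ bound ×
      (e G ≡ bound ⇔
        (Σ (Fin n → Fin r) λ π → CompletePartiteWith G π × (∃[ I ]
          BalancedGroup π I s m × BalancedGroup π (∁ I) (r ∸ s) (n ∸ m)))))
corollary1 r s r>s s≥1 H (H-critical , _) χ≡ =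
  corollary-split r s (r ∸ s) {{>-nonZero (m<n⇒0<n r>s)}} {{>-nonZero s≥1}} {{>-nonZero (m<n⇒0<n∸m r>s)}}
    (sym (m+[n∸m]≡n (<⇒≤ r>s))) s≥1 (m<n⇒0<n∸m r>s) H H-critical χ≡
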